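{- There is an algorithm that, given two limits $L_1$ and $L_2$, decides whether $[\![L_1]\!]\subseteq[\![L_2]\!]$.
   Context: Fix an effective and absorbing intruder model $(\Sigma,\vdash)$: messages are terms over a countably infinite set of names and a finite constructor signature $\Sigma$; $\vdash$ is a decidable relation between finite sets of messages and messages satisfying: $\{M\}\vdash M$; $\Gamma\subseteq\Gamma'$, $\Gamma\vdash M$ imply $\Gamma'\vdash M$; $\Gamma\vdash M$ and $\Gamma\cup\{M\}\vdash N$ imply $\Gamma\vdash N$; $\{M_1,\dots,M_n\}\vdash f(M_1,\dots,M_n)$ for each constructor $f$ of arity $n$; $\Gamma\theta\vdash M\theta$ iff $\Gamma\vdash M$ for each injective renaming $\theta$ of the names of $\Gamma$ into names; $\Gamma\cup\{a\}\vdash M$ with $a$ a name not in $\Gamma,M$ implies $\Gamma\vdash M$; (absorbing) for all lists $\vec x,\vec y$ of pairwise distinct names, finite $\Gamma$ whose names are disjoint from $\vec y$, $\Gamma'=\Gamma\{\vec x\mapsto\vec y\}$, and $M$ whose names all occur in $\Gamma$: $\Gamma\cup\Gamma'\vdash M$ iff $\Gamma\vdash M$. $\Gamma_1\preceq\Gamma_2$ iff every $M$ with $\Gamma_1\vdash M$ has $\Gamma_2\vdash M$; $\Gamma_1\simeq\Gamma_2$ iff both directions. Processes: $P::=0\mid\nu x.P\mid P\parallel P\mid\langle M\rangle\mid\mathsf Q[M_1,\dots,M_n]$ ($\nu x$ binds $x$; $\langle M\rangle$: $M$ known to intruder); $\langle\Gamma\rangle$ = parallel composition of $\langle M\rangle$,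 $M\in\Gamma$. $\equiv$: smallest congruence containing $\alpha$-equivalence, with $\parallel$ associative-commutative with neutral $0$, $\nu a.0\equiv0$, $\nu a.\nu b.P\equiv\nu b.\nu a.P$, $P\parallel\nu a.Q\equiv\nu a.(P\parallel Q)$ if $a$ not free in $P$. $\cong$: smallest congruence containing $\equiv$ with $\langle\Gamma_1\rangle\cong\langle\Gamma_2\rangle$ when $\Gamma_1\simeq\Gamma_2$. $P_1\sqsubseteq P_2$ iff $P_1\equiv\nu\vec x.(\langle\Gamma_1\rangle\parallel Q)$, $P_2\equiv\nu\vec x.\nu\vec y.(\langle\Gamma_2\rangle\parallel Q\parallel Q')$ with $\Gamma_1\preceq\Gamma_2$. Limits: $L::=0\mid R_1\parallel\dots\parallel R_n$, $R::=B\mid B^\omega$, $B::=\langle M\rangle\mid\mathsf Q[\vec M]\mid\nu x.L$. Instances: $\mathrm{inst}(0)=\{0\}$, $\mathrm{inst}(\langle M\rangle)=\{\langle M\rangle\}$, $\mathrm{inst}(\mathsf Q[\vec M])=\{\mathsf Q[\vec M]\}$, $\mathrm{inst}(L_1\parallel L_2)=\{P_1\parallel P_2\mid P_i\in\mathrm{inst}(L_i)\}$, $\mathrm{inst}(\nu x.L)=\{\nu x.P\mid P\in\mathrm{inst}(L)\}$, $\mathrm{inst}(B^\omega)=\bigcup_{n\in\mathbb N}\{P_1\parallel\dots\parallel P_n\mid P_i\in\mathrm{inst}(B)\}$. The denotation is $[\![L]\!]=\{P\mid\exists P'\in\mathrm{inst}(L),\ P\sqsubseteq P'\}$. -}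

module Defs where

open import Data.Nat using (ℕ)
open import Data.Nat.Properties using (_≟_)
open import Data.Fin using (Fin)
open import Data.Vec using (Vec; []; _∷_; toList)
open import Data.List using (List; []; _∷_; _++_; map; concatMap; filter; zip; length)
open import Data.List.Membership.Propositional using (_∈_; _∉_)
open import Data.List.Relation.Binary.Subset.Propositional using (_⊆_)
open import Data.List.Relation.Unary.Unique.Propositional using (Unique)
open import Data.Product using (Σ; _×_; _,_)
open import Function.Definitions using (Injective)
open import Relation.Binary.PropositionalEquality using (_≡_)
open import Relation.Nullary using (yes; no; ¬?)

Name : Set
Name = ℕ

record Signature : Set where
  field
    nCon  : ℕ
    arity : Fin nCon → ℕ

module Terms (S : Signature) where
  open Signature S

  data Msg : Set where
    name : Name → Msg
    app  : (f : Fin nCon) → Vec Msg (arity f) → Msg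

  mutual
    namesM : Msg → List Name
    namesM (name a)   = a ∷ []
    namesM (app f ms) = namesV ms

    namesV : ∀ {n} → Vec Msg n → List Name
    namesV []       = []
    namesV (m ∷ ms) = namesM m ++ namesV ms

  namesL : List Msg → List Name
  namesL = concatMap namesM

  mutual
    renM : (Name → Name) → Msg → Msg
    renM θ (name a)   = name (θ a)
    renM θ (app f ms) = app f (renV θ ms)

    renV : ∀ {n} → (Name → Name) → Vec Msg n → Vec Msg n
    renV θ []       = []
    renV θ (m ∷ ms) = renM θ m ∷ renV θ ms

  substPairs : List (Name × Name) → Name → Name
  substPairs []             a = a
  substPairs ((x , y) ∷ ps) a with a ≟ x
  ... | yes _ = y
  ... | no  _ = substPairs ps a

-- Intruder models (effective and absorbing). Finite sets of messages are
-- represented by lists; ⊢ is invariant under list permutation/duplication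
-- by the monotonicity axiom.

record IntruderModel : Set₁ where
  field
    sig : Signature
  open Signature sig public
  open Terms sig public
  field
    _⊢_       : List Msg → Msg → Set
    ⊢-dec     : ∀ Γ M → Relation.Nullary.Dec (Γ ⊢ M)
    ax-refl   : ∀ M → (M ∷ []) ⊢ M
    ax-mono   : ∀ {Γ Γ' M} → Γ ⊆ Γ' → Γ ⊢ M → Γ' ⊢ M
    ax-cut    : ∀ {Γ M N} → Γ ⊢ M → (M ∷ Γ) ⊢ N → Γ ⊢ N
    ax-cons   : ∀ (f : Fin nCon) (ms : Vec Msg (arity f)) → toList ms ⊢ app f ms
    ax-rename : ∀ (θ : Name → Name) → Injective _≡_ _≡_ θ → ∀ Γ M →
                (map (renM θ) Γ ⊢ renM θ M → Γ ⊢ M) × (Γ ⊢ M → map (renM θ) Γ ⊢ renM θ M)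
    ax-fresh  : ∀ Γ M a → a ∉ namesL Γ → a ∉ namesM M → (name a ∷ Γ) ⊢ M → Γ ⊢ M
    ax-absorb : ∀ (xs ys : List Name) Γ M →
                Unique xs → Unique ys → length xs ≡ length ys →
                (∀ y → y ∈ ys → y ∉ namesL Γ) →
                namesM M ⊆ namesL Γ →
                ((Γ ++ map (renM (substPairs (zip xs ys))) Γ) ⊢ M → Γ ⊢ M)
                × (Γ ⊢ M → (Γ ++ map (renM (substPairs (zip xs ys))) Γ) ⊢ M)

module Processes (S : Signature) where
  open Terms S

  infixr 5 _∥_
  data Proc : Set where
    𝟘    : Proc
    ν    : Name → Proc → Proc
    _∥_  : Proc → Proc → Proc
    ⟨_⟩  : Msg → Proc
    Qc   : ℕ → List Msg → Proc      -- process constant Q[M₁,…,Mₙ]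

  removeName : Name → List Name → List Name
  removeName x = filter (λ y → ¬? (y ≟ x))

  fvP : Proc → List Name
  fvP 𝟘        = []
  fvP (ν x P)  = removeName x (fvP P)
  fvP (P ∥ Q)  = fvP P ++ fvP Q
  fvP ⟨ M ⟩    = namesM M
  fvP (Qc q Ms) = namesL Ms

  occP : Proc → List Name
  occP 𝟘        = []
  occP (ν x P)  = x ∷ occP P
  occP (P ∥ Q)  = occP P ++ occP Q
  occP ⟨ M ⟩    = namesM M
  occP (Qc q Ms) = namesL Ms

  renameP : Name → Name → Proc → Proc
  renameP x y 𝟘 = 𝟘
  renameP x y (ν z P) with z ≟ x
  ... | yes _ = ν z P
  ... | no  _ = ν z (renameP x y P)
  renameP x y (P ∥ Q)   = renameP x y P ∥ renameP x y Q
  renameP x y ⟨ M ⟩     = ⟨ renM (substPairs ((x , y) ∷ [])) M ⟩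
  renameP x y (Qc q Ms) = Qc q (map (renM (substPairs ((x , y) ∷ []))) Ms)

  infix 4 _≡ₛ_
  data _≡ₛ_ : Proc → Proc → Set where
    ≡-refl  : ∀ {P} → P ≡ₛ P
    ≡-sym   : ∀ {P Q} → P ≡ₛ Q → Q ≡ₛ P
    ≡-trans : ∀ {P Q R} → P ≡ₛ Q → Q ≡ₛ R → P ≡ₛ R
    ≡-ν     : ∀ {x P Q} → P ≡ₛ Q → ν x P ≡ₛ ν x Q
    ≡-∥     : ∀ {P P' Q Q'} → P ≡ₛ P' → Q ≡ₛ Q' → (P ∥ Q) ≡ₛ (P' ∥ Q')
    ≡-α     : ∀ {x y P} → y ∉ occP P → ν x P ≡ₛ ν y (renameP x y P)
    ≡-assoc : ∀ {P Q R} → ((P ∥ Q) ∥ R) ≡ₛ (P ∥ (Q ∥ R))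
    ≡-comm  : ∀ {P Q} → (P ∥ Q) ≡ₛ (Q ∥ P)
    ≡-unit  : ∀ {P} → (P ∥ 𝟘) ≡ₛ P
    ≡-ν𝟘    : ∀ {a} → ν a 𝟘 ≡ₛ 𝟘
    ≡-νν    : ∀ {a b P} → ν a (ν b P) ≡ₛ ν b (ν a P)
    ≡-extr  : ∀ {a P Q} → a ∉ fvP P → (P ∥ ν a Q) ≡ₛ ν a (P ∥ Q)

  νs : List Name → Proc → Proc
  νs []       P = P
  νs (x ∷ xs) P = ν x (νs xs P)

  ⟪_⟫ : List Msg → Proc
  ⟪ [] ⟫         = 𝟘
  ⟪ M ∷ [] ⟫     = ⟨ M ⟩
  ⟪ M ∷ M' ∷ Γ ⟫ = ⟨ M ⟩ ∥ ⟪ M' ∷ Γ ⟫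

  -- Limits:  L ::= 0 | R₁ ∥ … ∥ Rₙ ,  R ::= B | B^ω ,  B ::= ⟨M⟩ | Q[M⃗] | νx.L
  -- A limit is represented by its list of components R₁ … Rₙ (empty list = 0).
  mutual
    Limit : Set
    Limit = List Rep

    data Rep : Set where
      once  : Base → Rep
      omega : Base → Rep

    data Base : Set where
      msgB : Msg → Base
      QB   : ℕ → List Msg → Base
      νB   : Name → Limit → Base

  mutual
    data InstL : Limit → Proc → Set where
      inst-0    : InstL [] 𝟘
      inst-one  : ∀ {R P} → InstR R P → InstL (R ∷ []) P
      inst-par  : ∀ {R R' Rs P P'} → InstR R P → InstL (R' ∷ Rs) P' →
                  InstL (R ∷ R' ∷ Rs) (P ∥ P')

    data InstR : Rep → Proc → Set where
      inst-once  : ∀ {B P} → InstB B P → InstR (once B) P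
      inst-omega : ∀ {B P} → InstMany B P → InstR (omega B) P

    data InstMany : Base → Proc → Set where
      many-0 : ∀ {B} → InstMany B 𝟘
      many+  : ∀ {B P} → InstMany⁺ B P → InstMany B P

    data InstMany⁺ : Base → Proc → Set where
      many-one  : ∀ {B P} → InstB B P → InstMany⁺ B P
      many-cons : ∀ {B P P'} → InstB B P → InstMany⁺ B P' → InstMany⁺ B (P ∥ P')

    data InstB : Base → Proc → Set where
      inst-msg : ∀ {M} → InstB (msgB M) ⟨ M ⟩
      inst-Q   : ∀ {q Ms} → InstB (QB q Ms) (Qc q Ms)
      inst-ν   : ∀ {x L P} → InstL L P → InstB (νB x L) (ν x P)

module Semantics (I : IntruderModel) where
  open IntruderModel I
  open Processes sig

  _⪯_ : List Msg → List Msg → Set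
  Γ₁ ⪯ Γ₂ = ∀ M → Γ₁ ⊢ M → Γ₂ ⊢ M

  _⊑_ : Proc → Proc → Set
  P₁ ⊑ P₂ = Σ (List Name) λ xs → Σ (List Name) λ ys →
            Σ (List Msg) λ Γ₁ → Σ (List Msg) λ Γ₂ → Σ Proc λ Q → Σ Proc λ Q' →
              (P₁ ≡ₛ νs xs (⟪ Γ₁ ⟫ ∥ Q))
            × (P₂ ≡ₛ νs xs (νs ys (⟪ Γ₂ ⟫ ∥ Q ∥ Q')))
            × (Γ₁ ⪯ Γ₂)

  ⟦_⟧ : Limit → Proc → Set
  ⟦ L ⟧ P = Σ Proc λ P' → InstL L P' × (P ⊑ P')

  DenotIncl : Limit → Limit → Set
  DenotIncl L₁ L₂ = ∀ P → ⟦ L₁ ⟧ P → ⟦ L₂ ⟧ P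

LimitOf : IntruderModel → Set
LimitOf I = Processes.Limit (IntruderModel.sig I)

DenotationIncluded : (I : IntruderModel) → LimitOf I → LimitOf I → Set
DenotationIncluded I = Semantics.DenotIncl I

{-# OPTIONS --safe #-}
module Submission where

-- A process flattens to a finite configuration of messages and tagged process constants, once its binders
-- are given names; ⊑ is an embedding of configurations in which the names not free in the larger process
-- may be chosen. (In this order the free names of the smaller process can be captured by the additional
-- binders of the larger one.)
--
-- A limit unfolds to templates: an item at nesting depth d of repetitions is instantiated for every index
-- vector in ℕᵈ, a name bound at depth d' ≤ d depending only on the first d' indices. Because the order is
-- sensitive to which free names occur, the limit is first restricted to each set F of admissible free names.
-- Inclusion then says: for every number n of copies and every choice O of instances of binders of L₁ that are
-- named by free names, the n-fold instance of L₁ embeds into some instance of L₂.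
--
-- This is decided by three finiteness arguments. (1) The indices of the opened binders can be renamed to be
-- small. (2) If n is large, then by the pigeonhole principle one of the n copies below each node is mapped
-- away from the paths to the images of the names it shares with the rest; shifting the first index that
-- leaves these paths yields disjoint images for arbitrarily many further copies. (3) The image of an
-- embedding can be renamed to small indices, and by absorption the remaining copies in L₂ beyond one that is
-- unused derive nothing more.

open import Defs
open import Data.Empty using (⊥; ⊥-elim)
open import Data.Fin using (Fin; toℕ)
import Data.Fin.Properties as FinP
open import Data.List hiding (fromMaybe; sum; find)
open import Data.List.Membership.Propositional using (_∈_; _∉_; find; lose)
open import Data.List.Membership.Propositional.Properties
open import Data.List.Properties using (length-map; map-∘; map-cong; map-injective; take-map; length-++; map-++; ++-assoc; ++-identityʳ; ++-cancelˡ; ∷-injectiveˡ; ∷-injectiveʳ; ≡-dec)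
open import Data.List.Relation.Binary.Permutation.Propositional as Perm using (_↭_; prep; swap; ↭-refl; ↭-sym; ↭-trans; ↭⇒↭ₛ)
import Data.List.Relation.Binary.Permutation.Propositional.Properties as PermP
import Data.List.Relation.Binary.Permutation.Setoid.Properties as PermS
open import Data.List.Relation.Binary.Subset.Propositional using (_⊆_)
open import Data.List.Relation.Unary.All as All using (All; []; _∷_)
open import Data.List.Relation.Unary.AllPairs using ([]; _∷_)
open import Data.List.Relation.Unary.Any as Any using (Any; here; there)
import Data.List.Relation.Unary.Any.Properties as AnyP
open import Data.List.Relation.Unary.Unique.Propositional using (Unique)
import Data.List.Relation.Unary.Unique.Propositional.Properties as Uniq
open import Data.Maybe using (Maybe; just; nothing; fromMaybe)
open import Data.Maybe.Properties using (just-injective)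
open import Data.Nat
import Data.Nat.Binary as B
import Data.Nat.Binary.Properties as BP
open import Data.Nat.ListAction using (sum)
open import Data.Nat.Properties
open import Data.Product using (∃; _×_; _,_; proj₁; proj₂)
open import Data.Product.Properties as ProdP using (,-injective; ,-injectiveˡ; ,-injectiveʳ)
open import Data.Sum as Sum using (_⊎_; inj₁; inj₂)
open import Data.Unit using (⊤; tt)
open import Data.Vec using (Vec; []; _∷_; toList)
open import Function using (_∘_; id; const)
open import Function.Definitions using (Injective)
open import Relation.Binary using (DecidableEquality; Setoid)
open import Relation.Binary.PropositionalEquality hiding ([_])
import Relation.Binary.Reasoning.Setoid as SetoidR
open import Relation.Nullary
open import Relation.Nullary.Decidable using (map′)
open import Relation.Unary using (Decidable)
open import Data.List.Membership.DecPropositional _≟_ using (_∈?_)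
open import Data.List.Membership.DecPropositional (ProdP.≡-dec _≟_ (≡-dec _≟_)) using () renaming (_∈?_ to _∈ᵏ?_)
open import Data.List.Membership.DecPropositional (ProdP.≡-dec _≟_ (ProdP.≡-dec _≟_ (≡-dec _≟_))) using () renaming (_∈?_ to _∈ᵒ?_)
open import Data.List.Relation.Unary.Unique.DecPropositional.Properties _≟_ using (deduplicate-!)

-- The choice `O` originates in the order. If `E` flattens `P`, then `proc E`, which is `P` without
-- its binders, lies below `P`; so a denotation contains its instances with the bound names made
-- free under any distinct names. A larger process matches such a name by a binder, or by the same
-- name if that name is free in it. Hence a test has to record only which keys of `L₁` carry names
-- of `L₂`. The set `F₂` of free names of the larger instance is part of the search, because a name
-- of `L₂` that does not occur in that instance is still available for one of its binders. The
-- obstacle to pumping is that copies are not independent: they share the names bound outside, and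
-- several copies of `L₁` may be embedded in one copy of `L₂`. No level of `L₂` is the right one to
-- duplicate for all images. Instead each image is moved at the index where it parts from the images
-- of the shared names, and it suffices that the model copy has no image on those paths. A derivable
-- message may contain names absent from the knowledge. Coverings therefore constrain the shape of
-- the images of names, but not their indices, and use additional identifiers for names that the
-- target does not contain.

concatMap∈⁺ : ∀ {A C : Set} (f : A → List C) {x : A} {y : C} {xs : List A} → x ∈ xs → y ∈ f x → y ∈ concatMap f xs
concatMap∈⁺ f x∈ y∈ = ∈-concatMap⁺ f (Any.map (λ { refl → y∈ }) x∈)

concatMap∈⁻ : ∀ {A C : Set} (f : A → List C) {y : C} (xs : List A) → y ∈ concatMap f xs → ∃ λ x → x ∈ xs × y ∈ f x
concatMap∈⁻ f (x ∷ xs) y∈ with ∈-++⁻ (f x) y∈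
... | inj₁ p = x , here refl , p
... | inj₂ p with concatMap∈⁻ f xs p
...   | x' , q , r = x' , there q , r

Unique-resp-↭ : ∀ {A : Set} {xs ys : List A} → xs ↭ ys → Unique xs → Unique ys
Unique-resp-↭ {A} p = PermS.Unique-resp-↭ (setoid A) (↭⇒↭ₛ p)

Unique-++⁻ : ∀ {A : Set} (xs : List A) {ys : List A} → Unique (xs ++ ys) →
             Unique xs × Unique ys × (∀ {a} → a ∈ xs → a ∉ ys)
Unique-++⁻ [] u = [] , u , λ ()
Unique-++⁻ (x ∷ xs) (x# ∷ u) with Unique-++⁻ xs u
... | u₁ , u₂ , d = (All.tabulate λ a∈ → All.lookup x# (∈-++⁺ˡ a∈)) ∷ u₁ , u₂ ,
  λ { (here refl) b∈ → All.lookup x# (∈-++⁺ʳ xs b∈) refl ; (there a∈) → d a∈ }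

Unique-++⁺ : ∀ {A : Set} {xs ys : List A} → Unique xs → Unique ys → (∀ {a} → a ∈ xs → a ∉ ys) → Unique (xs ++ ys)
Unique-++⁺ u v d = Uniq.++⁺ u v λ (p , q) → d p q

Unique-∷⁺ : ∀ {A : Set} {x : A} {xs : List A} → x ∉ xs → Unique xs → Unique (x ∷ xs)
Unique-∷⁺ x∉ u = All.tabulate (λ { p refl → x∉ p }) ∷ u

Unique-∷⁻ : ∀ {A : Set} {x : A} {xs : List A} → Unique (x ∷ xs) → x ∉ xs × Unique xs
Unique-∷⁻ u@(_ ∷ v) = Uniq.Unique[x∷xs]⇒x∉xs u , v

InjOn : ∀ {A C : Set} → (A → C) → List A → Set
InjOn f xs = ∀ {a b} → a ∈ xs → b ∈ xs → f a ≡ f b → a ≡ b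

Unique-map-InjOn : ∀ {A C : Set} (f : A → C) {xs : List A} → InjOn f xs → Unique xs → Unique (map f xs)
Unique-map-InjOn f {[]} inj u = []
Unique-map-InjOn f {x ∷ xs} inj u with Unique-∷⁻ u
... | x∉ , v = Unique-∷⁺ (λ p → let (y , y∈ , e) = ∈-map⁻ f p in
    x∉ (subst (_∈ xs) (sym (inj (here refl) (there y∈) e)) y∈))
  (Unique-map-InjOn f (λ a b → inj (there a) (there b)) v)

bound : List ℕ → ℕ
bound []       = 0
bound (x ∷ xs) = suc x ⊔ bound xs

∈⇒<bound : ∀ {a xs} → a ∈ xs → a < bound xs
∈⇒<bound {xs = x ∷ xs} (here refl) = m≤m⊔n (suc x) (bound xs)
∈⇒<bound {xs = x ∷ xs} (there p)   = ≤-trans (∈⇒<bound p) (m≤n⊔m (suc x) (bound xs))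

bound≤⇒∉ : ∀ {a xs} → bound xs ≤ a → a ∉ xs
bound≤⇒∉ b≤ a∈ = <-irrefl refl (<-≤-trans (∈⇒<bound a∈) b≤)

-- `ax-rename` asks for injectivity on all names, whereas most renamings below are injective only on
-- the finitely many names at hand. Outside `xs` the values are moved past all images of `xs`.
extend : (ℕ → ℕ) → List ℕ → ℕ → ℕ
extend θ xs a with a ∈? xs
... | yes _ = θ a
... | no  _ = bound (map θ xs) + a

extend-∈ : ∀ θ xs {a} → a ∈ xs → extend θ xs a ≡ θ a
extend-∈ θ xs {a} a∈ with a ∈? xs
... | yes _ = refl
... | no n  = ⊥-elim (n a∈)

extend-injective : ∀ θ xs → InjOn θ xs → Injective _≡_ _≡_ (extend θ xs)
extend-injective θ xs inj {a} {b} e with a ∈? xs | b ∈? xs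
... | yes p | yes q = inj p q e
... | yes p | no _  = ⊥-elim (bound≤⇒∉ (≤-trans (m≤m+n _ b) (≤-reflexive (sym e))) (∈-map⁺ θ p))
... | no _  | yes q = ⊥-elim (bound≤⇒∉ (≤-trans (m≤m+n _ a) (≤-reflexive e)) (∈-map⁺ θ q))
... | no _  | no _  = +-cancelˡ-≡ (bound (map θ xs)) a b e

_[_↦_] : ∀ {A : Set} → (Name → A) → Name → A → Name → A
(ρ [ x ↦ y ]) a with a ≟ x
... | yes _ = y
... | no  _ = ρ a

[↦]-same : ∀ {A : Set} (ρ : Name → A) (x : Name) (y : A) → (ρ [ x ↦ y ]) x ≡ y
[↦]-same ρ x y with x ≟ x
... | yes _ = refl
... | no n  = ⊥-elim (n refl)

[↦]-other : ∀ {A : Set} (ρ : Name → A) {x : Name} {y : A} {a : Name} → a ≢ x → (ρ [ x ↦ y ]) a ≡ ρ a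
[↦]-other ρ {x} {y} {a} a≢ with a ≟ x
... | yes e = ⊥-elim (a≢ e)
... | no _  = refl

-- ℕᵇ is the type of finite bit strings, so a list of numbers is written in unary with separators.
consᵇ : ℕ → B.ℕᵇ → B.ℕᵇ
consᵇ zero    b = B.2[1+ b ]
consᵇ (suc n) b = B.1+[2 consᵇ n b ]

encodeᵇ : List ℕ → B.ℕᵇ
encodeᵇ = foldr consᵇ B.zero

decodeᵇ : B.ℕᵇ → List ℕ
decodeᵇ B.zero     = []
decodeᵇ B.2[1+ b ] = 0 ∷ decodeᵇ b
decodeᵇ B.1+[2 b ] with decodeᵇ b
... | []     = []
... | n ∷ ns = suc n ∷ ns

decodeᵇ-encodeᵇ : ∀ ns → decodeᵇ (encodeᵇ ns) ≡ ns
decodeᵇ-encodeᵇ []             = refl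
decodeᵇ-encodeᵇ (zero ∷ ns)    = cong (0 ∷_) (decodeᵇ-encodeᵇ ns)
decodeᵇ-encodeᵇ (suc n ∷ ns) rewrite decodeᵇ-encodeᵇ (n ∷ ns) = refl

abstract
  code : List ℕ → ℕ
  code = B.toℕ ∘ encodeᵇ

  decode : ℕ → List ℕ
  decode = decodeᵇ ∘ B.fromℕ

  decode-code : ∀ ns → decode (code ns) ≡ ns
  decode-code ns = trans (cong decodeᵇ (BP.fromℕ-toℕ (encodeᵇ ns))) (decodeᵇ-encodeᵇ ns)

code-injective : ∀ {ms ns} → code ms ≡ code ns → ms ≡ ns
code-injective {ms} {ns} e = trans (sym (decode-code ms)) (trans (cong decode e) (decode-code ns))

sublists : ∀ {A : Set} → List A → List (List A)
sublists []       = [] ∷ []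
sublists (x ∷ xs) = sublists xs ++ map (x ∷_) (sublists xs)

filter∈sublists : ∀ {A : Set} {P : A → Set} (P? : Decidable P) (xs : List A) → filter P? xs ∈ sublists xs
filter∈sublists P? [] = here refl
filter∈sublists P? (x ∷ xs) with P? x
... | yes _ = ∈-++⁺ʳ (sublists xs) (∈-map⁺ (x ∷_) (filter∈sublists P? xs))
... | no _  = ∈-++⁺ˡ (filter∈sublists P? xs)

∈sublists⇒⊆ : ∀ {A : Set} (xs : List A) {ys : List A} → ys ∈ sublists xs → ∀ {y} → y ∈ ys → y ∈ xs
∈sublists⇒⊆ [] (here refl) ()
∈sublists⇒⊆ (x ∷ xs) p y∈ with ∈-++⁻ (sublists xs) p
... | inj₁ q = there (∈sublists⇒⊆ xs q y∈)
... | inj₂ q with ∈-map⁻ (x ∷_) q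
...   | zs , zs∈ , refl with y∈
...     | here e   = here e
...     | there y' = there (∈sublists⇒⊆ xs zs∈ y')

-- The maximum of finitely many thresholds serves for all. It provides one number of copies, or one
-- bound on indices, for finitely many objects.
commonBound : ∀ {A : Set} {P : ℕ → A → Set} → (∀ {m n x} → m ≤ n → P m x → P n x) →
              (xs : List A) → (∀ {x} → x ∈ xs → ∃ λ m → P m x) → ∃ λ m → ∀ {x} → x ∈ xs → P m x
commonBound mono [] h = 0 , λ ()
commonBound mono (x ∷ xs) h with h (here refl) | commonBound mono xs (h ∘ there)
... | m , p | n , q = m ⊔ n , λ { (here refl) → mono (m≤m⊔n m n) p ; (there x∈) → mono (m≤n⊔m m n) (q x∈) }

-- Without repetitions in `xs`, set inclusion is multiset inclusion. This is how tags make multisets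
-- of process constants comparable by membership.
Unique-⊆⇒↭ : ∀ {A : Set} (xs : List A) {ys : List A} → Unique xs → (∀ {x} → x ∈ xs → x ∈ ys) → ∃ λ zs → ys ↭ xs ++ zs
Unique-⊆⇒↭ [] {ys} u s = ys , ↭-refl
Unique-⊆⇒↭ (x ∷ xs) {ys} u s with Unique-∷⁻ u | ∈-∃++ (s (here refl))
... | x∉ , v | as , bs , refl with Unique-⊆⇒↭ xs {as ++ bs} v s'
  where
    s' : ∀ {y} → y ∈ xs → y ∈ as ++ bs
    s' y∈ with ∈-++⁻ as (s (there y∈))
    ... | inj₁ p = ∈-++⁺ˡ p
    ... | inj₂ (here refl) = ⊥-elim (x∉ y∈)
    ... | inj₂ (there p) = ∈-++⁺ʳ as p
...   | zs , p = zs , ↭-trans (PermP.shift x as bs) (prep x p)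

-- Index vectors

InR : (ℕ → ℕ) → List ℕ → Set
InR r []      = ⊤
InR r (i ∷ v) = i < r 0 × InR (r ∘ suc) v

vecs : ℕ → (ℕ → ℕ) → List (List ℕ)
vecs zero    r = [] ∷ []
vecs (suc d) r = concatMap (λ i → map (i ∷_) (vecs d (r ∘ suc))) (upTo (r 0))

∈vecs⁺ : ∀ {d r} v → length v ≡ d → InR r v → v ∈ vecs d r
∈vecs⁺ [] refl _ = here refl
∈vecs⁺ {r = r} (i ∷ v) refl (i< , p) =
  concatMap∈⁺ (λ i → map (i ∷_) (vecs (length v) (r ∘ suc))) (∈-upTo⁺ i<) (∈-map⁺ (i ∷_) (∈vecs⁺ v refl p))

∈vecs⁻ : ∀ d {r v} → v ∈ vecs d r → length v ≡ d × InR r v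
∈vecs⁻ zero (here refl) = refl , tt
∈vecs⁻ (suc d) {r} v∈ with concatMap∈⁻ (λ i → map (i ∷_) (vecs d (r ∘ suc))) (upTo (r 0)) v∈
... | i , i∈ , p with ∈-map⁻ (i ∷_) p
...   | w , w∈ , refl with ∈vecs⁻ d w∈
...     | l , q = cong suc l , ∈-upTo⁻ i∈ , q

InR-mono : ∀ {r r'} v → (∀ i → r i ≤ r' i) → InR r v → InR r' v
InR-mono []      h p        = tt
InR-mono (i ∷ v) h (q , p) = <-≤-trans q (h 0) , InR-mono v (h ∘ suc) p

InR-take : ∀ {r} n v → InR r v → InR r (take n v)
InR-take zero    v       p       = tt
InR-take (suc n) []      p       = tt
InR-take (suc n) (i ∷ v) (q , p) = q , InR-take n v p

InR⇒All : ∀ {m} v → InR (const m) v → All (_< m) v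
InR⇒All []      p       = []
InR⇒All (i ∷ v) (q , p) = q ∷ InR⇒All v p

All⇒InR : ∀ {m} v → All (_< m) v → InR (const m) v
All⇒InR []      []      = tt
All⇒InR (i ∷ v) (q ∷ p) = q , All⇒InR v p

All-bound : ∀ v → All (_< bound v) v
All-bound v = All.tabulate ∈⇒<bound

length-take-≤ : ∀ n (v : List ℕ) → n ≤ length v → length (take n v) ≡ n
length-take-≤ zero    v       l       = refl
length-take-≤ (suc n) (x ∷ v) (s≤s l) = cong suc (length-take-≤ n v l)

take-length : ∀ n (v : List ℕ) → length v ≡ n → take n v ≡ v
take-length zero    []      e = refl
take-length (suc n) (x ∷ v) e = cong (x ∷_) (take-length n v (suc-injective e))

take-length-++ : ∀ (v w : List ℕ) → take (length v) (v ++ w) ≡ v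
take-length-++ []      w = refl
take-length-++ (x ∷ v) w = cong (x ∷_) (take-length-++ v w)

take-take-≤ : ∀ m n (v : List ℕ) → m ≤ n → take m (take n v) ≡ take m v
take-take-≤ zero    n       v       l       = refl
take-take-≤ (suc m) (suc n) []      (s≤s l) = refl
take-take-≤ (suc m) (suc n) (x ∷ v) (s≤s l) = cong (x ∷_) (take-take-≤ m n v l)

updR : ℕ → ℕ → (ℕ → ℕ) → ℕ → ℕ
updR zero    n r zero    = n
updR zero    n r (suc i) = r (suc i)
updR (suc j) n r zero    = r zero
updR (suc j) n r (suc i) = updR j n (r ∘ suc) i

-- Interpolates between two constant ranges: `lo` on the first levels and `hi` on the others. Both
-- pumping and absorption change one level at a time along it.
mixR : ℕ → ℕ → ℕ → ℕ → ℕ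
mixR lo hi zero    i       = hi
mixR lo hi (suc j) zero    = lo
mixR lo hi (suc j) (suc i) = mixR lo hi j i

mixR-at : ∀ lo hi j → mixR lo hi j j ≡ hi
mixR-at lo hi zero    = refl
mixR-at lo hi (suc j) = mixR-at lo hi j

updR-mix-lo : ∀ lo hi j i → updR j lo (mixR lo hi j) i ≡ mixR lo hi (suc j) i
updR-mix-lo lo hi zero    zero    = refl
updR-mix-lo lo hi zero    (suc i) = refl
updR-mix-lo lo hi (suc j) zero    = refl
updR-mix-lo lo hi (suc j) (suc i) = updR-mix-lo lo hi j i

updR-mix-hi : ∀ lo hi j i → updR j hi (mixR lo hi j) i ≡ mixR lo hi j i
updR-mix-hi lo hi zero    zero    = refl
updR-mix-hi lo hi zero    (suc i) = refl
updR-mix-hi lo hi (suc j) zero    = refl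
updR-mix-hi lo hi (suc j) (suc i) = updR-mix-hi lo hi j i

-- A vector of length at most `D` does not reach the levels where `hi` holds, so after `D` steps the
-- change of range is complete.
InR-mix⁺ : ∀ lo hi D v → length v ≤ D → InR (const lo) v → InR (mixR lo hi D) v
InR-mix⁺ lo hi D       []      l       p       = tt
InR-mix⁺ lo hi (suc D) (i ∷ v) (s≤s l) (q , p) = q , InR-mix⁺ lo hi D v l p

InR-mix⁻ : ∀ lo hi D v → length v ≤ D → InR (mixR lo hi D) v → InR (const lo) v
InR-mix⁻ lo hi D       []      l       p       = tt
InR-mix⁻ lo hi (suc D) (i ∷ v) (s≤s l) (q , p) = q , InR-mix⁻ lo hi D v l p

setAt : ℕ → ℕ → List ℕ → List ℕ
setAt j       i []      = []
setAt zero    i (x ∷ u) = i ∷ u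
setAt (suc j) i (x ∷ u) = x ∷ setAt j i u

getAt : ℕ → List ℕ → ℕ
getAt j       []      = 0
getAt zero    (x ∷ u) = x
getAt (suc j) (x ∷ u) = getAt j u

length-setAt : ∀ j i u → length (setAt j i u) ≡ length u
length-setAt j       i []      = refl
length-setAt zero    i (x ∷ u) = refl
length-setAt (suc j) i (x ∷ u) = cong suc (length-setAt j i u)

take-setAt : ∀ n j i u → take n (setAt j i u) ≡ setAt j i (take n u)
take-setAt zero    j       i u       = refl
take-setAt (suc n) j       i []      = refl
take-setAt (suc n) zero    i (x ∷ u) = refl
take-setAt (suc n) (suc j) i (x ∷ u) = cong (x ∷_) (take-setAt n j i u)

setAt-short : ∀ j i u → length u ≤ j → setAt j i u ≡ u
setAt-short j       i []      l       = refl
setAt-short (suc j) i (x ∷ u) (s≤s l) = cong (x ∷_) (setAt-short j i u l)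

take-setAt-before : ∀ j i u → take j (setAt j i u) ≡ take j u
take-setAt-before zero    i u       = refl
take-setAt-before (suc j) i []      = refl
take-setAt-before (suc j) i (x ∷ u) = cong (x ∷_) (take-setAt-before j i u)

getAt-setAt : ∀ j i u → j < length u → getAt j (setAt j i u) ≡ i
getAt-setAt zero    i (x ∷ u) l       = refl
getAt-setAt (suc j) i (x ∷ u) (s≤s l) = getAt-setAt j i u l

getAt-take : ∀ j n u → j < n → getAt j (take n u) ≡ getAt j u
getAt-take j       (suc n) []      l       = refl
getAt-take zero    (suc n) (x ∷ u) l       = refl
getAt-take (suc j) (suc n) (x ∷ u) (s≤s l) = getAt-take j n u l

setAt-injective : ∀ j i u u' → take (suc j) u ≡ take (suc j) u' → setAt j i u ≡ setAt j i u' → u ≡ u'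
setAt-injective j       i []      []        e e' = refl
setAt-injective zero    i (x ∷ u) (x' ∷ u') e e' = cong₂ _∷_ (∷-injectiveˡ e) (∷-injectiveʳ e')
setAt-injective (suc j) i (x ∷ u) (x' ∷ u') e e' =
  cong₂ _∷_ (∷-injectiveˡ e) (setAt-injective j i u u' (∷-injectiveʳ e) (∷-injectiveʳ e'))

InR-setAt : ∀ j {n i r} u → i < r j → InR (updR j n r) u → InR r (setAt j i u)
InR-setAt j       []      l p       = tt
InR-setAt zero    (x ∷ u) l (q , p) = l , p
InR-setAt (suc j) (x ∷ u) l (q , p) = q , InR-setAt j u l p

-- Level `j` is about to be widened; a vector is new if it uses a copy at that level which `r` does
-- not have.
New : (ℕ → ℕ) → ℕ → List ℕ → Set
New r j u = j < length u × r j ≤ getAt j u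

New? : ∀ r j u → Dec (New r j u)
New? r j u = (j <? length u) ×-dec (r j ≤? getAt j u)

InR-old : ∀ j {n r} u → ¬ New r j u → InR (updR j n r) u → InR r u
InR-old j       []      ¬new p       = tt
InR-old zero    (x ∷ u) ¬new (q , p) = ≰⇒> (λ l → ¬new (s≤s z≤n , l)) , p
InR-old (suc j) (x ∷ u) ¬new (q , p) = q , InR-old j u (λ (a , b) → ¬new (s≤s a , b)) p

getAt-∈ : ∀ j u → j < length u → getAt j u ∈ u
getAt-∈ zero    (x ∷ u) l       = here refl
getAt-∈ (suc j) (x ∷ u) (s≤s l) = there (getAt-∈ j u l)

-- Shifting the first index that leaves a tree of prefixes

tails′ : ℕ → List (List ℕ) → List (List ℕ)
tails′ i []             = []
tails′ i ([] ∷ ws)      = tails′ i ws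
tails′ i ((h ∷ w) ∷ ws) with h ≟ i
... | yes _ = w ∷ tails′ i ws
... | no  _ = tails′ i ws

tails′⁺ : ∀ {i w} ws → i ∷ w ∈ ws → w ∈ tails′ i ws
tails′⁺ ([] ∷ ws) (there p) = tails′⁺ ws p
tails′⁺ {i} ((h ∷ w) ∷ ws) p with h ≟ i | p
... | yes _ | here refl = here refl
... | yes _ | there q   = there (tails′⁺ ws q)
... | no n  | here refl = ⊥-elim (n refl)
... | no n  | there q   = tails′⁺ ws q

tails′⁻ : ∀ {i w} ws → w ∈ tails′ i ws → i ∷ w ∈ ws
tails′⁻ ([] ∷ ws) p = there (tails′⁻ ws p)
tails′⁻ {i} ((h ∷ w) ∷ ws) p with h ≟ i | p
... | yes refl | here refl = here refl
... | yes refl | there q   = there (tails′⁻ ws q)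
... | no n     | q         = there (tails′⁻ ws q)

-- `ws` stands for the tree of prefixes of its members, and `tails′` selects a subtree. Replacing
-- only the index at which `w` leaves the tree moves the remainder of `w` to another branch, while
-- all that is shared with `ws` stays in place.
shift : (ℕ → ℕ) → List (List ℕ) → List ℕ → List ℕ
shift g ws []      = []
shift g ws (i ∷ w) with tails′ i ws
... | []       = g i ∷ w
... | t ∷ ts   = i ∷ shift g (t ∷ ts) w

Prefix : List (List ℕ) → List ℕ → Set
Prefix ws w = ∃ λ s → w ++ s ∈ ws

∈⇒prefix : ∀ {ws w} → w ∈ ws → Prefix ws w
∈⇒prefix {ws} {w} p = [] , subst (_∈ ws) (sym (++-identityʳ w)) p

shift-fix : ∀ g ws w → Prefix ws w → shift g ws w ≡ w
shift-fix g ws [] p = refl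
shift-fix g ws (i ∷ w) (s , p) with tails′ i ws | tails′⁺ ws p
... | t ∷ ts | q = cong (i ∷_) (shift-fix g (t ∷ ts) w (s , q))

shift-length : ∀ g ws w → length (shift g ws w) ≡ length w
shift-length g ws [] = refl
shift-length g ws (i ∷ w) with tails′ i ws
... | []     = refl
... | t ∷ ts = cong suc (shift-length g (t ∷ ts) w)

shift-take : ∀ g ws n w → take n (shift g ws w) ≡ shift g ws (take n w)
shift-take g ws zero    w  = refl
shift-take g ws (suc n) [] = refl
shift-take g ws (suc n) (i ∷ w) with tails′ i ws
... | []     = refl
... | t ∷ ts = cong (i ∷_) (shift-take g (t ∷ ts) n w)

-- The values of `g` lie above all entries, so the result shows where the tree was left, and `g` can
-- be undone there.
shift-injective : ∀ {M g} → (∀ i → M ≤ g i) → Injective _≡_ _≡_ g → ∀ ws w w' → All (_< M) w → All (_< M) w' →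
                  shift g ws w ≡ shift g ws w' → w ≡ w'
shift-injective big inj ws [] [] a a' e = refl
shift-injective big inj ws [] (i' ∷ w') a a' e with tails′ i' ws
shift-injective big inj ws [] (i' ∷ w') a a' () | []
shift-injective big inj ws [] (i' ∷ w') a a' () | _ ∷ _
shift-injective big inj ws (i ∷ w) [] a a' e with tails′ i ws
shift-injective big inj ws (i ∷ w) [] a a' () | []
shift-injective big inj ws (i ∷ w) [] a a' () | _ ∷ _
shift-injective big inj ws (i ∷ w) (i' ∷ w') (p ∷ a) (p' ∷ a') e with tails′ i ws in eq | tails′ i' ws in eq'
... | []     | []     = cong₂ _∷_ (inj (∷-injectiveˡ e)) (∷-injectiveʳ e)
... | []     | _ ∷ _  = ⊥-elim (<-irrefl (sym (∷-injectiveˡ e)) (<-≤-trans p' (big i)))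
... | _ ∷ _  | []     = ⊥-elim (<-irrefl (∷-injectiveˡ e) (<-≤-trans p (big i')))
... | t ∷ ts | _ ∷ _ with ∷-injectiveˡ e
...   | refl with trans (sym eq) eq'
...     | refl = cong (i ∷_) (shift-injective big inj (t ∷ ts) w w' a a' (∷-injectiveʳ e))

firstBig : ℕ → List ℕ → Maybe ℕ
firstBig M []      = nothing
firstBig M (i ∷ w) with M ≤? i
... | yes _ = just i
... | no _  = firstBig M w

firstBig-small : ∀ {M} w → All (_< M) w → firstBig M w ≡ nothing
firstBig-small [] [] = refl
firstBig-small {M} (i ∷ w) (p ∷ a) with M ≤? i
... | yes q = ⊥-elim (<⇒≱ p q)
... | no _  = firstBig-small w a

-- The replaced index is the first big one, so `firstBig` recovers the value of `g`, by which new
-- copies are later told apart. A member of `ws` makes the empty vector a prefix and thereby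
-- excludes it: it has no index to replace.
shift-big : ∀ {M g} → (∀ i → M ≤ g i) → ∀ ws w → All (_< M) w → ¬ Prefix ws w → (∃ λ w₀ → w₀ ∈ ws) →
            ∃ λ i → firstBig M (shift g ws w) ≡ just (g i)
shift-big big ws [] a np (w₀ , w₀∈) = ⊥-elim (np (w₀ , w₀∈))
shift-big {M} {g} big ws (i ∷ w) (p ∷ a) np ne with tails′ i ws in eq
... | [] with M ≤? g i
...   | yes _ = i , refl
...   | no n  = ⊥-elim (n (big i))
shift-big {M} {g} big ws (i ∷ w) (p ∷ a) np ne | t ∷ ts with M ≤? i
...   | yes q = ⊥-elim (<⇒≱ p q)
...   | no _  = shift-big big (t ∷ ts) w a
                  (λ (s , q) → np (s , tails′⁻ ws (subst (_ ∈_) (sym eq) q))) (t , here refl)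

-- The renaming used for absorption. Applied to all instances with `suc c` copies at level `j`, it
-- creates one further copy as a renamed twin of copy `c` and fixes everything else.
bump : ℕ → ℕ → List ℕ → List ℕ
bump j       c []      = []
bump zero    c (i ∷ w) with i ≟ c
... | yes _ = suc c ∷ w
... | no _  = i ∷ w
bump (suc j) c (i ∷ w) = i ∷ bump j c w

bump-length : ∀ j c w → length (bump j c w) ≡ length w
bump-length j c [] = refl
bump-length zero c (i ∷ w) with i ≟ c
... | yes _ = refl
... | no _  = refl
bump-length (suc j) c (i ∷ w) = cong suc (bump-length j c w)

bump-take : ∀ j c n w → take n (bump j c w) ≡ bump j c (take n w)
bump-take j c zero w = refl
bump-take j c (suc n) [] = refl
bump-take zero c (suc n) (i ∷ w) with i ≟ c
... | yes _ = refl
... | no _  = refl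
bump-take (suc j) c (suc n) (i ∷ w) = cong (i ∷_) (bump-take j c n w)

bump-injective : ∀ j c {r} w w' → InR (updR j (suc c) r) w → InR (updR j (suc c) r) w' → bump j c w ≡ bump j c w' → w ≡ w'
bump-injective j c [] [] p p' e = refl
bump-injective zero c [] (i' ∷ w') p p' e with i' ≟ c
bump-injective zero c [] (i' ∷ w') p p' () | yes _
bump-injective zero c [] (i' ∷ w') p p' () | no _
bump-injective zero c (i ∷ w) [] p p' e with i ≟ c
bump-injective zero c (i ∷ w) [] p p' () | yes _
bump-injective zero c (i ∷ w) [] p p' () | no _
bump-injective zero c (i ∷ w) (i' ∷ w') (q , p) (q' , p') e with i ≟ c | i' ≟ c
... | yes refl | yes refl = cong (i ∷_) (∷-injectiveʳ e)
... | yes refl | no _     = ⊥-elim (<-irrefl (sym (∷-injectiveˡ e)) q')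
... | no _     | yes refl = ⊥-elim (<-irrefl (∷-injectiveˡ e) q)
... | no _     | no _     = e
bump-injective (suc j) c (i ∷ w) (i' ∷ w') (q , p) (q' , p') e =
  cong₂ _∷_ (∷-injectiveˡ e) (bump-injective j c w w' p p' (∷-injectiveʳ e))

bump-moved-∈ : ∀ j c w → bump j c w ≢ w → suc c ∈ bump j c w
bump-moved-∈ j c [] ne = ⊥-elim (ne refl)
bump-moved-∈ zero c (i ∷ w) ne with i ≟ c
... | yes _ = here refl
... | no _  = ⊥-elim (ne refl)
bump-moved-∈ (suc j) c (i ∷ w) ne = there (bump-moved-∈ j c w (ne ∘ cong (i ∷_)))

bump-moved-InR : ∀ j c {r} w → bump j c w ≢ w → ¬ InR (updR j (suc c) r) (bump j c w)
bump-moved-InR j c [] ne p = ne refl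
bump-moved-InR zero c (i ∷ w) ne p with i ≟ c
... | yes _ = <-irrefl refl (proj₁ p)
... | no _  = ne refl
bump-moved-InR (suc j) c (i ∷ w) ne (_ , p) = bump-moved-InR j c w (ne ∘ cong (i ∷_)) p

bump-cover : ∀ j c {r} w → InR (updR j (suc (suc c)) r) w →
             InR (updR j (suc c) r) w ⊎ (∃ λ w₀ → InR (updR j (suc c) r) w₀ × length w₀ ≡ length w × w ≡ bump j c w₀)
bump-cover j c [] p = inj₁ tt
bump-cover zero c (i ∷ w) (q , p) with i ≟ suc c
... | no ne    = inj₁ (≤∧≢⇒< (s≤s⁻¹ q) ne , p)
... | yes refl = inj₂ (c ∷ w , (≤-refl , p) , refl , eq)
  where eq : suc c ∷ w ≡ bump zero c (c ∷ w)
        eq with c ≟ c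
        ... | yes _ = refl
        ... | no n  = ⊥-elim (n refl)
bump-cover (suc j) c (i ∷ w) (q , p) with bump-cover j c w p
... | inj₁ p'                  = inj₁ (q , p')
... | inj₂ (w₀ , p' , l , e)   = inj₂ (i ∷ w₀ , (q , p') , cong suc l , cong (i ∷_) e)

-- Reindexing

position : List ℕ → ℕ → ℕ
position []      s = 0
position (x ∷ S) s with s ≟ x
... | yes _ = 0
... | no  _ = suc (position S s)

position-< : ∀ S {s} → s ∈ S → position S s < length S
position-< (x ∷ S) {s} p with s ≟ x
... | yes _ = s≤s z≤n
... | no n with p
...   | here e  = ⊥-elim (n e)
...   | there q = s≤s (position-< S q)

position-injective : ∀ S {s s'} → s ∈ S → s' ∈ S → position S s ≡ position S s' → s ≡ s'
position-injective (x ∷ S) {s} {s'} p p' e with s ≟ x | s' ≟ x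
... | yes refl | yes refl = refl
... | no n | no n' with p | p'
...   | here q  | _        = ⊥-elim (n q)
...   | there _ | here q   = ⊥-elim (n' q)
...   | there q | there q' = position-injective S q q' (suc-injective e)

-- Members of `S` are numbered from 0 and the others moved past `k`. With `length S ≤ k` this is
-- injective everywhere, so it can be applied to whole index vectors without identifying keys.
reindex : ℕ → List ℕ → ℕ → ℕ
reindex k S s with s ∈? S
... | yes _ = position S s
... | no  _ = k + s

reindex-∈ : ∀ {k S s} → length S ≤ k → s ∈ S → reindex k S s < k
reindex-∈ {k} {S} {s} l p with s ∈? S
... | yes q = <-≤-trans (position-< S q) l
... | no n  = ⊥-elim (n p)

reindex-≤ : ∀ {k S} s → length S ≤ k → reindex k S s ≤ k + s
reindex-≤ {k} {S} s l with s ∈? S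
... | yes q = ≤-trans (<⇒≤ (<-≤-trans (position-< S q) l)) (m≤m+n k s)
... | no n  = ≤-refl

reindex-injective : ∀ {k} S → length S ≤ k → Injective _≡_ _≡_ (reindex k S)
reindex-injective {k} S l {s} {s'} e with s ∈? S | s' ∈? S
... | yes q | yes q' = position-injective S q q' e
... | yes q | no _   = ⊥-elim (<-irrefl e (≤-trans (<-≤-trans (position-< S q) l) (m≤m+n k s')))
... | no _  | yes q' = ⊥-elim (<-irrefl (sym e) (≤-trans (<-≤-trans (position-< S q') l) (m≤m+n k s)))
... | no _  | no _   = +-cancelˡ-≡ k s s' e

module _ (I : IntruderModel) where

  open IntruderModel I
  open Processes sig
  open Semantics I

  -- Renamings of messages and their names

  mutual
    renM-cong : ∀ {θ θ'} M → (∀ {a} → a ∈ namesM M → θ a ≡ θ' a) → renM θ M ≡ renM θ' M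
    renM-cong (name a)   h = cong name (h (here refl))
    renM-cong (app f ms) h = cong (app f) (renV-cong ms h)

    renV-cong : ∀ {θ θ' n} (ms : Vec Msg n) → (∀ {a} → a ∈ namesV ms → θ a ≡ θ' a) → renV θ ms ≡ renV θ' ms
    renV-cong []       h = refl
    renV-cong (m ∷ ms) h = cong₂ _∷_ (renM-cong m (h ∘ ∈-++⁺ˡ)) (renV-cong ms (h ∘ ∈-++⁺ʳ (namesM m)))

  mutual
    renM-∘ : ∀ θ θ' M → renM θ (renM θ' M) ≡ renM (θ ∘ θ') M
    renM-∘ θ θ' (name a)   = refl
    renM-∘ θ θ' (app f ms) = cong (app f) (renV-∘ θ θ' ms)

    renV-∘ : ∀ θ θ' {n} (ms : Vec Msg n) → renV θ (renV θ' ms) ≡ renV (θ ∘ θ') ms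
    renV-∘ θ θ' []       = refl
    renV-∘ θ θ' (m ∷ ms) = cong₂ _∷_ (renM-∘ θ θ' m) (renV-∘ θ θ' ms)

  mutual
    renM-id : ∀ M → renM id M ≡ M
    renM-id (name a)   = refl
    renM-id (app f ms) = cong (app f) (renV-id ms)

    renV-id : ∀ {n} (ms : Vec Msg n) → renV id ms ≡ ms
    renV-id []       = refl
    renV-id (m ∷ ms) = cong₂ _∷_ (renM-id m) (renV-id ms)

  mutual
    namesM-ren : ∀ θ M → namesM (renM θ M) ≡ map θ (namesM M)
    namesM-ren θ (name a)   = refl
    namesM-ren θ (app f ms) = namesV-ren θ ms

    namesV-ren : ∀ θ {n} (ms : Vec Msg n) → namesV (renV θ ms) ≡ map θ (namesV ms)
    namesV-ren θ []       = refl
    namesV-ren θ (m ∷ ms) = trans (cong₂ _++_ (namesM-ren θ m) (namesV-ren θ ms)) (sym (map-++ θ (namesM m) (namesV ms)))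

  namesL-ren : ∀ θ Γ → namesL (map (renM θ) Γ) ≡ map θ (namesL Γ)
  namesL-ren θ []      = refl
  namesL-ren θ (M ∷ Γ) = trans (cong₂ _++_ (namesM-ren θ M) (namesL-ren θ Γ)) (sym (map-++ θ (namesM M) (namesL Γ)))

  renL-cong : ∀ {θ θ'} Ms → (∀ {a} → a ∈ namesL Ms → θ a ≡ θ' a) → map (renM θ) Ms ≡ map (renM θ') Ms
  renL-cong []       h = refl
  renL-cong (M ∷ Ms) h = cong₂ _∷_ (renM-cong M (h ∘ ∈-++⁺ˡ)) (renL-cong Ms (h ∘ ∈-++⁺ʳ (namesM M)))

  renL-∘ : ∀ θ θ' Ms → map (renM θ) (map (renM θ') Ms) ≡ map (renM (θ ∘ θ')) Ms
  renL-∘ θ θ' Ms = trans (sym (map-∘ Ms)) (map-cong (renM-∘ θ θ') Ms)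

  renL-id : ∀ Ms → map (renM id) Ms ≡ Ms
  renL-id []       = refl
  renL-id (M ∷ Ms) = cong₂ _∷_ (renM-id M) (renL-id Ms)

  ∈namesL⁺ : ∀ {a M Γ} → M ∈ Γ → a ∈ namesM M → a ∈ namesL Γ
  ∈namesL⁺ = concatMap∈⁺ namesM

  ∈namesL⁻ : ∀ {a} Γ → a ∈ namesL Γ → ∃ λ M → M ∈ Γ × a ∈ namesM M
  ∈namesL⁻ = concatMap∈⁻ namesM

  namesL-⊆ : ∀ {Γ Δ} → Γ ⊆ Δ → namesL Γ ⊆ namesL Δ
  namesL-⊆ {Γ} s a∈ with ∈namesL⁻ Γ a∈
  ... | M , M∈ , a∈M = ∈namesL⁺ (s M∈) a∈M

  mutual
    _≟M_ : DecidableEquality Msg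
    name a ≟M name b with a ≟ b
    ... | yes refl = yes refl
    ... | no n     = no λ { refl → n refl }
    name a ≟M app g ns = no λ ()
    app f ms ≟M name b = no λ ()
    app f ms ≟M app g ns with f FinP.≟ g
    ... | no n = no λ { refl → n refl }
    ... | yes refl with ms ≟V ns
    ...   | yes refl = yes refl
    ...   | no n     = no λ { refl → n refl }

    _≟V_ : ∀ {n} → DecidableEquality (Vec Msg n)
    []       ≟V []       = yes refl
    (m ∷ ms) ≟V (n ∷ ns) with m ≟M n | ms ≟V ns
    ... | yes refl | yes refl = yes refl
    ... | no p     | _        = no λ { refl → p refl }
    ... | _        | no p     = no λ { refl → p refl }

  -- Derivability

  ∈⇒⊢ : ∀ {Γ M} → M ∈ Γ → Γ ⊢ M
  ∈⇒⊢ {M = M} M∈ = ax-mono (λ { (here refl) → M∈ }) (ax-refl M)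

  ⊢-cut* : ∀ Γ {Δ M} → (∀ {N} → N ∈ Γ → Δ ⊢ N) → Γ ⊢ M → Δ ⊢ M
  ⊢-cut* Γ {Δ} {M} h d = go Γ h (ax-mono ∈-++⁺ˡ d)
    where
      go : ∀ Γ → (∀ {N} → N ∈ Γ → Δ ⊢ N) → (Γ ++ Δ) ⊢ M → Δ ⊢ M
      go []      h d = d
      go (N ∷ Γ) h d = go Γ (h ∘ there) (ax-cut (ax-mono (∈-++⁺ʳ Γ) (h (here refl))) d)

  ⊢-rename : ∀ θ {Γ M} → InjOn θ (namesL Γ ++ namesM M) → Γ ⊢ M → map (renM θ) Γ ⊢ renM θ M
  ⊢-rename θ {Γ} {M} inj d = subst₂ _⊢_
      (renL-cong Γ (λ a∈ → extend-∈ θ xs (∈-++⁺ˡ a∈)))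
      (renM-cong M (λ a∈ → extend-∈ θ xs (∈-++⁺ʳ (namesL Γ) a∈)))
      (proj₂ (ax-rename (extend θ xs) (extend-injective θ xs inj) Γ M) d)
    where xs = namesL Γ ++ namesM M

  mutual
    ⊢-fromNames : ∀ {Γ} M → (∀ {a} → a ∈ namesM M → name a ∈ Γ) → Γ ⊢ M
    ⊢-fromNames (name a)   h = ∈⇒⊢ (h (here refl))
    ⊢-fromNames (app f ms) h = ⊢-cut* (toList ms) (⊢-fromNamesV ms h) (ax-cons f ms)

    ⊢-fromNamesV : ∀ {Γ n} (ms : Vec Msg n) → (∀ {a} → a ∈ namesV ms → name a ∈ Γ) → ∀ {N} → N ∈ toList ms → Γ ⊢ N
    ⊢-fromNamesV (m ∷ ms) h (here refl) = ⊢-fromNames m (h ∘ ∈-++⁺ˡ)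
    ⊢-fromNamesV (m ∷ ms) h (there p)   = ⊢-fromNamesV ms (h ∘ ∈-++⁺ʳ (namesM m)) p

  ⊢-dropFresh : ∀ as {Γ M} → (∀ {a} → a ∈ as → a ∉ namesL Γ) → (∀ {a} → a ∈ as → a ∉ namesM M) →
                (map name as ++ Γ) ⊢ M → Γ ⊢ M
  ⊢-dropFresh [] h h' d = d
  ⊢-dropFresh (a ∷ as) {Γ} {M} h h' d with a ∈? as
  -- A repeated name is not fresh for the rest; it is removed by monotonicity instead of `ax-fresh`.
  ... | yes p = ⊢-dropFresh as (h ∘ there) (h' ∘ there)
                  (ax-mono (λ { (here refl) → ∈-++⁺ˡ (∈-map⁺ name p) ; (there q) → q }) d)
  ... | no n  = ⊢-dropFresh as (h ∘ there) (h' ∘ there) (ax-fresh _ M a a∉ (h' (here refl)) d)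
    where
      a∉ : a ∉ namesL (map name as ++ Γ)
      a∉ q with ∈namesL⁻ (map name as ++ Γ) q
      ... | N , N∈ , a∈N with ∈-++⁻ (map name as) N∈
      ...   | inj₂ r = h (here refl) (∈namesL⁺ r a∈N)
      ...   | inj₁ r with ∈-map⁻ name r
      ...     | b , b∈ , refl with a∈N
      ...       | here refl = n b∈

  substPairs-zip-∈ : ∀ κ xs {a} → a ∈ xs → substPairs (zip xs (map κ xs)) a ≡ κ a
  substPairs-zip-∈ κ (x ∷ xs) {a} a∈ with a ≟ x
  ... | yes refl = refl
  ... | no n with a∈
  ...   | here e  = ⊥-elim (n e)
  ...   | there p = substPairs-zip-∈ κ xs p

  substPairs-zip-∉ : ∀ κ xs {a} → a ∉ xs → substPairs (zip xs (map κ xs)) a ≡ a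
  substPairs-zip-∉ κ []       a∉ = refl
  substPairs-zip-∉ κ (x ∷ xs) {a} a∉ with a ≟ x
  ... | yes e = ⊥-elim (a∉ (here e))
  ... | no n  = substPairs-zip-∉ κ xs (a∉ ∘ there)

  -- The names of M need not occur in Γ. Let A be the names of M outside Γ and Γκ, and θ an injection that
  -- fixes A and makes all other names fresh. Fresh names derive Mθ, whose names include A; so absorption
  -- applies to Γ extended by these fresh names and Mθ, after which Mθ is cut and the fresh names are dropped.
  ⊢-absorb : ∀ κ Γ M → InjOn κ (namesL Γ) →
             (∀ {a} → a ∈ namesL Γ → κ a ≢ a → κ a ∉ namesL Γ × κ a ∉ namesM M) →
             (Γ ++ map (renM κ) Γ) ⊢ M → Γ ⊢ M
  ⊢-absorb κ Γ M inj out d =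
      ⊢-dropFresh ms (λ m∈ → big∉ m∈ ∘ ∈-++⁺ʳ (namesM M) ∘ Γ⊆Δ)
                     (λ m∈ → big∉ m∈ ∘ ∈-++⁺ˡ)
                     (ax-cut (ax-mono ∈-++⁺ˡ ms⊢K) (absorbed))
    where
      Δ = Γ ++ map (renM κ) Γ

      N : ℕ
      N = bound (namesM M ++ namesL Δ)

      Γ⊆Δ : namesL Γ ⊆ namesL Δ
      Γ⊆Δ = namesL-⊆ {Γ} {Δ} ∈-++⁺ˡ

      κΓ⊆Δ : ∀ {a} → a ∈ namesL Γ → κ a ∈ namesL Δ
      κΓ⊆Δ {a} a∈ = namesL-⊆ {map (renM κ) Γ} (∈-++⁺ʳ Γ) (subst (κ a ∈_) (sym (namesL-ren κ Γ)) (∈-map⁺ κ a∈))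

      inA? : ∀ a → Dec (a ∈ namesM M × a ∉ namesL Δ)
      inA? a = (a ∈? namesM M) ×-dec (¬? (a ∈? namesL Δ))

      θ : Name → Name
      θ a with inA? a
      ... | yes _ = a
      ... | no  _ = N + a

      θ-fix : ∀ {a} → a ∈ namesM M → a ∉ namesL Δ → θ a ≡ a
      θ-fix {a} p q with inA? a
      ... | yes _ = refl
      ... | no n  = ⊥-elim (n (p , q))

      θ-Δ : ∀ {a} → a ∈ namesL Δ → θ a ≡ N + a
      θ-Δ {a} p with inA? a
      ... | yes (_ , n) = ⊥-elim (n p)
      ... | no _        = refl

      small : ∀ {a} → a ∈ namesM M → a < N
      small p = ∈⇒<bound (∈-++⁺ˡ p)

      θ-inj : Injective _≡_ _≡_ θ
      θ-inj {a} {b} e with inA? a | inA? b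
      ... | yes _       | yes _       = e
      ... | yes (p , _) | no _        = ⊥-elim (<-irrefl e (≤-trans (small p) (m≤m+n N b)))
      ... | no _        | yes (q , _) = ⊥-elim (<-irrefl (sym e) (≤-trans (small q) (m≤m+n N a)))
      ... | no _        | no _        = +-cancelˡ-≡ N a b e

      ms : List Name
      ms = map (N +_) (namesL Δ)

      K = renM θ M

      big∉ : ∀ {a} → a ∈ ms → a ∉ namesM M ++ namesL Δ
      big∉ m∈ q with ∈-map⁻ (N +_) m∈
      ... | b , _ , refl = <-irrefl refl (≤-trans (∈⇒<bound q) (m≤m+n N b))

      ms⊢K : map name ms ⊢ K
      ms⊢K = ⊢-cut* (map (renM θ) Δ) fromMs (proj₂ (ax-rename θ θ-inj Δ M) d)
        where
          fromMs : ∀ {P} → P ∈ map (renM θ) Δ → map name ms ⊢ P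
          fromMs P∈ with ∈-map⁻ (renM θ) P∈
          ... | P' , P'∈ , refl = ⊢-fromNames _ λ {a} a∈ →
            let (b , b∈ , e) = ∈-map⁻ θ (subst (a ∈_) (namesM-ren θ P') a∈)
                b∈Δ = ∈namesL⁺ P'∈ b∈
            in ∈-map⁺ name (subst (_∈ ms) (sym (trans e (θ-Δ b∈Δ))) (∈-map⁺ (N +_) b∈Δ))

      Γ⁺ = K ∷ map name ms ++ Γ

      moved? : ∀ a → Dec (κ a ≢ a)
      moved? a = ¬? (κ a ≟ a)

      -- Only names moved by `κ` enter the substitution: an unmoved name would be its own image and
      -- violate the requirement that the images do not occur in `Γ⁺`.
      xs = deduplicate _≟_ (filter moved? (namesL Γ))

      xs⁻ : ∀ {a} → a ∈ xs → a ∈ namesL Γ × κ a ≢ a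
      xs⁻ p = ∈-filter⁻ moved? (∈-deduplicate⁻ _≟_ _ p)

      subst-Γ : ∀ {a} → a ∈ namesL Γ → substPairs (zip xs (map κ xs)) a ≡ κ a
      subst-Γ {a} a∈ with κ a ≟ a
      ... | no n  = substPairs-zip-∈ κ xs (∈-deduplicate⁺ _≟_ (∈-filter⁺ moved? a∈ n))
      ... | yes e = trans (substPairs-zip-∉ κ xs (λ p → proj₂ (xs⁻ p) e)) (sym e)

      namesK : ∀ {y} → y ∈ namesL Δ → y ∉ namesM K
      namesK {y} y∈ p with ∈-map⁻ θ (subst (y ∈_) (namesM-ren θ M) p)
      ... | b , b∈ , e with inA? b
      ...   | yes (_ , n) = n (subst (_∈ namesL Δ) e y∈)
      ...   | no _ = <-irrefl e (≤-trans (∈⇒<bound (∈-++⁺ʳ (namesM M) y∈)) (m≤m+n N b))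

      ys∉ : ∀ y → y ∈ map κ xs → y ∉ namesL Γ⁺
      ys∉ y y∈ q with ∈-map⁻ κ y∈
      ... | x , x∈ , refl with xs⁻ x∈
      ...   | x∈Γ , mv with ∈-++⁻ (namesM K) q
      ...     | inj₁ r = namesK (κΓ⊆Δ x∈Γ) r
      ...     | inj₂ r with ∈namesL⁻ (map name ms ++ Γ) r
      ...       | P , P∈ , y∈P with ∈-++⁻ (map name ms) P∈
      ...         | inj₂ s = proj₁ (out x∈Γ mv) (∈namesL⁺ s y∈P)
      ...         | inj₁ s with ∈-map⁻ name s
      ...           | m , m∈ , refl with y∈P
      ...             | here refl = big∉ m∈ (∈-++⁺ʳ (namesM M) (κΓ⊆Δ x∈Γ))

      -- Names of `M` outside `Δ` occur in `K`, since `θ` fixes them. A name of `M` in the renamed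
      -- half is a value of `κ`; by `out` it is unmoved and hence occurs in `Γ`.
      M⊆ : namesM M ⊆ namesL Γ⁺
      M⊆ {a} a∈ with a ∈? namesL Δ
      ... | no n  = ∈-++⁺ˡ (subst (_∈ namesM K) (θ-fix a∈ n) (subst (θ a ∈_) (sym (namesM-ren θ M)) (∈-map⁺ θ a∈)))
      ... | yes p with ∈namesL⁻ Δ p
      ...   | P , P∈ , a∈P with ∈-++⁻ Γ P∈
      ...     | inj₁ r = ∈-++⁺ʳ (namesM K) (namesL-⊆ {Γ} (∈-++⁺ʳ (map name ms)) (∈namesL⁺ r a∈P))
      ...     | inj₂ r with ∈-map⁻ κ (subst (a ∈_) (namesL-ren κ Γ) (∈namesL⁺ r a∈P))
      ...       | b , b∈ , refl with κ b ≟ b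
      ...         | no n  = ⊥-elim (proj₂ (out b∈ n) a∈)
      ...         | yes e = ∈-++⁺ʳ (namesM K) (namesL-⊆ {Γ} (∈-++⁺ʳ (map name ms)) (subst (_∈ namesL Γ) (sym e) b∈))

      Δ⊆ : Δ ⊆ Γ⁺ ++ map (renM (substPairs (zip xs (map κ xs)))) Γ⁺
      Δ⊆ P∈ with ∈-++⁻ Γ P∈
      ... | inj₁ r = ∈-++⁺ˡ (there (∈-++⁺ʳ (map name ms) r))
      ... | inj₂ r with ∈-map⁻ (renM κ) r
      ...   | P , P∈Γ , refl = ∈-++⁺ʳ Γ⁺ (subst (_∈ _) (renM-cong P (λ a∈ → subst-Γ (∈namesL⁺ P∈Γ a∈)))
                                 (∈-map⁺ (renM _) (there (∈-++⁺ʳ (map name ms) P∈Γ))))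

      absorbed : Γ⁺ ⊢ M
      absorbed = proj₁ (ax-absorb xs (map κ xs) Γ⁺ M (deduplicate-! _)
          (Unique-map-InjOn κ (λ a∈ b∈ → inj (proj₁ (xs⁻ a∈)) (proj₁ (xs⁻ b∈))) (deduplicate-! _))
          (sym (length-map κ xs)) ys∉ M⊆)
        (ax-mono Δ⊆ d)

  -- Items and configurations

  data Item : Set where
    im : Msg → Item
    iq : (tag q : ℕ) → List Msg → Item

  namesI tagsI : Item → List Name
  namesI (im M)      = namesM M
  namesI (iq t q Ms) = namesL Ms
  tagsI (im M)       = []
  tagsI (iq t q Ms)  = t ∷ []

  namesE tagsE : List Item → List Name
  namesE = concatMap namesI
  tagsE  = concatMap tagsI

  renI : (Name → Name) → (ℕ → ℕ) → Item → Item
  renI θ σ (im M)      = im (renM θ M)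
  renI θ σ (iq t q Ms) = iq (σ t) q (map (renM θ) Ms)

  msgs : List Item → List Msg
  msgs []                = []
  msgs (im M ∷ E)        = M ∷ msgs E
  msgs (iq t q Ms ∷ E)   = msgs E

  renI-cong : ∀ {θ θ' σ σ'} e → (∀ {a} → a ∈ namesI e → θ a ≡ θ' a) → (∀ {t} → t ∈ tagsI e → σ t ≡ σ' t) →
              renI θ σ e ≡ renI θ' σ' e
  renI-cong (im M)      h h' = cong im (renM-cong M h)
  renI-cong (iq t q Ms) h h' = cong₂ (λ t Ms → iq t q Ms) (h' (here refl)) (renL-cong Ms h)

  renE-cong : ∀ {θ θ' σ σ'} E → (∀ {a} → a ∈ namesE E → θ a ≡ θ' a) → (∀ {t} → t ∈ tagsE E → σ t ≡ σ' t) →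
              map (renI θ σ) E ≡ map (renI θ' σ') E
  renE-cong []      h h' = refl
  renE-cong (e ∷ E) h h' = cong₂ _∷_ (renI-cong e (h ∘ ∈-++⁺ˡ) (h' ∘ ∈-++⁺ˡ))
                             (renE-cong E (h ∘ ∈-++⁺ʳ (namesI e)) (h' ∘ ∈-++⁺ʳ (tagsI e)))

  renI-∘ : ∀ θ θ' σ σ' e → renI θ σ (renI θ' σ' e) ≡ renI (θ ∘ θ') (σ ∘ σ') e
  renI-∘ θ θ' σ σ' (im M)      = cong im (renM-∘ θ θ' M)
  renI-∘ θ θ' σ σ' (iq t q Ms) = cong (iq (σ (σ' t)) q) (renL-∘ θ θ' Ms)

  renE-∘ : ∀ θ θ' σ σ' E → map (renI θ σ) (map (renI θ' σ') E) ≡ map (renI (θ ∘ θ') (σ ∘ σ')) E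
  renE-∘ θ θ' σ σ' E = trans (sym (map-∘ E)) (map-cong (renI-∘ θ θ' σ σ') E)

  renI-id : ∀ e → renI id id e ≡ e
  renI-id (im M)      = cong im (renM-id M)
  renI-id (iq t q Ms) = cong (iq t q) (renL-id Ms)

  renE-id : ∀ E → map (renI id id) E ≡ E
  renE-id []      = refl
  renE-id (e ∷ E) = cong₂ _∷_ (renI-id e) (renE-id E)

  namesI-ren : ∀ θ σ e → namesI (renI θ σ e) ≡ map θ (namesI e)
  namesI-ren θ σ (im M)      = namesM-ren θ M
  namesI-ren θ σ (iq t q Ms) = namesL-ren θ Ms

  tagsI-ren : ∀ θ σ e → tagsI (renI θ σ e) ≡ map σ (tagsI e)
  tagsI-ren θ σ (im M)      = refl
  tagsI-ren θ σ (iq t q Ms) = refl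

  namesE-ren : ∀ θ σ E → namesE (map (renI θ σ) E) ≡ map θ (namesE E)
  namesE-ren θ σ []      = refl
  namesE-ren θ σ (e ∷ E) = trans (cong₂ _++_ (namesI-ren θ σ e) (namesE-ren θ σ E)) (sym (map-++ θ (namesI e) (namesE E)))

  tagsE-ren : ∀ θ σ E → tagsE (map (renI θ σ) E) ≡ map σ (tagsE E)
  tagsE-ren θ σ []      = refl
  tagsE-ren θ σ (e ∷ E) = trans (cong₂ _++_ (tagsI-ren θ σ e) (tagsE-ren θ σ E)) (sym (map-++ σ (tagsI e) (tagsE E)))

  ∈msgs⁺ : ∀ {M E} → im M ∈ E → M ∈ msgs E
  ∈msgs⁺ (here refl) = here refl
  ∈msgs⁺ {E = im M ∷ E} (there p) = there (∈msgs⁺ p)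
  ∈msgs⁺ {E = iq t q Ms ∷ E} (there p) = ∈msgs⁺ p

  ∈msgs⁻ : ∀ {M} E → M ∈ msgs E → im M ∈ E
  ∈msgs⁻ (im M ∷ E) (here refl) = here refl
  ∈msgs⁻ (im M ∷ E) (there p) = there (∈msgs⁻ E p)
  ∈msgs⁻ (iq t q Ms ∷ E) p = there (∈msgs⁻ E p)

  msgs-⊆ : ∀ {E E'} → E ⊆ E' → msgs E ⊆ msgs E'
  msgs-⊆ {E} s p = ∈msgs⁺ (s (∈msgs⁻ E p))

  msgs-ren : ∀ θ σ E → msgs (map (renI θ σ) E) ≡ map (renM θ) (msgs E)
  msgs-ren θ σ []                = refl
  msgs-ren θ σ (im M ∷ E)        = cong (renM θ M ∷_) (msgs-ren θ σ E)
  msgs-ren θ σ (iq t q Ms ∷ E)   = msgs-ren θ σ E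

  names-msgs : ∀ E → namesL (msgs E) ⊆ namesE E
  names-msgs E a∈ with ∈namesL⁻ (msgs E) a∈
  ... | M , M∈ , a∈M = concatMap∈⁺ namesI (∈msgs⁻ E M∈) a∈M

  _≟I_ : DecidableEquality Item
  im M ≟I im N with M ≟M N
  ... | yes refl = yes refl
  ... | no n     = no λ { refl → n refl }
  im M ≟I iq _ _ _ = no λ ()
  iq _ _ _ ≟I im N = no λ ()
  iq t q Ms ≟I iq t' q' Ms' with t ≟ t' | q ≟ q' | ≡-dec _≟M_ Ms Ms'
  ... | yes refl | yes refl | yes refl = yes refl
  ... | no n     | _        | _        = no λ { refl → n refl }
  ... | _        | no n     | _        = no λ { refl → n refl }
  ... | _        | _        | no n     = no λ { refl → n refl }

  Ok : List Item → Item → Set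
  Ok E (im M)          = msgs E ⊢ M
  Ok E e@(iq _ _ _)    = e ∈ E

  _≼_ : List Item → List Item → Set
  E ≼ E' = ∀ {e} → e ∈ E → Ok E' e

  open import Data.List.Membership.DecPropositional _≟I_ using () renaming (_∈?_ to _∈I?_)

  Ok? : ∀ E e → Dec (Ok E e)
  Ok? E (im M)          = ⊢-dec (msgs E) M
  Ok? E e@(iq _ _ _)    = e ∈I? E

  ∈⇒Ok : ∀ {E e} → e ∈ E → Ok E e
  ∈⇒Ok {e = im M}      p = ∈⇒⊢ (∈msgs⁺ p)
  ∈⇒Ok {e = iq _ _ _}  p = p

  Ok-≼ : ∀ {E E' e} → E ≼ E' → Ok E e → Ok E' e
  Ok-≼ {E} {e = im M}     s d = ⊢-cut* (msgs E) (λ N∈ → s (∈msgs⁻ E N∈)) d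
  Ok-≼ {e = iq _ _ _}     s p = s p

  Ok-⊆ : ∀ {E E' e} → E ⊆ E' → Ok E e → Ok E' e
  Ok-⊆ {e = e} s = Ok-≼ {e = e} (∈⇒Ok ∘ s)

  Ok-ren : ∀ θ σ {E e} → InjOn θ (namesE E ++ namesI e) → Ok E e → Ok (map (renI θ σ) E) (renI θ σ e)
  Ok-ren θ σ {E} {im M} inj d = subst (_⊢ renM θ M) (sym (msgs-ren θ σ E))
    (⊢-rename θ (λ p q → inj (widen p) (widen q)) d)
    where widen : namesL (msgs E) ++ namesM M ⊆ namesE E ++ namesM M
          widen p with ∈-++⁻ (namesL (msgs E)) p
          ... | inj₁ q = ∈-++⁺ˡ (names-msgs E q)
          ... | inj₂ q = ∈-++⁺ʳ (namesE E) q
  Ok-ren θ σ {E} {iq t q Ms} inj p = ∈-map⁺ (renI θ σ) p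

  concatMap-↭ : ∀ {A C : Set} (f : A → List C) {xs ys} → xs ↭ ys → concatMap f xs ↭ concatMap f ys
  concatMap-↭ f Perm.refl = ↭-refl
  concatMap-↭ f (prep x p) = PermP.++⁺ˡ (f x) (concatMap-↭ f p)
  concatMap-↭ f (swap x y p) = ↭-trans (PermP.shifts (f x) (f y)) (PermP.++⁺ˡ (f y) (PermP.++⁺ˡ (f x) (concatMap-↭ f p)))
  concatMap-↭ f (Perm.trans p q) = ↭-trans (concatMap-↭ f p) (concatMap-↭ f q)

  infix 4 _#_
  _#_ : List Name → List Name → Set
  xs # V = ∀ {a} → a ∈ xs → a ∉ V

  #-++⁺ : ∀ xs {ys V} → xs # V → ys # V → (xs ++ ys) # V
  #-++⁺ xs p q a∈ with ∈-++⁻ xs a∈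
  ... | inj₁ r = p r
  ... | inj₂ r = q r

  #-↭ : ∀ {xs ys V} → xs ↭ ys → xs # V → ys # V
  #-↭ p h a∈ = h (PermP.∈-resp-↭ (↭-sym p) a∈)

  -- Flattening

  -- A flattening of P under ρ names the binders of P by ys and lists its messages and process
  -- constants; each process constant gets a tag, which turns multiset inclusion into set inclusion.
  data Fl : (Name → Name) → Proc → List Name → List Item → Set where
    f𝟘 : ∀ {ρ} → Fl ρ 𝟘 [] []
    fν : ∀ {ρ x P y ys E} → Fl (ρ [ x ↦ y ]) P ys E → Fl ρ (ν x P) (y ∷ ys) E
    f∥ : ∀ {ρ P Q ys zs E E'} → Fl ρ P ys E → Fl ρ Q zs E' → Fl ρ (P ∥ Q) (ys ++ zs) (E ++ E')
    fm : ∀ {ρ M} → Fl ρ ⟨ M ⟩ [] (im (renM ρ M) ∷ [])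
    fq : ∀ {ρ q Ms} t → Fl ρ (Qc q Ms) [] (iq t q (map (renM ρ) Ms) ∷ [])

  ∈removeName⁺ : ∀ {a x xs} → a ∈ xs → a ≢ x → a ∈ removeName x xs
  ∈removeName⁺ = ∈-filter⁺ (λ y → ¬? (y ≟ _))

  ∈removeName⁻ : ∀ {a x} xs → a ∈ removeName x xs → a ∈ xs × a ≢ x
  ∈removeName⁻ {x = x} xs = ∈-filter⁻ (λ y → ¬? (y ≟ x)) {xs = xs}

  [↦]-cong : ∀ {ρ ρ' : Name → Name} {x y} {xs} → (∀ {a} → a ∈ removeName x xs → ρ a ≡ ρ' a) →
             ∀ {a} → a ∈ xs → (ρ [ x ↦ y ]) a ≡ (ρ' [ x ↦ y ]) a
  [↦]-cong {x = x} h {a} a∈ with a ≟ x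
  ... | yes _ = refl
  ... | no n  = h (∈removeName⁺ a∈ n)

  Fl-cong : ∀ {ρ ρ' P ys E} → (∀ {a} → a ∈ fvP P → ρ a ≡ ρ' a) → Fl ρ P ys E → Fl ρ' P ys E
  Fl-cong h f𝟘 = f𝟘
  Fl-cong h (fν d) = fν (Fl-cong ([↦]-cong h) d)
  Fl-cong {P = P ∥ Q} h (f∥ d d') = f∥ (Fl-cong (h ∘ ∈-++⁺ˡ) d) (Fl-cong (h ∘ ∈-++⁺ʳ (fvP P)) d')
  Fl-cong {ρ' = ρ'} {P = ⟨ M ⟩} h fm = subst (Fl ρ' ⟨ M ⟩ []) (cong (λ N → im N ∷ []) (sym (renM-cong M h))) fm
  Fl-cong {ρ' = ρ'} {P = Qc q Ms} h (fq t) =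
    subst (Fl ρ' (Qc q Ms) []) (cong (λ N → iq t q N ∷ []) (sym (renL-cong Ms h))) (fq t)

  Fl-ren : ∀ θ σ {ρ P ys E} → Fl ρ P ys E → Fl (θ ∘ ρ) P (map θ ys) (map (renI θ σ) E)
  Fl-ren θ σ f𝟘 = f𝟘
  Fl-ren θ σ {ρ} (fν {x = x} {y = y} d) = fν (Fl-cong (λ {a} _ → h a) (Fl-ren θ σ d))
    where h : ∀ a → θ ((ρ [ x ↦ y ]) a) ≡ ((θ ∘ ρ) [ x ↦ θ y ]) a
          h a with a ≟ x
          ... | yes _ = refl
          ... | no _  = refl
  Fl-ren θ σ (f∥ {ys = ys} {E = E} d d') = subst₂ (Fl _ _) (sym (map-++ θ ys _)) (sym (map-++ (renI θ σ) E _))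
    (f∥ (Fl-ren θ σ d) (Fl-ren θ σ d'))
  Fl-ren θ σ {ρ} {⟨ M ⟩} fm = subst (Fl (θ ∘ ρ) ⟨ M ⟩ []) (cong (λ N → im N ∷ []) (sym (renM-∘ θ ρ M))) fm
  Fl-ren θ σ {ρ} {Qc q Ms} (fq t) =
    subst (Fl (θ ∘ ρ) (Qc q Ms) []) (cong (λ N → iq (σ t) q N ∷ []) (sym (renL-∘ θ ρ Ms))) (fq (σ t))

  Fl-fv : ∀ {ρ P ys E a} → Fl ρ P ys E → a ∈ fvP P → ρ a ∈ namesE E
  Fl-fv {ρ} {ν x P} {E = E} (fν d) a∈ with ∈removeName⁻ (fvP P) a∈
  ... | a∈P , a≢ = subst (_∈ namesE E) ([↦]-other ρ a≢) (Fl-fv d a∈P)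
  Fl-fv {P = P ∥ Q} (f∥ {E = E} {E' = E'} d d') a∈ with ∈-++⁻ (fvP P) a∈
  ... | inj₁ p = let (e , e∈ , r) = concatMap∈⁻ namesI E (Fl-fv d p) in concatMap∈⁺ namesI (∈-++⁺ˡ e∈) r
  ... | inj₂ p = let (e , e∈ , r) = concatMap∈⁻ namesI E' (Fl-fv d' p) in concatMap∈⁺ namesI (∈-++⁺ʳ E e∈) r
  Fl-fv {ρ} {⟨ M ⟩} {a = a} fm a∈ = ∈-++⁺ˡ (subst (ρ a ∈_) (sym (namesM-ren ρ M)) (∈-map⁺ ρ a∈))
  Fl-fv {ρ} {Qc q Ms} {a = a} (fq t) a∈ = ∈-++⁺ˡ (subst (ρ a ∈_) (sym (namesL-ren ρ Ms)) (∈-map⁺ ρ a∈))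

  Fl-names : ∀ {ρ P ys E b} → Fl ρ P ys E → b ∈ namesE E → b ∈ ys ⊎ (∃ λ a → a ∈ fvP P × b ≡ ρ a)
  Fl-names {ρ} {ν x P} (fν d) b∈ with Fl-names d b∈
  ... | inj₁ p = inj₁ (there p)
  ... | inj₂ (a , a∈ , e) with a ≟ x
  ...   | yes refl = inj₁ (here e)
  ...   | no n     = inj₂ (a , ∈removeName⁺ a∈ n , e)
  Fl-names {P = P ∥ Q} (f∥ {ys = ys} {E = E} {E' = E'} d d') b∈ with concatMap∈⁻ namesI (E ++ E') b∈
  ... | e , e∈ , b∈e with ∈-++⁻ E e∈
  ...   | inj₁ p with Fl-names d (concatMap∈⁺ namesI p b∈e)
  ...     | inj₁ q = inj₁ (∈-++⁺ˡ q)
  ...     | inj₂ (a , a∈ , eq) = inj₂ (a , ∈-++⁺ˡ a∈ , eq)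
  Fl-names {P = P ∥ Q} (f∥ {ys = ys} {E = E} {E' = E'} d d') b∈ | e , e∈ , b∈e | inj₂ p
          with Fl-names d' (concatMap∈⁺ namesI p b∈e)
  ...     | inj₁ q = inj₁ (∈-++⁺ʳ ys q)
  ...     | inj₂ (a , a∈ , eq) = inj₂ (a , ∈-++⁺ʳ (fvP P) a∈ , eq)
  Fl-names {ρ} {⟨ M ⟩} {b = b} fm b∈ with ∈-++⁻ (namesM (renM ρ M)) b∈
  ... | inj₁ p = inj₂ (∈-map⁻ ρ (subst (b ∈_) (namesM-ren ρ M) p))
  Fl-names {ρ} {Qc q Ms} {b = b} (fq t) b∈ with ∈-++⁻ (namesL (map (renM ρ) Ms)) b∈
  ... | inj₁ p = inj₂ (∈-map⁻ ρ (subst (b ∈_) (namesL-ren ρ Ms) p))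

  tagsE-++ : ∀ E E' → tagsE (E ++ E') ≡ tagsE E ++ tagsE E'
  tagsE-++ []      E' = refl
  tagsE-++ (e ∷ E) E' = trans (cong (tagsI e ++_) (tagsE-++ E E')) (sym (++-assoc (tagsI e) (tagsE E) (tagsE E')))

  Fl-exists : ∀ ρ P V W → ∃ λ ys → ∃ λ E → Fl ρ P ys E × Unique ys × ys # V × Unique (tagsE E) × tagsE E # W
  Fl-exists ρ 𝟘 V W = [] , [] , f𝟘 , [] , (λ ()) , [] , (λ ())
  Fl-exists ρ (ν x P) V W with Fl-exists (ρ [ x ↦ bound V ]) P (bound V ∷ V) W
  ... | ys , E , d , u , h , u' , h' = bound V ∷ ys , E , fν d ,
    Unique-∷⁺ (λ p → h p (here refl)) u ,
    (λ { (here refl) → bound≤⇒∉ ≤-refl ; (there p) → h p ∘ there }) , u' , h'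
  Fl-exists ρ (P ∥ Q) V W with Fl-exists ρ P V W
  ... | ys , E , d , u , h , u' , h' with Fl-exists ρ Q (ys ++ V) (tagsE E ++ W)
  ...   | zs , E' , d₂ , u₂ , h₂ , u₂' , h₂' = ys ++ zs , E ++ E' , f∥ d d₂ ,
    Unique-++⁺ u u₂ (λ p q → h₂ q (∈-++⁺ˡ p)) , #-++⁺ ys h (λ q → h₂ q ∘ ∈-++⁺ʳ ys) ,
    subst Unique (sym (tagsE-++ E E')) (Unique-++⁺ u' u₂' (λ p q → h₂' q (∈-++⁺ˡ p))) ,
    subst (_# W) (sym (tagsE-++ E E')) (#-++⁺ (tagsE E) h' (λ q → h₂' q ∘ ∈-++⁺ʳ (tagsE E)))
  Fl-exists ρ ⟨ M ⟩ V W = _ , _ , fm , [] , (λ ()) , [] , (λ ())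
  Fl-exists ρ (Qc q Ms) V W = _ , _ , fq (bound W) , [] , (λ ()) , [] ∷ [] , λ { (here refl) → bound≤⇒∉ ≤-refl }

  -- Structural congruence preserves flattenings up to permutation

  fv⊆occ : ∀ P {a} → a ∈ fvP P → a ∈ occP P
  fv⊆occ (ν x P) a∈ = there (fv⊆occ P (proj₁ (∈removeName⁻ (fvP P) a∈)))
  fv⊆occ (P ∥ Q) a∈ with ∈-++⁻ (fvP P) a∈
  ... | inj₁ p = ∈-++⁺ˡ (fv⊆occ P p)
  ... | inj₂ p = ∈-++⁺ʳ (occP P) (fv⊆occ Q p)
  fv⊆occ ⟨ M ⟩ a∈ = a∈
  fv⊆occ (Qc q Ms) a∈ = a∈

  _⟼_ : Name → Name → Name → Name
  x ⟼ y = substPairs ((x , y) ∷ [])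

  ⟼-other : ∀ {x y a} → a ≢ x → (x ⟼ y) a ≡ a
  ⟼-other {x} {y} {a} n with a ≟ x
  ... | yes e = ⊥-elim (n e)
  ... | no _  = refl

  [↦]-⟼ : ∀ {ρ₁ ρ₂ : Name → Name} {x y z w xs} → z ≢ x → z ≢ y →
          (∀ {a} → a ∈ removeName z xs → ρ₁ a ≡ ρ₂ ((x ⟼ y) a)) →
          ∀ {a} → a ∈ xs → (ρ₁ [ z ↦ w ]) a ≡ (ρ₂ [ z ↦ w ]) ((x ⟼ y) a)
  [↦]-⟼ {ρ₁} {ρ₂} {x} {y} {z} {w} z≢x z≢y h {a} a∈ with a ≟ z
  ... | yes refl = sym (trans (cong (ρ₂ [ z ↦ w ]) (⟼-other z≢x)) ([↦]-same ρ₂ z w))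
  ... | no n = trans (h (∈removeName⁺ a∈ n)) (sym ([↦]-other ρ₂ ne))
    where ne : (x ⟼ y) a ≢ z
          ne e with a ≟ x
          ... | yes refl = z≢y (sym e)
          ... | no _     = n e

  -- As `y` occurs nowhere in `P`, not even as a binder, the substitution is never captured. The
  -- binders stay in the same positions, so even `ys` and `E` are unchanged.
  Fl-rename⁺ : ∀ {ρ₁ ρ₂ x y} P {ys E} → y ∉ occP P → (∀ {a} → a ∈ fvP P → ρ₁ a ≡ ρ₂ ((x ⟼ y) a)) →
               Fl ρ₁ P ys E → Fl ρ₂ (renameP x y P) ys E
  Fl-rename⁺ 𝟘 y∉ h f𝟘 = f𝟘
  Fl-rename⁺ {ρ₁} {ρ₂} {x} {y} (ν z P) y∉ h (fν d) with z ≟ x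
  ... | yes refl = fν (Fl-cong ([↦]-cong (λ a∈ → trans (h a∈) (cong ρ₂ (⟼-other (proj₂ (∈removeName⁻ (fvP P) a∈)))))) d)
  ... | no n = fν (Fl-rename⁺ P (y∉ ∘ there) ([↦]-⟼ n (λ e → y∉ (here (sym e))) h) d)
  Fl-rename⁺ (P ∥ Q) y∉ h (f∥ d d') = f∥ (Fl-rename⁺ P (y∉ ∘ ∈-++⁺ˡ) (h ∘ ∈-++⁺ˡ) d)
                                        (Fl-rename⁺ Q (y∉ ∘ ∈-++⁺ʳ (occP P)) (h ∘ ∈-++⁺ʳ (fvP P)) d')
  Fl-rename⁺ {ρ₁} {ρ₂} {x} {y} ⟨ M ⟩ y∉ h fm =
    subst (λ N → Fl ρ₂ _ [] (im N ∷ [])) (trans (renM-∘ ρ₂ (x ⟼ y) M) (sym (renM-cong M h))) fm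
  Fl-rename⁺ {ρ₁} {ρ₂} {x} {y} (Qc q Ms) y∉ h (fq t) =
    subst (λ N → Fl ρ₂ _ [] (iq t q N ∷ [])) (trans (renL-∘ ρ₂ (x ⟼ y) Ms) (sym (renL-cong Ms h))) (fq t)

  Fl-rename⁻ : ∀ {ρ₁ ρ₂ x y} P {ys E} → y ∉ occP P → (∀ {a} → a ∈ fvP P → ρ₁ a ≡ ρ₂ ((x ⟼ y) a)) →
               Fl ρ₂ (renameP x y P) ys E → Fl ρ₁ P ys E
  Fl-rename⁻ 𝟘 y∉ h f𝟘 = f𝟘
  Fl-rename⁻ {ρ₁} {ρ₂} {x} {y} (ν z P) y∉ h d with z ≟ x
  Fl-rename⁻ {ρ₁} {ρ₂} {x} {y} (ν z P) y∉ h (fν d) | yes refl =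
    fν (Fl-cong ([↦]-cong (λ a∈ → sym (trans (h a∈) (cong ρ₂ (⟼-other (proj₂ (∈removeName⁻ (fvP P) a∈))))))) d)
  Fl-rename⁻ {ρ₁} {ρ₂} {x} {y} (ν z P) y∉ h (fν d) | no n =
    fν (Fl-rename⁻ P (y∉ ∘ there) ([↦]-⟼ n (λ e → y∉ (here (sym e))) h) d)
  Fl-rename⁻ (P ∥ Q) y∉ h (f∥ d d') = f∥ (Fl-rename⁻ P (y∉ ∘ ∈-++⁺ˡ) (h ∘ ∈-++⁺ˡ) d)
                                        (Fl-rename⁻ Q (y∉ ∘ ∈-++⁺ʳ (occP P)) (h ∘ ∈-++⁺ʳ (fvP P)) d')
  Fl-rename⁻ {ρ₁} {ρ₂} {x} {y} ⟨ M ⟩ y∉ h fm =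
    subst (λ N → Fl ρ₁ _ [] (im N ∷ [])) (sym (trans (renM-∘ ρ₂ (x ⟼ y) M) (sym (renM-cong M h)))) fm
  Fl-rename⁻ {ρ₁} {ρ₂} {x} {y} (Qc q Ms) y∉ h (fq t) =
    subst (λ N → Fl ρ₁ _ [] (iq t q N ∷ [])) (sym (trans (renL-∘ ρ₂ (x ⟼ y) Ms) (sym (renL-cong Ms h)))) (fq t)

  -- The list `V` of names to avoid allows one component of a parallel composition to be flattened
  -- anew away from the names chosen for the other.
  Sim : Proc → Proc → Set
  Sim P Q = ∀ {ρ} V {ys E} → Fl ρ P ys E → Unique ys → ys # V →
            ∃ λ ys' → ∃ λ E' → Fl ρ Q ys' E' × Unique ys' × ys' # V × E ↭ E'

  sim-refl : ∀ {P} → Sim P P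
  sim-refl V d u h = _ , _ , d , u , h , ↭-refl

  sim-trans : ∀ {P Q R} → Sim P Q → Sim Q R → Sim P R
  sim-trans s t V d u h with s V d u h
  ... | _ , _ , d₁ , u₁ , h₁ , p₁ with t V d₁ u₁ h₁
  ...   | _ , _ , d₂ , u₂ , h₂ , p₂ = _ , _ , d₂ , u₂ , h₂ , ↭-trans p₁ p₂

  sim-ν : ∀ {x P Q} → Sim P Q → Sim (ν x P) (ν x Q)
  sim-ν s V (fν {y = y} d) u h with Unique-∷⁻ u
  ... | y∉ , v with s (y ∷ V) d v (λ { a∈ (here refl) → y∉ a∈ ; a∈ (there p) → h (there a∈) p })
  ...   | ys' , E' , d' , u' , h' , p = _ , _ , fν d' , Unique-∷⁺ (λ q → h' q (here refl)) u' ,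
    (λ { (here refl) → h (here refl) ; (there q) → h' q ∘ there }) , p

  sim-∥ : ∀ {P P' Q Q'} → Sim P P' → Sim Q Q' → Sim (P ∥ Q) (P' ∥ Q')
  sim-∥ s t V (f∥ {ys = ys} {zs = zs} d₁ d₂) u h with Unique-++⁻ ys u
  ... | u₁ , u₂ , dis with s (zs ++ V) d₁ u₁ (λ a∈ q → either a∈ (∈-++⁻ zs q))
    where either : ∀ {a} → a ∈ ys → a ∈ zs ⊎ a ∈ V → ⊥
          either a∈ (inj₁ q) = dis a∈ q
          either a∈ (inj₂ q) = h (∈-++⁺ˡ a∈) q
  ...   | ys' , E₁' , d₁' , u₁' , h₁' , p₁ with t (ys' ++ V) d₂ u₂ (λ a∈ q → either a∈ (∈-++⁻ ys' q))
    where either : ∀ {a} → a ∈ zs → a ∈ ys' ⊎ a ∈ V → ⊥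
          either a∈ (inj₁ q) = h₁' q (∈-++⁺ˡ a∈)
          either a∈ (inj₂ q) = h (∈-++⁺ʳ ys a∈) q
  ...     | zs' , E₂' , d₂' , u₂' , h₂' , p₂ = _ , _ , f∥ d₁' d₂' ,
    Unique-++⁺ u₁' u₂' (λ p q → h₂' q (∈-++⁺ˡ p)) ,
    #-++⁺ ys' (λ q → h₁' q ∘ ∈-++⁺ʳ zs) (λ q → h₂' q ∘ ∈-++⁺ʳ ys') , PermP.++⁺ p₁ p₂

  moveNames : ∀ {ρ Q V ys zs E E'} → ys ↭ zs → Fl ρ Q zs E' → E ↭ E' → Unique ys → ys # V →
              ∃ λ ys' → ∃ λ E' → Fl ρ Q ys' E' × Unique ys' × ys' # V × E ↭ E'
  moveNames p d q u h = _ , _ , d , Unique-resp-↭ p u , #-↭ p h , q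

  sim-α-cond : ∀ {ρ : Name → Name} {x y z} P → y ∉ occP P →
               ∀ {a} → a ∈ fvP P → (ρ [ x ↦ z ]) a ≡ (ρ [ y ↦ z ]) ((x ⟼ y) a)
  sim-α-cond {ρ} {x} {y} {z} P y∉ {a} a∈ with a ≟ x
  ... | yes refl = sym ([↦]-same ρ y z)
  ... | no _     = sym ([↦]-other ρ (λ { refl → y∉ (fv⊆occ P a∈) }))

  extr-cond : ∀ {ρ : Name → Name} {a y xs} → a ∉ xs → ∀ {b} → b ∈ xs → ρ b ≡ (ρ [ a ↦ y ]) b
  extr-cond {ρ} a∉ b∈ = sym ([↦]-other ρ (λ { refl → a∉ b∈ }))

  [↦]-swap : ∀ {ρ : Name → Name} {a b y z} → a ≢ b → ∀ c → ((ρ [ a ↦ y ]) [ b ↦ z ]) c ≡ ((ρ [ b ↦ z ]) [ a ↦ y ]) c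
  [↦]-swap {ρ} {a} {b} ne c with c ≟ b | c ≟ a
  ... | yes refl | yes refl = ⊥-elim (ne refl)
  ... | yes refl | no _  = sym ([↦]-same ρ b _)
  ... | no _ | yes refl = [↦]-same ρ a _
  ... | no p | no q = trans ([↦]-other ρ q) (sym ([↦]-other ρ p))

  sim-νν : ∀ {a b P} → Sim (ν a (ν b P)) (ν b (ν a P))
  sim-νν {a} {b} V (fν {y = y} (fν {y = z} {ys = ys} d)) u h with a ≟ b
  ... | yes refl = _ , _ , fν (fν d) , u , h , ↭-refl
  ... | no ne = moveNames (swap y z ↭-refl) (fν (fν (Fl-cong (λ {c} _ → [↦]-swap ne c) d))) ↭-refl u h

  sim : ∀ {P Q} → P ≡ₛ Q → Sim P Q × Sim Q P
  sim ≡-refl = sim-refl , sim-refl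
  sim (≡-sym e) = let (s , t) = sim e in t , s
  sim (≡-trans e e') = let (s , t) = sim e ; (s' , t') = sim e' in sim-trans s s' , sim-trans t' t
  sim (≡-ν e) = let (s , t) = sim e in sim-ν s , sim-ν t
  sim (≡-∥ e e') = let (s , t) = sim e ; (s' , t') = sim e' in sim-∥ s s' , sim-∥ t t'
  sim (≡-α {P = P} y∉) = (λ { V (fν d) u h → _ , _ , fν (Fl-rename⁺ P y∉ (sim-α-cond P y∉) d) , u , h , ↭-refl })
                       , (λ { V (fν d) u h → _ , _ , fν (Fl-rename⁻ P y∉ (sim-α-cond P y∉) d) , u , h , ↭-refl })
  sim ≡-assoc =
      (λ { V (f∥ (f∥ {ys = ys} {zs = zs} {E = E} {E' = E'} d₁ d₂) d₃) u h →
        moveNames (PermP.++-assoc ys zs _) (f∥ d₁ (f∥ d₂ d₃)) (PermP.++-assoc E E' _) u h })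
    , (λ { V (f∥ {ys = ys} {E = E} d₁ (f∥ {ys = zs} {E = E'} d₂ d₃)) u h →
        moveNames (↭-sym (PermP.++-assoc ys zs _)) (f∥ (f∥ d₁ d₂) d₃) (↭-sym (PermP.++-assoc E E' _)) u h })
  sim ≡-comm = s , s
    where s : ∀ {P Q} → Sim (P ∥ Q) (Q ∥ P)
          s V (f∥ {ys = ys} {E = E} d₁ d₂) u h = moveNames (PermP.++-comm ys _) (f∥ d₂ d₁) (PermP.++-comm E _) u h
  sim ≡-unit =
      (λ { V (f∥ {ys = ys} {E = E} d f𝟘) u h → moveNames (PermP.++-identityʳ ys) d (PermP.++-identityʳ E) u h })
    , (λ { V {ys} {E} d u h → moveNames (↭-sym (PermP.++-identityʳ ys)) (f∥ d f𝟘) (↭-sym (PermP.++-identityʳ E)) u h })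
  sim ≡-ν𝟘 = (λ { V (fν f𝟘) u h → _ , _ , f𝟘 , [] , (λ ()) , ↭-refl })
           , (λ { V f𝟘 u h → bound V ∷ [] , _ , fν f𝟘 , [] ∷ [] , (λ { (here refl) → bound≤⇒∉ ≤-refl }) , ↭-refl })
  sim ≡-νν = sim-νν , sim-νν
  sim (≡-extr {a = a} {P = P} a∉) =
      (λ { V (f∥ {ys = ys} d₁ (fν {y = y} d₂)) u h →
        moveNames (PermP.shift y ys _) (fν (f∥ (Fl-cong (extr-cond a∉) d₁) d₂)) ↭-refl u h })
    , (λ { V (fν {y = y} (f∥ {ys = ys} d₁ d₂)) u h →
        moveNames (↭-sym (PermP.shift y ys _)) (f∥ (Fl-cong (sym ∘ extr-cond a∉) d₁) (fν d₂)) ↭-refl u h })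

  -- If no binder is named `a`, then `a` occurs in the items of a flattening exactly when it is
  -- free, and congruence preserves the items up to permutation.
  ≡ₛ-fv : ∀ {P Q a} → P ≡ₛ Q → a ∈ fvP P → a ∈ fvP Q
  ≡ₛ-fv {P} {Q} {a} e a∈ with Fl-exists id P (a ∷ []) []
  ... | ys , E , d , u , h , _ with proj₁ (sim e) (a ∷ []) d u h
  ...   | ys' , E' , d' , u' , h' , p with Fl-names d' (PermP.∈-resp-↭ (concatMap-↭ namesI p) (Fl-fv d a∈))
  ...     | inj₁ q = ⊥-elim (h' q (here refl))
  ...     | inj₂ (b , b∈ , refl) = b∈

  -- Standard forms

  procSetoid : Setoid _ _
  procSetoid = record { Carrier = Proc ; _≈_ = _≡ₛ_
                      ; isEquivalence = record { refl = ≡-refl ; sym = ≡-sym ; trans = ≡-trans } }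

  ∥-congˡ : ∀ {P Q Q'} → Q ≡ₛ Q' → (P ∥ Q) ≡ₛ (P ∥ Q')
  ∥-congˡ = ≡-∥ ≡-refl

  ∥-congʳ : ∀ {P P' Q} → P ≡ₛ P' → (P ∥ Q) ≡ₛ (P' ∥ Q)
  ∥-congʳ e = ≡-∥ e ≡-refl

  ∥-unitˡ : ∀ {P} → (𝟘 ∥ P) ≡ₛ P
  ∥-unitˡ = ≡-trans ≡-comm ≡-unit

  ∥-interchange : ∀ {A B C D} → ((A ∥ B) ∥ (C ∥ D)) ≡ₛ ((A ∥ C) ∥ (B ∥ D))
  ∥-interchange {A} {B} {C} {D} = begin
    (A ∥ B) ∥ (C ∥ D) ≈⟨ ≡-assoc ⟩
    A ∥ (B ∥ (C ∥ D)) ≈⟨ ∥-congˡ (≡-sym ≡-assoc) ⟩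
    A ∥ ((B ∥ C) ∥ D) ≈⟨ ∥-congˡ (∥-congʳ ≡-comm) ⟩
    A ∥ ((C ∥ B) ∥ D) ≈⟨ ∥-congˡ ≡-assoc ⟩
    A ∥ (C ∥ (B ∥ D)) ≈⟨ ≡-sym ≡-assoc ⟩
    (A ∥ C) ∥ (B ∥ D) ∎
    where open SetoidR procSetoid

  νs-cong : ∀ xs {P Q} → P ≡ₛ Q → νs xs P ≡ₛ νs xs Q
  νs-cong []       e = e
  νs-cong (x ∷ xs) e = ≡-ν (νs-cong xs e)

  νs-++ : ∀ xs ys P → νs (xs ++ ys) P ≡ νs xs (νs ys P)
  νs-++ []       ys P = refl
  νs-++ (x ∷ xs) ys P = cong (ν x) (νs-++ xs ys P)

  νs-extrude : ∀ xs {P Q} → xs # fvP P → (P ∥ νs xs Q) ≡ₛ νs xs (P ∥ Q)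
  νs-extrude []       h = ≡-refl
  νs-extrude (x ∷ xs) h = ≡-trans (≡-extr (h (here refl))) (≡-ν (νs-extrude xs (h ∘ there)))

  νs-↭ : ∀ {xs ys P} → xs ↭ ys → νs xs P ≡ₛ νs ys P
  νs-↭ Perm.refl = ≡-refl
  νs-↭ (prep x p) = ≡-ν (νs-↭ p)
  νs-↭ (swap x y p) = ≡-trans ≡-νν (≡-ν (≡-ν (νs-↭ p)))
  νs-↭ (Perm.trans p q) = ≡-trans (νs-↭ p) (νs-↭ q)

  ν-unused : ∀ {a P} → a ∉ fvP P → P ≡ₛ ν a P
  ν-unused {a} {P} a∉ = begin
    P           ≈⟨ ≡-sym ≡-unit ⟩
    P ∥ 𝟘       ≈⟨ ∥-congˡ (≡-sym ≡-ν𝟘) ⟩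
    P ∥ ν a 𝟘   ≈⟨ ≡-extr a∉ ⟩
    ν a (P ∥ 𝟘) ≈⟨ ≡-ν ≡-unit ⟩
    ν a P       ∎
    where open SetoidR procSetoid

  fv-νs⁻ : ∀ xs {P a} → a ∈ fvP (νs xs P) → a ∈ fvP P × a ∉ xs
  fv-νs⁻ []       a∈ = a∈ , λ ()
  fv-νs⁻ (x ∷ xs) {P} a∈ with ∈removeName⁻ (fvP (νs xs P)) a∈
  ... | a∈' , ne with fv-νs⁻ xs a∈'
  ...   | r , n = r , λ { (here e) → ne e ; (there q) → n q }

  -- A name of `zs` that is missing from `ys` is not free in `R` and can be added as a vacuous
  -- restriction; the others are permuted to the front.
  νs-reorder : ∀ zs ys {R} → Unique zs → (∀ {z} → z ∈ zs → z ∈ fvP R → z ∈ ys) →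
               ∃ λ ws → νs ys R ≡ₛ νs zs (νs ws R)
  νs-reorder [] ys u h = ys , ≡-refl
  νs-reorder (z ∷ zs) ys {R} u h with Unique-∷⁻ u | z ∈? ys
  ... | z∉ , v | no n with νs-reorder zs ys v (h ∘ there)
  ...   | ws , e = ws , ≡-trans (ν-unused (λ p → n (h (here refl) (proj₁ (fv-νs⁻ ys p))))) (≡-ν e)
  νs-reorder (z ∷ zs) ys {R} u h | z∉ , v | yes p with ∈-∃++ p
  ...   | as , bs , refl with νs-reorder zs (as ++ bs) {R} v h'
    where h' : ∀ {z'} → z' ∈ zs → z' ∈ fvP R → z' ∈ as ++ bs
          h' z'∈ f with ∈-++⁻ as (h (there z'∈) f)
          ... | inj₁ q = ∈-++⁺ˡ q
          ... | inj₂ (here refl) = ⊥-elim (z∉ z'∈)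
          ... | inj₂ (there q) = ∈-++⁺ʳ as q
  ...     | ws , e = ws , ≡-trans (νs-↭ (PermP.shift z as bs)) (≡-ν e)

  ⟪⟫-∷ : ∀ M Γ → ⟪ M ∷ Γ ⟫ ≡ₛ (⟨ M ⟩ ∥ ⟪ Γ ⟫)
  ⟪⟫-∷ M []       = ≡-sym ≡-unit
  ⟪⟫-∷ M (N ∷ Γ)  = ≡-refl

  ⟪⟫-++ : ∀ Γ Δ → (⟪ Γ ⟫ ∥ ⟪ Δ ⟫) ≡ₛ ⟪ Γ ++ Δ ⟫
  ⟪⟫-++ []      Δ = ∥-unitˡ
  ⟪⟫-++ (M ∷ Γ) Δ = begin
    ⟪ M ∷ Γ ⟫ ∥ ⟪ Δ ⟫       ≈⟨ ∥-congʳ (⟪⟫-∷ M Γ) ⟩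
    (⟨ M ⟩ ∥ ⟪ Γ ⟫) ∥ ⟪ Δ ⟫ ≈⟨ ≡-assoc ⟩
    ⟨ M ⟩ ∥ (⟪ Γ ⟫ ∥ ⟪ Δ ⟫) ≈⟨ ∥-congˡ (⟪⟫-++ Γ Δ) ⟩
    ⟨ M ⟩ ∥ ⟪ Γ ++ Δ ⟫      ≈⟨ ≡-sym (⟪⟫-∷ M (Γ ++ Δ)) ⟩
    ⟪ M ∷ Γ ++ Δ ⟫          ∎
    where open SetoidR procSetoid

  qproc : List Item → Proc
  qproc []              = 𝟘
  qproc (im M ∷ E)      = qproc E
  qproc (iq t q Ms ∷ E) = Qc q Ms ∥ qproc E

  qitems : List Item → List Item
  qitems []              = []
  qitems (im M ∷ E)      = qitems E
  qitems (iq t q Ms ∷ E) = iq t q Ms ∷ qitems E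

  proc : List Item → Proc
  proc E = ⟪ msgs E ⟫ ∥ qproc E

  qproc-++ : ∀ E E' → (qproc E ∥ qproc E') ≡ₛ qproc (E ++ E')
  qproc-++ []              E' = ∥-unitˡ
  qproc-++ (im M ∷ E)      E' = qproc-++ E E'
  qproc-++ (iq t q Ms ∷ E) E' = ≡-trans ≡-assoc (∥-congˡ (qproc-++ E E'))

  msgs-++ : ∀ E E' → msgs (E ++ E') ≡ msgs E ++ msgs E'
  msgs-++ []              E' = refl
  msgs-++ (im M ∷ E)      E' = cong (M ∷_) (msgs-++ E E')
  msgs-++ (iq t q Ms ∷ E) E' = msgs-++ E E'

  proc-++ : ∀ E E' → (proc E ∥ proc E') ≡ₛ proc (E ++ E')
  proc-++ E E' = ≡-trans ∥-interchange
    (≡-∥ (subst (λ Γ → (⟪ msgs E ⟫ ∥ ⟪ msgs E' ⟫) ≡ₛ ⟪ Γ ⟫) (sym (msgs-++ E E')) (⟪⟫-++ (msgs E) (msgs E'))) (qproc-++ E E'))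

  qproc-↭ : ∀ {E E'} → E ↭ E' → qproc E ≡ₛ qproc E'
  qproc-↭ Perm.refl = ≡-refl
  qproc-↭ (prep (im _) p) = qproc-↭ p
  qproc-↭ (prep (iq _ _ _) p) = ∥-congˡ (qproc-↭ p)
  qproc-↭ (swap (im _) (im _) p) = qproc-↭ p
  qproc-↭ (swap (im _) (iq _ _ _) p) = ∥-congˡ (qproc-↭ p)
  qproc-↭ (swap (iq _ _ _) (im _) p) = ∥-congˡ (qproc-↭ p)
  qproc-↭ (swap (iq _ _ _) (iq _ _ _) p) =
    ≡-trans (≡-sym ≡-assoc) (≡-trans (≡-∥ ≡-comm (qproc-↭ p)) ≡-assoc)
  qproc-↭ (Perm.trans p q) = ≡-trans (qproc-↭ p) (qproc-↭ q)

  qproc-qitems : ∀ E → qproc (qitems E) ≡ qproc E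
  qproc-qitems []              = refl
  qproc-qitems (im M ∷ E)      = qproc-qitems E
  qproc-qitems (iq t q Ms ∷ E) = cong (Qc q Ms ∥_) (qproc-qitems E)

  ∈qitems⁺ : ∀ {t q Ms E} → iq t q Ms ∈ E → iq t q Ms ∈ qitems E
  ∈qitems⁺ (here refl) = here refl
  ∈qitems⁺ {E = im _ ∷ _} (there p) = ∈qitems⁺ p
  ∈qitems⁺ {E = iq _ _ _ ∷ _} (there p) = there (∈qitems⁺ p)

  ∈qitems⁻ : ∀ {e} E → e ∈ qitems E → e ∈ E × (∃ λ t → ∃ λ q → ∃ λ Ms → e ≡ iq t q Ms)
  ∈qitems⁻ (im _ ∷ E) p = let (r , s) = ∈qitems⁻ E p in there r , s
  ∈qitems⁻ (iq t q Ms ∷ E) (here refl) = here refl , t , q , Ms , refl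
  ∈qitems⁻ (iq t q Ms ∷ E) (there p) = let (r , s) = ∈qitems⁻ E p in there r , s

  Unique-qitems : ∀ E → Unique (tagsE E) → Unique (qitems E)
  Unique-qitems [] u = []
  Unique-qitems (im _ ∷ E) u = Unique-qitems E u
  Unique-qitems (iq t q Ms ∷ E) u with Unique-∷⁻ u
  ... | t∉ , v = Unique-∷⁺ (λ p → t∉ (concatMap∈⁺ tagsI (proj₁ (∈qitems⁻ E p)) (here refl))) (Unique-qitems E v)

  fv-⟪⟫ : ∀ Γ {a} → a ∈ fvP ⟪ Γ ⟫ → a ∈ namesL Γ
  fv-⟪⟫ (M ∷ []) a∈ = ∈-++⁺ˡ a∈
  fv-⟪⟫ (M ∷ N ∷ Γ) a∈ = Sum.[ ∈-++⁺ˡ , (λ p → ∈-++⁺ʳ (namesM M) (fv-⟪⟫ (N ∷ Γ) p)) ] (∈-++⁻ (namesM M) a∈)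

  fv-qproc : ∀ E {a} → a ∈ fvP (qproc E) → a ∈ namesE E
  fv-qproc (im M ∷ E) a∈ = ∈-++⁺ʳ (namesM M) (fv-qproc E a∈)
  fv-qproc (iq t q Ms ∷ E) a∈ with ∈-++⁻ (namesL Ms) a∈
  ... | inj₁ p = ∈-++⁺ˡ p
  ... | inj₂ p = ∈-++⁺ʳ (namesL Ms) (fv-qproc E p)

  fv-proc : ∀ E {a} → a ∈ fvP (proc E) → a ∈ namesE E
  fv-proc E a∈ with ∈-++⁻ (fvP ⟪ msgs E ⟫) a∈
  ... | inj₁ p = names-msgs E (fv-⟪⟫ (msgs E) p)
  ... | inj₂ p = fv-qproc E p

  size : Proc → ℕ
  size 𝟘         = 0
  size (ν x P)   = suc (size P)
  size (P ∥ Q)   = suc (size P + size Q)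
  size ⟨ M ⟩     = 0
  size (Qc q Ms) = 0

  size-rename : ∀ x y P → size (renameP x y P) ≡ size P
  size-rename x y 𝟘 = refl
  size-rename x y (ν z P) with z ≟ x
  ... | yes _ = refl
  ... | no _  = cong suc (size-rename x y P)
  size-rename x y (P ∥ Q) = cong₂ (λ m n → suc (m + n)) (size-rename x y P) (size-rename x y Q)
  size-rename x y ⟨ M ⟩ = refl
  size-rename x y (Qc q Ms) = refl

  occ-ren : ∀ {x y a} ns → a ∈ map (x ⟼ y) ns → a ≡ y ⊎ a ∈ ns
  occ-ren {x} {y} ns p with ∈-map⁻ (x ⟼ y) p
  ... | b , b∈ , refl with b ≟ x
  ...   | yes _ = inj₁ refl
  ...   | no _  = inj₂ b∈

  occ-rename : ∀ x y P {a} → a ∈ occP (renameP x y P) → a ≡ y ⊎ a ∈ occP P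
  occ-rename x y (ν z P) p with z ≟ x
  ... | yes _ = inj₂ p
  ... | no _ with p
  ...   | here e = inj₂ (here e)
  ...   | there q with occ-rename x y P q
  ...     | inj₁ e = inj₁ e
  ...     | inj₂ r = inj₂ (there r)
  occ-rename x y (P ∥ Q) p with ∈-++⁻ (occP (renameP x y P)) p
  ... | inj₁ q with occ-rename x y P q
  ...   | inj₁ e = inj₁ e
  ...   | inj₂ r = inj₂ (∈-++⁺ˡ r)
  occ-rename x y (P ∥ Q) p | inj₂ q with occ-rename x y Q q
  ...   | inj₁ e = inj₁ e
  ...   | inj₂ r = inj₂ (∈-++⁺ʳ (occP P) r)
  occ-rename x y ⟨ M ⟩ {a} p = occ-ren (namesM M) (subst (a ∈_) (namesM-ren (x ⟼ y) M) p)
  occ-rename x y (Qc q Ms) {a} p = occ-ren (namesL Ms) (subst (a ∈_) (namesL-ren (x ⟼ y) Ms) p)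

  -- Induction on the size, because an α-renamed body is not a subterm. Names outside `occP P` make
  -- every α-step and every scope extrusion legitimate.
  standardForm-fresh : ∀ n P → size P ≤ n → ∀ {ys E} → Fl id P ys E → Unique ys → ys # occP P → P ≡ₛ νs ys (proc E)
  standardForm-fresh n 𝟘 s f𝟘 u h = ≡-sym ≡-unit
  standardForm-fresh n ⟨ M ⟩ s fm u h rewrite renM-id M = ≡-sym ≡-unit
  standardForm-fresh n (Qc q Ms) s (fq t) u h rewrite renL-id Ms = ≡-sym (≡-trans ∥-unitˡ ≡-unit)
  standardForm-fresh (suc n) (ν x P) (s≤s s) (fν {y = y} {ys = ys} d) u h with Unique-∷⁻ u
  ... | y∉ , v = ≡-trans (≡-α (h (here refl) ∘ there))
    (≡-ν (standardForm-fresh n (renameP x y P) (≤-trans (≤-reflexive (size-rename x y P)) s)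
      (Fl-rename⁺ P (h (here refl) ∘ there) (λ {a} _ → agree a) d) v h'))
    where
      agree : ∀ a → (id [ x ↦ y ]) a ≡ (x ⟼ y) a
      agree a with a ≟ x
      ... | yes _ = refl
      ... | no _  = refl
      h' : ys # occP (renameP x y P)
      h' a∈ p with occ-rename x y P p
      ... | inj₁ refl = y∉ a∈
      ... | inj₂ q    = h (there a∈) (there q)
  standardForm-fresh (suc n) (P ∥ Q) (s≤s s) (f∥ {ys = ys} {zs = zs} {E = E} {E' = E'} d₁ d₂) u h with Unique-++⁻ ys u
  ... | u₁ , u₂ , dis = begin
    P ∥ Q                               ≈⟨ ∥-congʳ (standardForm-fresh n P (≤-trans (m≤m+n _ _) s) d₁ u₁ (λ p → h (∈-++⁺ˡ p) ∘ ∈-++⁺ˡ)) ⟩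
    νs ys (proc E) ∥ Q                  ≈⟨ ≡-comm ⟩
    Q ∥ νs ys (proc E)                  ≈⟨ νs-extrude ys (λ p q → h (∈-++⁺ˡ p) (∈-++⁺ʳ (occP P) (fv⊆occ Q q))) ⟩
    νs ys (Q ∥ proc E)                  ≈⟨ νs-cong ys ≡-comm ⟩
    νs ys (proc E ∥ Q)                  ≈⟨ νs-cong ys (∥-congˡ (standardForm-fresh n Q (≤-trans (m≤n+m _ (size P)) s) d₂ u₂
                                             (λ p → h (∈-++⁺ʳ ys p) ∘ ∈-++⁺ʳ (occP P)))) ⟩
    νs ys (proc E ∥ νs zs (proc E'))    ≈⟨ νs-cong ys (νs-extrude zs zs#) ⟩
    νs ys (νs zs (proc E ∥ proc E'))    ≈⟨ νs-cong ys (νs-cong zs (proc-++ E E')) ⟩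
    νs ys (νs zs (proc (E ++ E')))      ≡⟨ sym (νs-++ ys zs _) ⟩
    νs (ys ++ zs) (proc (E ++ E'))      ∎
    where
      open SetoidR procSetoid
      zs# : zs # fvP (proc E)
      zs# z∈ p with Fl-names d₁ (fv-proc E p)
      ... | inj₁ q = dis q z∈
      ... | inj₂ (a , a∈ , refl) = h (∈-++⁺ʳ ys z∈) (∈-++⁺ˡ (fv⊆occ P a∈))

  -- Binder lists and their environments

  envs : (Name → Name) → List Name → List Name → Name → Name
  envs ρ []       ws       = ρ
  envs ρ (x ∷ xs) []       = ρ
  envs ρ (x ∷ xs) (w ∷ ws) = envs (ρ [ x ↦ w ]) xs ws

  envs-∉ : ∀ ρ xs ws {a} → a ∉ xs → envs ρ xs ws a ≡ ρ a
  envs-∉ ρ []       ws       a∉ = refl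
  envs-∉ ρ (x ∷ xs) []       a∉ = refl
  envs-∉ ρ (x ∷ xs) (w ∷ ws) a∉ = trans (envs-∉ _ xs ws (a∉ ∘ there)) ([↦]-other ρ (a∉ ∘ here))

  envs-last : ∀ ρ xs ws {x w c} → c ∉ xs → c ∈ x ∷ xs → envs (ρ [ x ↦ w ]) xs ws c ≡ w
  envs-last ρ xs ws         n (there q)   = ⊥-elim (n q)
  envs-last ρ xs ws {x} {w} n (here refl) = trans (envs-∉ _ xs ws n) ([↦]-same ρ x w)

  envs-∈ : ∀ ρ xs ws {a} → length xs ≡ length ws → a ∈ xs → envs ρ xs ws a ∈ ws
  envs-∈ ρ (x ∷ xs) (w ∷ ws) {a} l a∈ with a ∈? xs
  ... | yes p = there (envs-∈ _ xs ws (suc-injective l) p)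
  ... | no n  = here (envs-last ρ xs ws n a∈)

  envs-inj : ∀ ρ xs ws → length xs ≡ length ws → Unique ws → InjOn (envs ρ xs ws) xs
  envs-inj ρ (x ∷ xs) (w ∷ ws) l u {a} {b} a∈ b∈ e with Unique-∷⁻ u | a ∈? xs | b ∈? xs
  ... | w∉ , v | yes p | yes q = envs-inj _ xs ws (suc-injective l) v p q e
  ... | w∉ , v | yes p | no n = ⊥-elim (w∉ (subst (_∈ ws) (trans e (envs-last ρ xs ws n b∈)) (envs-∈ _ xs ws (suc-injective l) p)))
  ... | w∉ , v | no n | yes q = ⊥-elim (w∉ (subst (_∈ ws) (trans (sym e) (envs-last ρ xs ws n a∈)) (envs-∈ _ xs ws (suc-injective l) q)))
  ... | w∉ , v | no n | no m with a∈ | b∈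
  ...   | there q | _ = ⊥-elim (n q)
  ...   | _ | there q = ⊥-elim (m q)
  ...   | here refl | here refl = refl

  envs-map : ∀ θ ρ xs → (∀ {a} → a ∉ xs → ρ a ≡ θ a) → ∀ a → envs ρ xs (map θ xs) a ≡ θ a
  envs-map θ ρ []       h a = h λ ()
  envs-map θ ρ (x ∷ xs) h a = envs-map θ (ρ [ x ↦ θ x ]) xs h' a
    where h' : ∀ {b} → b ∉ xs → (ρ [ x ↦ θ x ]) b ≡ θ b
          h' {b} n with b ≟ x
          ... | yes refl = refl
          ... | no m     = h λ { (here e) → m e ; (there q) → n q }

  Fl-νs⁺ : ∀ {ρ} xs ws {P ys E} → length xs ≡ length ws → Fl (envs ρ xs ws) P ys E → Fl ρ (νs xs P) (ws ++ ys) E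
  Fl-νs⁺ []       []       l d = d
  Fl-νs⁺ (x ∷ xs) (w ∷ ws) l d = fν (Fl-νs⁺ xs ws (suc-injective l) d)

  Fl-νs⁻ : ∀ {ρ} xs {P zs E} → Fl ρ (νs xs P) zs E →
           ∃ λ ws → ∃ λ ys → zs ≡ ws ++ ys × length xs ≡ length ws × Fl (envs ρ xs ws) P ys E
  Fl-νs⁻ []       d = [] , _ , refl , refl , d
  Fl-νs⁻ (x ∷ xs) (fν {y = y} d) with Fl-νs⁻ xs d
  ... | ws , ys , refl , l , d' = y ∷ ws , ys , refl , cong suc l , d'

  Fl-⟪⟫⁺ : ∀ {ρ} Γ → Fl ρ ⟪ Γ ⟫ [] (map (im ∘ renM ρ) Γ)
  Fl-⟪⟫⁺ []          = f𝟘
  Fl-⟪⟫⁺ (M ∷ [])    = fm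
  Fl-⟪⟫⁺ (M ∷ N ∷ Γ) = f∥ fm (Fl-⟪⟫⁺ (N ∷ Γ))

  Fl-⟪⟫⁻ : ∀ {ρ} Γ {ys E} → Fl ρ ⟪ Γ ⟫ ys E → ys ≡ [] × E ≡ map (im ∘ renM ρ) Γ
  Fl-⟪⟫⁻ []       f𝟘 = refl , refl
  Fl-⟪⟫⁻ (M ∷ []) fm = refl , refl
  Fl-⟪⟫⁻ (M ∷ N ∷ Γ) (f∥ fm d) with Fl-⟪⟫⁻ (N ∷ Γ) d
  ... | refl , refl = refl , refl

  -- The items in the order in which `proc E` lists them, messages before process constants.
  sorted : (Name → Name) → List Item → List Item
  sorted θ E = map (im ∘ renM θ) (msgs E) ++ map (renI θ id) (qitems E)

  Fl-qproc : ∀ {ρ} E → Fl ρ (qproc E) [] (map (renI ρ id) (qitems E))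
  Fl-qproc []              = f𝟘
  Fl-qproc (im M ∷ E)      = Fl-qproc E
  Fl-qproc (iq t q Ms ∷ E) = f∥ (fq t) (Fl-qproc E)

  Fl-proc : ∀ {ρ} E → Fl ρ (proc E) [] (sorted ρ E)
  Fl-proc E = f∥ (Fl-⟪⟫⁺ (msgs E)) (Fl-qproc E)

  msgs-sorted : ∀ θ E → msgs (sorted θ E) ≡ msgs (map (renI θ id) E)
  msgs-sorted θ E = trans (go (msgs E)) (sym (msgs-ren θ id E))
    where
      none : ∀ E → msgs (map (renI θ id) (qitems E)) ≡ []
      none []              = refl
      none (im M ∷ E)      = none E
      none (iq t q Ms ∷ E) = none E
      go : ∀ Γ → msgs (map (im ∘ renM θ) Γ ++ map (renI θ id) (qitems E)) ≡ map (renM θ) Γ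
      go []      = none E
      go (M ∷ Γ) = cong (renM θ M ∷_) (go Γ)

  qproc-sorted : ∀ θ E → qproc (sorted θ E) ≡ qproc (map (renI θ id) E)
  qproc-sorted θ E = trans (go (msgs E)) (eq E)
    where
      eq : ∀ E → qproc (map (renI θ id) (qitems E)) ≡ qproc (map (renI θ id) E)
      eq []              = refl
      eq (im M ∷ E)      = eq E
      eq (iq t q Ms ∷ E) = cong (Qc q _ ∥_) (eq E)
      go : ∀ Γ → qproc (map (im ∘ renM θ) Γ ++ map (renI θ id) (qitems E)) ≡ qproc (map (renI θ id) (qitems E))
      go []      = refl
      go (M ∷ Γ) = go Γ

  ∈sorted : ∀ {e} E → e ∈ E → e ∈ sorted id E
  ∈sorted {im M} E e∈ = ∈-++⁺ˡ (subst (λ N → im N ∈ _) (renM-id M) (∈-map⁺ (im ∘ renM id) (∈msgs⁺ e∈)))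
  ∈sorted {iq t q Ms} E e∈ = ∈-++⁺ʳ (map (im ∘ renM id) (msgs E))
    (subst (_∈ map (renI id id) (qitems E)) (renI-id (iq t q Ms)) (∈-map⁺ (renI id id) (∈qitems⁺ e∈)))

  tags-sorted : ∀ E → tagsE (sorted id E) ≡ tagsE E
  tags-sorted E = trans (go (msgs E)) (eq E)
    where
      eq : ∀ E → tagsE (map (renI id id) (qitems E)) ≡ tagsE E
      eq []              = refl
      eq (im M ∷ E)      = eq E
      eq (iq t q Ms ∷ E) = cong (t ∷_) (eq E)
      go : ∀ Γ → tagsE (map (im ∘ renM id) Γ ++ map (renI id id) (qitems E)) ≡ tagsE (map (renI id id) (qitems E))
      go []      = refl
      go (M ∷ Γ) = go Γ

  -- Both sides flatten to the same configuration once the names ys are shifted out of the way.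
  standardForm : ∀ {P ys E} → Fl id P ys E → Unique ys → ys # fvP P → P ≡ₛ νs ys (proc E)
  standardForm {P} {ys} {E} d u h = ≡-trans
      (standardForm-fresh (size P) P ≤-refl
        (Fl-cong (λ a∈ → θ-∉ (λ p → h p a∈)) (Fl-ren θ id d)) uθ (λ a∈ p → θ# a∈ (∈-++⁺ˡ p)))
      (≡-sym (subst (νs ys (proc E) ≡ₛ_) (cong₂ νs (++-identityʳ (map θ ys)) procEq)
        (standardForm-fresh _ (νs ys (proc E)) ≤-refl
          (Fl-νs⁺ ys (map θ ys) (sym (length-map θ ys)) (Fl-cong (λ {a} _ → sym (envs-map θ id ys (sym ∘ θ-∉) a)) (Fl-proc E)))
          (subst Unique (sym (++-identityʳ (map θ ys))) uθ)
          (λ {a} a∈ p → θ# (subst (a ∈_) (++-identityʳ (map θ ys)) a∈) (∈-++⁺ʳ (occP P) p)))))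
    where
      N = bound (occP P ++ occP (νs ys (proc E)))
      θ : Name → Name
      θ a with a ∈? ys
      ... | yes _ = N + a
      ... | no _  = a
      θ-∉ : ∀ {a} → a ∉ ys → θ a ≡ a
      θ-∉ {a} n with a ∈? ys
      ... | yes p = ⊥-elim (n p)
      ... | no _  = refl
      θ-∈ : ∀ {a} → a ∈ ys → θ a ≡ N + a
      θ-∈ {a} p with a ∈? ys
      ... | yes _ = refl
      ... | no n  = ⊥-elim (n p)
      uθ : Unique (map θ ys)
      uθ = Unique-map-InjOn θ (λ {a} {b} p q e → +-cancelˡ-≡ N a b (trans (sym (θ-∈ p)) (trans e (θ-∈ q)))) u
      θ# : map θ ys # (occP P ++ occP (νs ys (proc E)))
      θ# a∈ p with ∈-map⁻ θ a∈
      ... | b , b∈ , refl = bound≤⇒∉ (≤-trans (m≤m+n N b) (≤-reflexive (sym (θ-∈ b∈)))) p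
      procEq : proc (sorted θ E) ≡ proc (map (renI θ id) E)
      procEq = cong₂ (λ Γ Q → ⟪ Γ ⟫ ∥ Q) (msgs-sorted θ E) (qproc-sorted θ E)

  -- The order ⊑ in terms of flattenings

  -- `ys` avoids only the free names of `P` itself. It may contain names that are free in a smaller
  -- process, which is how capture by additional binders is expressed.
  FlatOf : Proc → List Item → Set
  FlatOf P E = ∃ λ ys → Fl id P ys E × Unique ys × ys # fvP P × Unique (tagsE E)

  -- A binder list cs with possible repetitions can be named so that the resulting environment is ρ;
  -- shadowed binders receive junk names.
  nameBinders : ∀ cs U (ρ ρ₀ : Name → Name) → (∀ {a} → a ∉ cs → ρ₀ a ≡ ρ a) → InjOn ρ cs → (∀ {a} → a ∈ cs → ρ a ∈ U) →
    ∃ λ ws → length cs ≡ length ws × (∀ a → envs ρ₀ cs ws a ≡ ρ a) × Unique ws ×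
             (∀ {w} → w ∈ ws → (∃ λ c → c ∈ cs × w ≡ ρ c) ⊎ w ∉ U)
  nameBinders [] U ρ ρ₀ off inj sub = [] , refl , (λ a → off λ ()) , [] , λ ()
  nameBinders (c ∷ cs) U ρ ρ₀ off inj sub with c ∈? cs
  ... | yes p with nameBinders cs (bound U ∷ U) ρ (ρ₀ [ c ↦ bound U ])
                    (λ {a} a∉ → trans ([↦]-other ρ₀ (λ { refl → a∉ p })) (off λ { (here refl) → a∉ p ; (there q) → a∉ q }))
                    (λ a b → inj (there a) (there b)) (λ a∈ → there (sub (there a∈)))
  ...   | ws , l , env , u , orig = bound U ∷ ws , cong suc l , env ,
          Unique-∷⁺ (λ w∈ → not∈ (orig w∈)) u ,
          λ { (here refl) → inj₂ (bound≤⇒∉ ≤-refl) ; (there w∈) → weaken (orig w∈) }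
    where
      not∈ : (∃ λ c' → c' ∈ cs × bound U ≡ ρ c') ⊎ bound U ∉ bound U ∷ U → ⊥
      not∈ (inj₁ (c' , c'∈ , e)) = bound≤⇒∉ (≤-reflexive e) (sub (there c'∈))
      not∈ (inj₂ n) = n (here refl)
      weaken : ∀ {w} → (∃ λ c' → c' ∈ cs × w ≡ ρ c') ⊎ w ∉ bound U ∷ U → (∃ λ c' → c' ∈ c ∷ cs × w ≡ ρ c') ⊎ w ∉ U
      weaken (inj₁ (c' , c'∈ , e)) = inj₁ (c' , there c'∈ , e)
      weaken (inj₂ n) = inj₂ (n ∘ there)
  nameBinders (c ∷ cs) U ρ ρ₀ off inj sub | no n with nameBinders cs U ρ (ρ₀ [ c ↦ ρ c ]) off'
                    (λ a b → inj (there a) (there b)) (sub ∘ there)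
    where
      off' : ∀ {a} → a ∉ cs → (ρ₀ [ c ↦ ρ c ]) a ≡ ρ a
      off' {a} a∉ with a ≟ c
      ... | yes refl = refl
      ... | no m     = off λ { (here e) → m e ; (there q) → a∉ q }
  ...   | ws , l , env , u , orig = ρ c ∷ ws , cong suc l , env ,
          Unique-∷⁺ (λ w∈ → not∈ (orig w∈)) u ,
          λ { (here refl) → inj₁ (c , here refl , refl) ; (there w∈) → weaken (orig w∈) }
    where
      not∈ : (∃ λ c' → c' ∈ cs × ρ c ≡ ρ c') ⊎ ρ c ∉ U → ⊥
      not∈ (inj₁ (c' , c'∈ , e)) = n (subst (_∈ cs) (sym (inj (here refl) (there c'∈) e)) c'∈)
      not∈ (inj₂ m) = m (sub (here refl))
      weaken : ∀ {w} → (∃ λ c' → c' ∈ cs × w ≡ ρ c') ⊎ w ∉ U → (∃ λ c' → c' ∈ c ∷ cs × w ≡ ρ c') ⊎ w ∉ U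
      weaken (inj₁ (c' , c'∈ , e)) = inj₁ (c' , there c'∈ , e)
      weaken (inj₂ m) = inj₂ m

  envs-fresh-inj : ∀ xs {zs V} → length xs ≡ length zs → Unique zs → zs # V → InjOn (envs id xs zs) V
  envs-fresh-inj xs {zs} {V} l u h {a} {b} a∈ b∈ e with a ∈? xs | b ∈? xs
  ... | yes p | yes q = envs-inj id xs zs l u p q e
  ... | yes p | no q  = ⊥-elim (h (envs-∈ id xs zs l p) (subst (_∈ V) (sym (trans e (envs-∉ id xs zs q))) b∈))
  ... | no p  | yes q = ⊥-elim (h (envs-∈ id xs zs l q) (subst (_∈ V) (trans (sym (envs-∉ id xs zs p)) e) a∈))
  ... | no p  | no q  = trans (sym (envs-∉ id xs zs p)) (trans e (envs-∉ id xs zs q))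

  tagsE-im : ∀ ρ Γ F → tagsE (map (im ∘ renM ρ) Γ ++ F) ≡ tagsE F
  tagsE-im ρ []      F = refl
  tagsE-im ρ (M ∷ Γ) F = tagsE-im ρ Γ F

  -- The shared binders `xs` receive the names `zs` of the given flattening, while the additional
  -- binders `bs` keep their own names: the names of `Γ` and `Q` that they capture must stay as they
  -- are.
  extendFlattening : ∀ {P'} xs bs {Γ Q Q' zs qs E} V → P' ≡ₛ νs (xs ++ bs) (⟪ Γ ⟫ ∥ Q ∥ Q') →
    fvP P' ⊆ V → xs ++ bs ⊆ V → length xs ≡ length zs → Unique zs → Unique qs → zs # qs → zs # V → qs # V →
    Fl (envs id xs zs) Q qs E → Unique (tagsE E) →
    ∃ λ E' → FlatOf P' E' × map (im ∘ renM (envs id xs zs)) Γ ++ E ⊆ E'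
  extendFlattening {P'} xs bs {Γ} {Q} {Q'} {zs} {qs} {E} V e P'V csV l uzs uqs zs#qs zs#V qs#V dQ uE
    with nameBinders (xs ++ bs) (map (envs id xs zs) (xs ++ bs) ++ V ++ qs) (envs id xs zs) id
           (λ n → sym (envs-∉ id xs zs (n ∘ ∈-++⁺ˡ)))
           (λ a∈ b∈ → envs-fresh-inj xs l uzs zs#V (csV a∈) (csV b∈)) (λ a∈ → ∈-++⁺ˡ (∈-map⁺ _ a∈))
  ... | ws , lws , env , uws , orig with Fl-exists (envs id xs zs) Q' (ws ++ qs ++ V) (tagsE E)
  ...   | q's , E₀ , dQ' , uq's , hq's , uE₀ , hE₀ with proj₂ (sim e) (fvP P')
            (Fl-νs⁺ (xs ++ bs) ws lws (Fl-cong (λ {a} _ → sym (env a)) (f∥ (Fl-⟪⟫⁺ Γ) (f∥ dQ dQ')))) u₂ h₂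
    where
      ρcs : ∀ {c} → c ∈ xs ++ bs → envs id xs zs c ∈ zs ⊎ (envs id xs zs c ≡ c)
      ρcs {c} c∈ with c ∈? xs
      ... | yes p = inj₁ (envs-∈ id xs zs l p)
      ... | no n  = inj₂ (envs-∉ id xs zs n)
      ws#qs : ws # qs
      ws#qs w∈ q∈ with orig w∈
      ... | inj₂ n = n (∈-++⁺ʳ (map (envs id xs zs) (xs ++ bs)) (∈-++⁺ʳ V q∈))
      ... | inj₁ (c , c∈ , refl) with ρcs c∈
      ...   | inj₁ r = zs#qs r q∈
      ...   | inj₂ r = qs#V q∈ (subst (_∈ V) (sym r) (csV c∈))
      u₂ : Unique (ws ++ (qs ++ q's))
      u₂ = Unique-++⁺ uws (Unique-++⁺ uqs uq's (λ p q → hq's q (∈-++⁺ʳ ws (∈-++⁺ˡ p))))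
             (λ p q → case p (∈-++⁻ qs q))
        where case : ∀ {a} → a ∈ ws → a ∈ qs ⊎ a ∈ q's → ⊥
              case p (inj₁ q) = ws#qs p q
              case p (inj₂ q) = hq's q (∈-++⁺ˡ p)
      wsP' : ws # fvP P'
      wsP' w∈ p with orig w∈
      ... | inj₂ n = n (∈-++⁺ʳ (map (envs id xs zs) (xs ++ bs)) (∈-++⁺ˡ (P'V p)))
      ... | inj₁ (c , c∈ , refl) with ρcs c∈
      ...   | inj₁ r = zs#V r (P'V p)
      ...   | inj₂ r = proj₂ (fv-νs⁻ (xs ++ bs) (≡ₛ-fv e p)) (subst (_∈ xs ++ bs) (sym r) c∈)
      h₂ : (ws ++ (qs ++ q's)) # fvP P'
      h₂ = #-++⁺ ws wsP' (#-++⁺ qs (λ q p → qs#V q (P'V p)) (λ q p → hq's q (∈-++⁺ʳ ws (∈-++⁺ʳ qs (P'V p)))))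
  ...     | ys' , E' , d' , u' , h' , p' = E' , (ys' , d' , u' , h' , tags') , incl
    where
      tags' : Unique (tagsE E')
      tags' = Unique-resp-↭ (concatMap-↭ tagsI p') (subst Unique
        (sym (trans (tagsE-im (envs id xs zs) Γ (E ++ E₀)) (tagsE-++ E E₀))) (Unique-++⁺ uE uE₀ (λ p q → hE₀ q p)))
      incl : map (im ∘ renM (envs id xs zs)) Γ ++ E ⊆ E'
      incl p with ∈-++⁻ (map (im ∘ renM (envs id xs zs)) Γ) p
      ... | inj₁ q = PermP.∈-resp-↭ p' (∈-++⁺ˡ q)
      ... | inj₂ q = PermP.∈-resp-↭ p' (∈-++⁺ʳ (map (im ∘ renM (envs id xs zs)) Γ) (∈-++⁺ˡ q))

  -- A flattening that avoids the names of the witnesses of `⊑` passes through the first congruence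
  -- with its binders still fresh. Naming the shared binders is then injective on the knowledge, so
  -- `Γ₁ ⪯ Γ₂` survives it.
  ⊑⇒≼ : ∀ {P P'} → P ⊑ P' → ∃ λ V → ∀ {zs E} → Fl id P zs E → Unique zs → zs # V → Unique (tagsE E) →
        ∃ λ E' → FlatOf P' E' × E ≼ E'
  ⊑⇒≼ {P} {P'} (xs , bs , Γ₁ , Γ₂ , Q , Q' , e₁ , e₂ , pre) = V , result
    where
      V = fvP P' ++ (xs ++ bs) ++ namesL Γ₁ ++ namesL Γ₂
      result : ∀ {zs E} → Fl id P zs E → Unique zs → zs # V → Unique (tagsE E) → ∃ λ E' → FlatOf P' E' × E ≼ E'
      result d u h ut with proj₁ (sim e₁) V d u h
      ... | _ , E₁ , d₁ , u₁ , h₁ , p₁ with Fl-νs⁻ xs d₁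
      ...   | zs , _ , refl , l , f∥ {E' = EQ} dΓ dQ with Fl-⟪⟫⁻ Γ₁ dΓ
      ...     | refl , refl with Unique-++⁻ zs u₁
      ...       | uzs , uqs , zs#qs with extendFlattening xs bs V (subst (P' ≡ₛ_) (sym (νs-++ xs bs _)) e₂)
                    ∈-++⁺ˡ (λ p → ∈-++⁺ʳ (fvP P') (∈-++⁺ˡ p)) l uzs uqs zs#qs (h₁ ∘ ∈-++⁺ˡ) (h₁ ∘ ∈-++⁺ʳ zs) dQ
                    (subst Unique (tagsE-im (envs id xs zs) Γ₁ EQ) (Unique-resp-↭ (concatMap-↭ tagsI p₁) ut))
      ...         | E' , fl , sub = E' , fl , E≼E'
        where
          ρ = envs id xs zs
          Γ₂⊆ : map (renM ρ) Γ₂ ⊆ msgs E'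
          Γ₂⊆ p with ∈-map⁻ (renM ρ) p
          ... | M , M∈ , refl = ∈msgs⁺ (sub (∈-++⁺ˡ (∈-map⁺ (im ∘ renM ρ) M∈)))
          E≼E' : _ ≼ E'
          E≼E' e∈ with ∈-++⁻ (map (im ∘ renM ρ) Γ₁) (PermP.∈-resp-↭ p₁ e∈)
          ... | inj₂ q = ∈⇒Ok (sub (∈-++⁺ʳ (map (im ∘ renM ρ) Γ₂) q))
          ... | inj₁ q with ∈-map⁻ (im ∘ renM ρ) q
          ...   | M , M∈ , refl = ax-mono Γ₂⊆ (⊢-rename ρ
                    (λ a∈ b∈ → envs-fresh-inj xs l uzs (λ p → h₁ (∈-++⁺ˡ p)) (V' a∈) (V' b∈)) (pre M (∈⇒⊢ M∈)))
            where V' : namesL Γ₂ ++ namesM M ⊆ V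
                  V' p = ∈-++⁺ʳ (fvP P') (∈-++⁺ʳ (xs ++ bs) (V'' (∈-++⁻ (namesL Γ₂) p)))
                    where V'' : ∀ {a} → a ∈ namesL Γ₂ ⊎ a ∈ namesM M → a ∈ namesL Γ₁ ++ namesL Γ₂
                          V'' (inj₁ r) = ∈-++⁺ʳ (namesL Γ₁) r
                          V'' (inj₂ r) = ∈-++⁺ˡ (∈namesL⁺ M∈ r)

  splitProc : ∀ E E' → Unique (tagsE E) → E ≼ E' → ∃ λ rest → proc E' ≡ₛ (⟪ msgs E' ⟫ ∥ qproc E ∥ qproc rest)
  splitProc E E' ut s with Unique-⊆⇒↭ (qitems E) {qitems E'} (Unique-qitems E ut) sub
    where sub : ∀ {e} → e ∈ qitems E → e ∈ qitems E'
          sub e∈ with ∈qitems⁻ E e∈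
          ... | e∈E , t , q , Ms , refl = ∈qitems⁺ (s e∈E)
  ... | rest , p = rest , ∥-congˡ (subst₂ (λ X Y → X ≡ₛ (Y ∥ qproc rest)) (qproc-qitems E') (qproc-qitems E)
        (≡-trans (qproc-↭ p) (≡-sym (qproc-++ (qitems E) rest))))

  fv-bound : ∀ {P ys E zs R} → Fl id P ys E → zs # fvP P → R ≡ₛ proc E → ∀ {z} → z ∈ zs → z ∈ fvP R → z ∈ ys
  fv-bound {E = E} d h e z∈ f with Fl-names d (fv-proc E (≡ₛ-fv e f))
  ... | inj₁ q = q
  ... | inj₂ (a , a∈ , refl) = ⊥-elim (h z∈ a∈)

  -- The names `zs` become the shared prefix. Since they avoid the free names of `P'`, those that
  -- occur in its body are among its binders, and `νs-reorder` brings them to the front.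
  ≼⇒⊑ : ∀ {P zs E P' E'} → Fl id P zs E → Unique zs → zs # fvP P → zs # fvP P' → Unique (tagsE E) →
        FlatOf P' E' → E ≼ E' → P ⊑ P'
  ≼⇒⊑ {P} {zs} {E} {P'} {E'} d u hP hP' ut (ys , d' , u' , h' , _) s =
      zs , ws , msgs E , msgs E' , qproc E , qproc rest , standardForm d u hP ,
      ≡-trans (standardForm d' u' h') (≡-trans (νs-cong ys same) (proj₂ reordered)) ,
      λ M → ⊢-cut* (msgs E) (λ N∈ → s (∈msgs⁻ E N∈))
    where
      rest : List Item
      rest = proj₁ (splitProc E E' ut s)
      same : proc E' ≡ₛ (⟪ msgs E' ⟫ ∥ qproc E ∥ qproc rest)
      same = proj₂ (splitProc E E' ut s)
      reordered : ∃ λ ws → νs ys (⟪ msgs E' ⟫ ∥ qproc E ∥ qproc rest) ≡ₛ νs zs (νs ws (⟪ msgs E' ⟫ ∥ qproc E ∥ qproc rest))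
      reordered = νs-reorder zs ys u (fv-bound d' hP' (≡-sym same))
      ws : List Name
      ws = proj₁ reordered

  -- Inclusion of limits in terms of flattenings

  mutual
    namesLim : Limit → List Name
    namesLim []       = []
    namesLim (R ∷ Rs) = namesRep R ++ namesLim Rs

    namesRep : Rep → List Name
    namesRep (once B)  = namesBase B
    namesRep (omega B) = namesBase B

    namesBase : Base → List Name
    namesBase (msgB M)  = namesM M
    namesBase (QB q Ms) = namesL Ms
    namesBase (νB x L)  = namesLim L

  mutual
    fv-InstL : ∀ {L P} → InstL L P → fvP P ⊆ namesLim L
    fv-InstL (inst-one i) a∈ = ∈-++⁺ˡ (fv-InstR i a∈)
    fv-InstL (inst-par {R = R} {P = P} i is) a∈ with ∈-++⁻ (fvP P) a∈
    ... | inj₁ p = ∈-++⁺ˡ (fv-InstR i p)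
    ... | inj₂ p = ∈-++⁺ʳ (namesRep R) (fv-InstL is p)

    fv-InstR : ∀ {R P} → InstR R P → fvP P ⊆ namesRep R
    fv-InstR (inst-once i) = fv-InstB i
    fv-InstR (inst-omega (many+ is)) = fv-InstMany⁺ is

    fv-InstMany⁺ : ∀ {B P} → InstMany⁺ B P → fvP P ⊆ namesBase B
    fv-InstMany⁺ (many-one i) = fv-InstB i
    fv-InstMany⁺ (many-cons {P = P} i is) a∈ with ∈-++⁻ (fvP P) a∈
    ... | inj₁ p = fv-InstB i p
    ... | inj₂ p = fv-InstMany⁺ is p

    fv-InstB : ∀ {B P} → InstB B P → fvP P ⊆ namesBase B
    fv-InstB inst-msg = id
    fv-InstB inst-Q = id
    fv-InstB (inst-ν {P = P} i) a∈ = fv-InstL i (proj₁ (∈removeName⁻ (fvP P) a∈))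

  FlatIncl : Limit → Limit → Set
  FlatIncl L₁ L₂ = ∀ {P E} → InstL L₁ P → FlatOf P E → ∃ λ P' → ∃ λ E' → InstL L₂ P' × FlatOf P' E' × E ≼ E'

  -- Inclusion is applied to `proc E`, which lies below `P` with an empty shared prefix. All names
  -- chosen in `E` are free there, so the larger process has to match these very names.
  DenotIncl⇒FlatIncl : ∀ {L₁ L₂} → DenotIncl L₁ L₂ → FlatIncl L₁ L₂
  DenotIncl⇒FlatIncl incl {P} {E} i (ys , d , u , h , ut)
    with incl (proc E) (P , i , [] , ys , msgs E , msgs E , qproc E , 𝟘 , ≡-refl ,
           ≡-trans (standardForm d u h) (νs-cong ys (∥-congˡ (≡-sym ≡-unit))) , λ M → id)
  ... | P' , i' , w with proj₂ (⊑⇒≼ w) (Fl-proc E) [] (λ ()) (subst Unique (sym (tags-sorted E)) ut)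
  ...   | E' , fl , s = P' , E' , i' , fl , λ e∈ → s (∈sorted E e∈)

  FlatIncl⇒DenotIncl : ∀ {L₁ L₂} → FlatIncl L₁ L₂ → DenotIncl L₁ L₂
  FlatIncl⇒DenotIncl {L₁} {L₂} incl P (P₁ , i₁ , w) = go (⊑⇒≼ w)
    where
      go : (∃ λ V → ∀ {zs E} → Fl id P zs E → Unique zs → zs # V → Unique (tagsE E) → ∃ λ E' → FlatOf P₁ E' × E ≼ E') → ⟦ L₂ ⟧ P
      -- The names of `L₂` are avoided in advance, since the instance whose free names must not
      -- clash with `zs` is only found later.
      go (V , k) = go₁ (Fl-exists id P (V ++ fvP P ++ namesLim L₂) [])
        where
          go₁ : (∃ λ zs → ∃ λ E → Fl id P zs E × Unique zs × zs # (V ++ fvP P ++ namesLim L₂) × Unique (tagsE E) × tagsE E # []) →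
                ⟦ L₂ ⟧ P
          go₁ (zs , E , d , u , h , ut , _) = go₂ (k d u (λ p → h p ∘ ∈-++⁺ˡ) ut)
            where
              go₃ : ∀ {E₁} → E ≼ E₁ → (∃ λ P' → ∃ λ E' → InstL L₂ P' × FlatOf P' E' × E₁ ≼ E') → ⟦ L₂ ⟧ P
              go₃ s₁ (P₂ , E₂ , i₂ , fl₂ , s₂) = P₂ , i₂ ,
                ≼⇒⊑ d u (λ p → h p ∘ ∈-++⁺ʳ V ∘ ∈-++⁺ˡ)
                    (λ p q → h p (∈-++⁺ʳ V (∈-++⁺ʳ (fvP P) (fv-InstL i₂ q)))) ut fl₂
                    (λ {e} e∈ → Ok-≼ {e = e} s₂ (s₁ e∈))
              go₂ : (∃ λ E₁ → FlatOf P₁ E₁ × E ≼ E₁) → ⟦ L₂ ⟧ P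
              go₂ (E₁ , fl₁ , s₁) = go₃ s₁ (incl i₁ fl₁)

  -- Identifiers and keys

  -- An identifier is the code of depth ∷ kind ∷ payload, with kind 0 for the free names of a limit, 1 for
  -- its binders and 2 for the tags of its process constants; the payload of a binder or tag is its position.
  -- A key is an identifier together with the indices of the copies that lead to it.

  hd : List ℕ → ℕ
  hd []      = 0
  hd (n ∷ _) = n

  dep kind payload : ℕ → ℕ
  dep x     = hd (decode x)
  kind x    = hd (drop 1 (decode x))
  payload x = hd (drop 2 (decode x))

  fr : Name → ℕ
  fr a = code (0 ∷ 0 ∷ a ∷ [])

  bid tid : ℕ → List ℕ → ℕ
  bid d π = code (d ∷ 1 ∷ π)
  tid d π = code (d ∷ 2 ∷ π)

  dep-code : ∀ d κ π → dep (code (d ∷ κ ∷ π)) ≡ d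
  dep-code d κ π = cong hd (decode-code (d ∷ κ ∷ π))

  kind-code : ∀ d κ π → kind (code (d ∷ κ ∷ π)) ≡ κ
  kind-code d κ π = cong (hd ∘ drop 1) (decode-code (d ∷ κ ∷ π))

  payload-fr : ∀ a → payload (fr a) ≡ a
  payload-fr a = cong (hd ∘ drop 2) (decode-code (0 ∷ 0 ∷ a ∷ []))

  Key : Set
  Key = ℕ × List ℕ

  ⌜_⌝ : Key → Name
  ⌜ x , u ⌝ = code (x ∷ u)

  ⌜⌝-injective : ∀ {k k'} → ⌜ k ⌝ ≡ ⌜ k' ⌝ → k ≡ k'
  ⌜⌝-injective {x , u} {x' , u'} e with code-injective e
  ... | refl = refl

  κ : Name → Key
  κ a = fr a , []

  Tm : Set
  Tm = ℕ × Item

  key : List ℕ → ℕ → Key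
  key v x = x , take (dep x) v

  inst : List ℕ → Item → Item
  inst v = renI (⌜_⌝ ∘ key v) (⌜_⌝ ∘ key v)

  -- Templates

  _⊕_ : ∀ {A : Set} → Maybe (List A) → Maybe (List A) → Maybe (List A)
  just xs ⊕ just ys = just (xs ++ ys)
  just xs ⊕ nothing = nothing
  nothing ⊕ _       = nothing

  ⊕-just⁻ : ∀ {A : Set} (m n : Maybe (List A)) {T} → m ⊕ n ≡ just T →
            ∃ λ X → ∃ λ Y → m ≡ just X × n ≡ just Y × T ≡ X ++ Y
  ⊕-just⁻ (just X) (just Y) refl = X , Y , refl , refl , refl

  Allowed : List Name → ℕ → Set
  Allowed F x = kind x ≡ 0 → payload x ∈ F

  Allowed? : ∀ F x → Dec (Allowed F x)
  Allowed? F x = (kind x ≟ 0) →-dec (payload x ∈? F)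

  guard : List Name → Tm → Maybe (List Tm)
  guard F t with All.all? (Allowed? F) (namesI (proj₂ t))
  ... | yes _ = just (t ∷ [])
  ... | no _  = nothing

  guard⁺ : ∀ F t → (∀ {x} → x ∈ namesI (proj₂ t) → Allowed F x) → guard F t ≡ just (t ∷ [])
  guard⁺ F t h with All.all? (Allowed? F) (namesI (proj₂ t))
  ... | yes _ = refl
  ... | no n  = ⊥-elim (n (All.tabulate h))

  guard⁻ : ∀ F t {T} → guard F t ≡ just T → T ≡ t ∷ [] × (∀ {x} → x ∈ namesI (proj₂ t) → Allowed F x)
  guard⁻ F t e with All.all? (Allowed? F) (namesI (proj₂ t))
  guard⁻ F t refl | yes p = refl , All.lookup p

  -- The items of L with their depth in repetitions. Items with a free name outside F are excluded: this
  -- drops the repetitions they occur in and fails if they occur outside of any repetition.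
  mutual
    TL : List Name → (Name → ℕ) → List ℕ → ℕ → Limit → Maybe (List Tm)
    TL F η π d []       = just []
    TL F η π d (R ∷ Rs) = TR F η (π ∷ʳ 0) d R ⊕ TL F η (π ∷ʳ 1) d Rs

    TR : List Name → (Name → ℕ) → List ℕ → ℕ → Rep → Maybe (List Tm)
    TR F η π d (once B)  = TB F η π d B
    TR F η π d (omega B) = just (fromMaybe [] (TB F η π (suc d) B))

    TB : List Name → (Name → ℕ) → List ℕ → ℕ → Base → Maybe (List Tm)
    TB F η π d (msgB M)  = guard F (d , im (renM η M))
    TB F η π d (QB q Ms) = guard F (d , iq (tid d π) q (map (renM η) Ms))
    TB F η π d (νB x L)  = TL F (η [ x ↦ bid d π ]) (π ∷ʳ 2) d L

  WfId : ℕ → ℕ → Set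
  WfId d x = dep x ≤ d × kind x < 2

  record WfTm (F : List Name) (d : ℕ) (t : Tm) : Set where
    field
      deep    : d ≤ proj₁ t
      wfName  : ∀ {x} → x ∈ namesI (proj₂ t) → WfId (proj₁ t) x
      allowed : ∀ {x} → x ∈ namesI (proj₂ t) → Allowed F x
      wfTag   : ∀ {x} → x ∈ tagsI (proj₂ t) → dep x ≡ proj₁ t × kind x ≡ 2

  open WfTm

  WfEnv : ℕ → (Name → ℕ) → Set
  WfEnv d η = ∀ a → WfId d (η a)

  wfEnv-suc : ∀ {d η} → WfEnv d η → WfEnv (suc d) η
  wfEnv-suc w a = m≤n⇒m≤1+n (proj₁ (w a)) , proj₂ (w a)

  wfEnv-ν : ∀ {d η} x π → WfEnv d η → WfEnv d (η [ x ↦ bid d π ])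
  wfEnv-ν {d} x π w a with a ≟ x
  ... | yes _ = ≤-reflexive (dep-code d 1 π) , subst (_< 2) (sym (kind-code d 1 π)) (s≤s (s≤s z≤n))
  ... | no _  = w a

  wfEnv-fr : WfEnv 0 fr
  wfEnv-fr a = ≤-reflexive (dep-code 0 0 (a ∷ [])) , subst (_< 2) (sym (kind-code 0 0 (a ∷ []))) (s≤s z≤n)

  mutual
    TL-wf : ∀ {F η π d} L {T} → WfEnv d η → TL F η π d L ≡ just T → ∀ {t} → t ∈ T → WfTm F d t
    TL-wf {F} {η} {π} {d} [] w refl ()
    TL-wf {F} {η} {π} {d} (R ∷ Rs) w e t∈ with ⊕-just⁻ (TR F η (π ∷ʳ 0) d R) (TL F η (π ∷ʳ 1) d Rs) e
    ... | X , Y , e₁ , e₂ , refl with ∈-++⁻ X t∈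
    ...   | inj₁ p = TR-wf R w e₁ p
    ...   | inj₂ p = TL-wf Rs w e₂ p

    TR-wf : ∀ {F η π d} R {T} → WfEnv d η → TR F η π d R ≡ just T → ∀ {t} → t ∈ T → WfTm F d t
    TR-wf (once B) w e t∈ = TB-wf B w e t∈
    TR-wf {F} {η} {π} {d} (omega B) w e t∈ with TB F η π (suc d) B in eq
    TR-wf {F} {η} {π} {d} (omega B) w refl t∈ | just T =
      let r = TB-wf B (wfEnv-suc w) eq t∈ in
      record { deep = ≤-trans (n≤1+n d) (deep r) ; wfName = wfName r ; allowed = allowed r ; wfTag = wfTag r }

    TB-wf : ∀ {F η π d} B {T} → WfEnv d η → TB F η π d B ≡ just T → ∀ {t} → t ∈ T → WfTm F d t
    TB-wf {F} {η} {π} {d} (msgB M) w e t∈ with guard⁻ F (d , im (renM η M)) e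
    TB-wf {F} {η} {π} {d} (msgB M) w e (here refl) | refl , al = record
      { deep = ≤-refl
      ; wfName = λ {x} x∈ → let (a , _ , eq) = ∈-map⁻ η (subst (x ∈_) (namesM-ren η M) x∈) in subst (WfId d) (sym eq) (w a)
      ; allowed = al ; wfTag = λ () }
    TB-wf {F} {η} {π} {d} (QB q Ms) w e t∈ with guard⁻ F (d , iq (tid d π) q (map (renM η) Ms)) e
    TB-wf {F} {η} {π} {d} (QB q Ms) w e (here refl) | refl , al = record
      { deep = ≤-refl
      ; wfName = λ {x} x∈ → let (a , _ , eq) = ∈-map⁻ η (subst (x ∈_) (namesL-ren η Ms) x∈) in subst (WfId d) (sym eq) (w a)
      ; allowed = al ; wfTag = λ { (here refl) → dep-code d 2 π , kind-code d 2 π } }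
    TB-wf {F} {η} {π} {d} (νB x L) w e t∈ = TL-wf L (wfEnv-ν x π w) e t∈

  -- Canonical flattenings

  -- `U` gives a region for each kind of identifier: binder names come from `U 1` and tags from
  -- `U 2`.
  record Canon (U : ℕ → Name → Set) (ρ : Name → Name) (P : Proc) (E : List Item) : Set where
    constructor canon
    field
      {cs}   : List Name
      flat   : Fl ρ P cs E
      ucs    : Unique cs
      named  : ∀ {c} → c ∈ cs → U 1 c
      utags  : Unique (tagsE E)
      tagged : ∀ {t} → t ∈ tagsE E → U 2 t

  -- The names created within one subterm of the limit and one copy: their position extends `π` and
  -- their indices extend `v`. Different branches have disjoint regions, and so do different copies;
  -- this yields distinctness of canonical names.
  Under : List ℕ → List ℕ → ℕ → Name → Set
  Under π v k c = ∃ λ d → ∃ λ π' → ∃ λ v' → c ≡ ⌜ code (d ∷ k ∷ (π ++ π')) , v ++ v' ⌝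

  -- The joint region of the copies numbered `i` and above, for adding copies one by one.
  UnderFrom : ℕ → List ℕ → List ℕ → ℕ → Name → Set
  UnderFrom i π v k c = ∃ λ d → ∃ λ π' → ∃ λ j → ∃ λ v' → i ≤ j × c ≡ ⌜ code (d ∷ k ∷ (π ++ π')) , v ++ j ∷ v' ⌝

  canon-map : ∀ {U W : ℕ → Name → Set} {ρ P E} → (∀ {k c} → U k c → W k c) → Canon U ρ P E → Canon W ρ P E
  canon-map s (canon f u n ut t) = canon f u (s ∘ n) ut (s ∘ t)

  canon-env : ∀ {U ρ ρ' P E} → (∀ a → ρ a ≡ ρ' a) → Canon U ρ P E → Canon U ρ' P E
  canon-env s (canon f u n ut t) = canon (Fl-cong (λ {a} _ → s a) f) u n ut t

  canon-∥ : ∀ {U U' W : ℕ → Name → Set} {ρ P P' E E'} → (∀ {k c} → U k c → U' k c → ⊥) →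
            (∀ {k c} → U k c → W k c) → (∀ {k c} → U' k c → W k c) →
            Canon U ρ P E → Canon U' ρ P' E' → Canon W ρ (P ∥ P') (E ++ E')
  canon-∥ {W = W} {E = E} {E'} dis s s' (canon {cs} f u n ut t) (canon {cs'} f' u' n' ut' t') =
    canon (f∥ f f') (Unique-++⁺ u u' (λ p q → dis (n p) (n' q)))
      (λ p → Sum.[ s ∘ n , s' ∘ n' ] (∈-++⁻ cs p))
      (subst Unique (sym (tagsE-++ E E')) (Unique-++⁺ ut ut' (λ p q → dis (t p) (t' q))))
      (λ {c} p → Sum.[ s ∘ t , s' ∘ t' ] (∈-++⁻ (tagsE E) (subst (c ∈_) (tagsE-++ E E') p)))

  canon-𝟘 : ∀ {U ρ} → Canon U ρ 𝟘 []
  canon-𝟘 = canon f𝟘 [] (λ ()) [] (λ ())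

  under-⊆ : ∀ {π v m k c} → Under (π ∷ʳ m) v k c → Under π v k c
  under-⊆ {π} {v} {m} {k} (d , π' , v' , e) = d , m ∷ π' , v' ,
    trans e (cong (λ ρ → ⌜ code (d ∷ k ∷ ρ) , v ++ v' ⌝) (++-assoc π (m ∷ []) π'))

  under-disjoint : ∀ {π v m n k c} → m ≢ n → Under (π ∷ʳ m) v k c → Under (π ∷ʳ n) v k c → ⊥
  under-disjoint {π} {v} {m} {n} ne (d , π' , v' , refl) (d₁ , π₁ , v₁ , e) =
    ne (∷-injectiveˡ (++-cancelˡ π (m ∷ π') (n ∷ π₁)
      (trans (sym (++-assoc π (m ∷ []) π')) (trans paths (++-assoc π (n ∷ []) π₁)))))
    where paths : (π ∷ʳ m) ++ π' ≡ (π ∷ʳ n) ++ π₁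
          paths = ∷-injectiveʳ (∷-injectiveʳ (code-injective (∷-injectiveˡ (code-injective e))))

  under⇒from : ∀ {π v i k c} → Under π (v ∷ʳ i) k c → UnderFrom i π v k c
  under⇒from {π} {v} {i} {k} (d , π' , v' , e) = d , π' , i , v' , ≤-refl ,
    trans e (cong (λ u → ⌜ code (d ∷ k ∷ π ++ π') , u ⌝) (++-assoc v (i ∷ []) v'))

  from⇒under : ∀ {π v i k c} → UnderFrom i π v k c → Under π v k c
  from⇒under (d , π' , j , v' , _ , e) = d , π' , j ∷ v' , e

  from-suc : ∀ {π v i k c} → UnderFrom (suc i) π v k c → UnderFrom i π v k c
  from-suc (d , π' , j , v' , l , e) = d , π' , j , v' , ≤-trans (n≤1+n _) l , e

  from-disjoint : ∀ {π v i k c} → Under π (v ∷ʳ i) k c → UnderFrom (suc i) π v k c → ⊥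
  from-disjoint {π} {v} {i} (d , π' , v' , refl) (d₁ , π₁ , j , v₁ , l , e) = <-irrefl i≡j l
    where i≡j : i ≡ j
          i≡j = ∷-injectiveˡ (++-cancelˡ v (i ∷ v') (j ∷ v₁) (trans (sym (++-assoc v (i ∷ []) v')) (∷-injectiveʳ (code-injective e))))

  cenv : (Name → ℕ) → List ℕ → Name → Name
  cenv η v a = ⌜ key v (η a) ⌝

  take-≤-++ : ∀ n (v w : List ℕ) → n ≤ length v → take n (v ++ w) ≡ take n v
  take-≤-++ zero    v       w l       = refl
  take-≤-++ (suc n) (x ∷ v) w (s≤s l) = cong (x ∷_) (take-≤-++ n v w l)

  cenv-ext : ∀ {η v d} w → WfEnv d η → length v ≡ d → ∀ a → cenv η (v ++ w) a ≡ cenv η v a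
  cenv-ext {η} {v} w wf refl a = cong (λ u → ⌜ η a , u ⌝) (take-≤-++ (dep (η a)) v w (proj₁ (wf a)))

  cenv-ν : ∀ {η v d} x π → length v ≡ d → ∀ a →
           (cenv η v [ x ↦ ⌜ bid d π , v ⌝ ]) a ≡ cenv (η [ x ↦ bid d π ]) v a
  cenv-ν {η} {v} {d} x π l a with a ≟ x
  ... | yes _ = cong (λ u → ⌜ bid d π , u ⌝) (sym (trans (cong (λ n → take n v) (dep-code d 1 π)) (take-length d v l)))
  ... | no _  = refl

  canon-ν : ∀ {η v d} x π {P E} → length v ≡ d →
            Canon (Under (π ∷ʳ 2) v) (cenv (η [ x ↦ bid d π ]) v) P E → Canon (Under π v) (cenv η v) (ν x P) E
  canon-ν {η} {v} {d} x π l (canon {cs} f u n ut t) = canon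
      (fν (Fl-cong (λ {a} _ → sym (cenv-ν x π l a)) f))
      (Unique-∷⁺ (fresh ∘ n) u)
      (λ { (here refl) → d , [] , [] , cong₂ (λ ρ u → ⌜ code (d ∷ 1 ∷ ρ) , u ⌝) (sym (++-identityʳ π)) (sym (++-identityʳ v))
         ; (there p) → under-⊆ (n p) })
      ut (under-⊆ ∘ t)
    where
      fresh : Under (π ∷ʳ 2) v 1 ⌜ bid d π , v ⌝ → ⊥
      fresh (d' , π' , v' , e) = absurd (++-cancelˡ π [] (2 ∷ π') (trans (++-identityʳ π) (trans paths (++-assoc π (2 ∷ []) π'))))
        where
          paths : π ≡ (π ∷ʳ 2) ++ π'
          paths = ∷-injectiveʳ (∷-injectiveʳ (code-injective (∷-injectiveˡ (code-injective e))))
          absurd : [] ≢ 2 ∷ π'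
          absurd ()

  InCan : List Tm → List ℕ → Item → Set
  InCan T v e = ∃ λ t → t ∈ T × ∃ λ v' → length (v ++ v') ≡ proj₁ t × e ≡ inst (v ++ v') (proj₂ t)

  inCan-⊆ : ∀ {T T' v e} → T ⊆ T' → InCan T v e → InCan T' v e
  inCan-⊆ s (t , t∈ , r) = t , s t∈ , r

  inCan-copy : ∀ {T v i e} → InCan T (v ∷ʳ i) e → InCan T v e
  inCan-copy {v = v} {i} (t , t∈ , v' , l , e) = t , t∈ , i ∷ v' , trans (cong length (sym as)) l ,
    trans e (cong (λ u → inst u (proj₂ t)) as)
    where as = ++-assoc v (i ∷ []) v'

  length-∷ʳ′ : ∀ (v : List ℕ) {i d} → length v ≡ d → length (v ∷ʳ i) ≡ suc d
  length-∷ʳ′ v {i} refl = trans (length-++ v) (+-comm (length v) 1)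

  inst-env : ∀ {η v d} M → WfEnv d η → length v ≡ d → ∀ w → renM (⌜_⌝ ∘ key (v ++ w)) (renM η M) ≡ renM (cenv η v) M
  inst-env {η} {v} M wf l w = trans (renM-∘ _ η M) (renM-cong M (λ {a} _ → cenv-ext w wf l a))

  inst-envL : ∀ {η v d} Ms → WfEnv d η → length v ≡ d → ∀ w → map (renM (⌜_⌝ ∘ key (v ++ w))) (map (renM η) Ms) ≡ map (renM (cenv η v)) Ms
  inst-envL {η} {v} Ms wf l w = trans (renL-∘ _ η Ms) (renL-cong Ms (λ {a} _ → cenv-ext w wf l a))

  tidKey : List ℕ → List ℕ → ℕ → Name
  tidKey π v d = ⌜ tid d π , v ⌝

  tid-key : ∀ {v d} π w → length v ≡ d → length (v ++ w) ≡ d → ⌜ key (v ++ w) (tid d π) ⌝ ≡ tidKey π v d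
  tid-key {v} {d} π [] l l' rewrite ++-identityʳ v = cong (λ u → ⌜ tid d π , u ⌝) (trans (cong (λ n → take n v) (dep-code d 2 π)) (take-length d v l))
  tid-key {v} {d} π (x ∷ w) l l' = ⊥-elim (absurd (+-cancelˡ-≡ d _ _ (trans (cong (_+ suc (length w)) (sym l)) (trans (sym (length-++ v)) (trans l' (sym (+-identityʳ d)))))))
    where absurd : suc (length w) ≢ 0
          absurd ()

  canon-msg : ∀ {U ρ M} → Canon U ρ ⟨ M ⟩ (im (renM ρ M) ∷ [])
  canon-msg = canon fm [] (λ ()) [] (λ ())

  canon-Q : ∀ {π v ρ d q Ms} → Canon (Under π v) ρ (Qc q Ms) (iq (tidKey π v d) q (map (renM ρ) Ms) ∷ [])
  canon-Q {π} {v} {d = d} = canon (fq _) [] (λ ()) ([] ∷ [])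
    λ { (here refl) → d , [] , [] , cong₂ (λ ρ u → ⌜ code (d ∷ 2 ∷ ρ) , u ⌝) (sym (++-identityʳ π)) (sym (++-identityʳ v)) }

  allowed-ν : ∀ {F d π x} P {η : Name → ℕ} → (∀ {a} → a ∈ fvP (ν x P) → Allowed F (η a)) →
              ∀ {a} → a ∈ fvP P → Allowed F ((η [ x ↦ bid d π ]) a)
  allowed-ν {F} {d} {π} {x} P h {a} a∈ with a ≟ x
  ... | yes _ = λ e → ⊥-elim (absurd (trans (sym (kind-code d 1 π)) e))
    where absurd : 1 ≢ 0
          absurd ()
  ... | no n  = h (∈removeName⁺ a∈ n)

  fromMaybe-just : ∀ {A : Set} {x y : A} {m} → m ≡ just y → just (fromMaybe x m) ≡ just y
  fromMaybe-just refl = refl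

  CanonIn : (U : ℕ → Name → Set) → Maybe (List Tm) → (Name → ℕ) → List ℕ → Proc → Set
  CanonIn U m η v P = ∃ λ T → m ≡ just T × ∃ λ E → Canon U (cenv η v) P E × (∀ {e} → e ∈ E → InCan T v e)

  canonIn-++ : ∀ {T T' v E E'} → (∀ {e} → e ∈ E → InCan T v e) → (∀ {e} → e ∈ E' → InCan T' v e) →
               ∀ {e} → e ∈ E ++ E' → InCan (T ++ T') v e
  canonIn-++ {T} {E = E} i i' e∈ =
    Sum.[ (λ p → inCan-⊆ ∈-++⁺ˡ (i p)) , (λ p → inCan-⊆ (∈-++⁺ʳ T) (i' p)) ] (∈-++⁻ E e∈)

  mutual
    -- Copies are numbered in the order in which the instance lists them. Every item then comes from
    -- a template; not every index vector need occur, since copies may have different numbers of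
    -- subcopies.
    instL-canon : ∀ {F η π v d L P} → WfEnv d η → length v ≡ d → InstL L P → (∀ {a} → a ∈ fvP P → Allowed F (η a)) →
                  CanonIn (Under π v) (TL F η π d L) η v P
    instL-canon w l inst-0 al = [] , refl , [] , canon-𝟘 , λ ()
    instL-canon {F} {η} {π} {v} {d} w l (inst-one {R} i) al with instR-canon {π = π ∷ʳ 0} w l i al
    ... | T , eq , E , c , inc rewrite eq = T ++ [] , refl , E , canon-map under-⊆ c , λ p → inCan-⊆ ∈-++⁺ˡ (inc p)
    instL-canon {F} {η} {π} {v} {d} w l (inst-par {P = P} i is) al
      with instR-canon {π = π ∷ʳ 0} w l i (al ∘ ∈-++⁺ˡ) | instL-canon {π = π ∷ʳ 1} w l is (al ∘ ∈-++⁺ʳ (fvP P))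
    ... | T , eq , E , c , inc | T' , eq' , E' , c' , inc' rewrite eq | eq' =
      T ++ T' , refl , E ++ E' , canon-∥ (under-disjoint (λ ())) under-⊆ under-⊆ c c' , canonIn-++ inc inc'

    instR-canon : ∀ {F η π v d R P} → WfEnv d η → length v ≡ d → InstR R P → (∀ {a} → a ∈ fvP P → Allowed F (η a)) →
                  CanonIn (Under π v) (TR F η π d R) η v P
    instR-canon w l (inst-once i) al = instB-canon w l i al
    instR-canon w l (inst-omega many-0) al = _ , refl , [] , canon-𝟘 , λ ()
    instR-canon {π = π} w l (inst-omega (many+ is)) al with instMany-canon {π = π} 0 w l is al
    ... | T , eq , E , c , inc = T , fromMaybe-just eq , E , canon-map from⇒under c , inc

    instMany-canon : ∀ {F η π v d B P} i → WfEnv d η → length v ≡ d → InstMany⁺ B P → (∀ {a} → a ∈ fvP P → Allowed F (η a)) →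
                     CanonIn (UnderFrom i π v) (TB F η π (suc d) B) η v P
    instMany-canon {v = v} i w l (many-one j) al with instB-canon (wfEnv-suc w) (length-∷ʳ′ v {i} l) j al
    ... | T , eq , E , c , inc = T , eq , E , canon-env (cenv-ext (i ∷ []) w l) (canon-map under⇒from c) , inCan-copy ∘ inc
    instMany-canon {v = v} i w l (many-cons {P = P} j js) al
      with instB-canon (wfEnv-suc w) (length-∷ʳ′ v {i} l) j (al ∘ ∈-++⁺ˡ) | instMany-canon (suc i) w l js (al ∘ ∈-++⁺ʳ (fvP P))
    ... | T , eq , E , c , inc | T' , eq' , E' , c' , inc' = T , eq , E ++ E' ,
      canon-∥ from-disjoint under⇒from from-suc (canon-env (cenv-ext (i ∷ []) w l) c) c' ,
      λ p → Sum.[ inCan-copy ∘ inc , (λ q → subst (λ T → InCan T v _) (just-injective (trans (sym eq') eq)) (inc' q)) ] (∈-++⁻ E p)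

    instB-canon : ∀ {F η π v d B P} → WfEnv d η → length v ≡ d → InstB B P → (∀ {a} → a ∈ fvP P → Allowed F (η a)) →
                  CanonIn (Under π v) (TB F η π d B) η v P
    instB-canon {F} {η} {π} {v} {d} w l (inst-msg {M}) al =
      _ , guard⁺ F _ (λ {x} x∈ → let (a , a∈ , eq) = ∈-map⁻ η (subst (x ∈_) (namesM-ren η M) x∈) in subst (Allowed F) (sym eq) (al a∈)) ,
      _ , canon-msg ,
      λ { (here refl) → _ , here refl , [] , trans (cong length (++-identityʳ v)) l , cong im (sym (inst-env M w l [])) }
    instB-canon {F} {η} {π} {v} {d} w l (inst-Q {q} {Ms}) al =
      _ , guard⁺ F _ (λ {x} x∈ → let (a , a∈ , eq) = ∈-map⁻ η (subst (x ∈_) (namesL-ren η Ms) x∈) in subst (Allowed F) (sym eq) (al a∈)) ,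
      _ , canon-Q {d = d} ,
      λ { (here refl) → _ , here refl , [] , lv , cong₂ (λ t N → iq t q N) (sym (tid-key π [] l lv)) (sym (inst-envL Ms w l [])) }
      where lv = trans (cong length (++-identityʳ v)) l
    instB-canon {F} {η} {π} {v} {d} w l (inst-ν {x} {L} {P} i) al
      with instL-canon {π = π ∷ʳ 2} (wfEnv-ν x π w) l i (allowed-ν P al)
    ... | T , eq , E , c , inc = T , eq , E , canon-ν x π l c , inc

  Covers : ℕ → List Tm → List ℕ → List Item → Set
  Covers n T v E = ∀ {t} → t ∈ T → ∀ v' → All (_< n) v' → length (v ++ v') ≡ proj₁ t → inst (v ++ v') (proj₂ t) ∈ E

  CanonOut : ℕ → (U : ℕ → Name → Set) → List Name → List Tm → (Name → ℕ) → List ℕ → Proc → Set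
  CanonOut n U F T η v P = ∃ λ E → Canon U (cenv η v) P E × (∀ {a} → a ∈ fvP P → Allowed F (η a)) × Covers n T v E

  covers-++ : ∀ {n T T' v E E'} → Covers n T v E → Covers n T' v E' → Covers n (T ++ T') v (E ++ E')
  covers-++ {T = T} {E = E} c c' t∈ v' a l =
    Sum.[ (λ p → ∈-++⁺ˡ (c p v' a l)) , (λ p → ∈-++⁺ʳ E (c' p v' a l)) ] (∈-++⁻ T t∈)

  allowed-∥ : ∀ {F} {η : Name → ℕ} xs {ys} → (∀ {a} → a ∈ xs → Allowed F (η a)) → (∀ {a} → a ∈ ys → Allowed F (η a)) →
              ∀ {a} → a ∈ xs ++ ys → Allowed F (η a)
  allowed-∥ xs h h' a∈ = Sum.[ h , h' ] (∈-++⁻ xs a∈)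

  allowed-ν⁻ : ∀ {F d π x} P {η : Name → ℕ} → (∀ {a} → a ∈ fvP P → Allowed F ((η [ x ↦ bid d π ]) a)) →
               ∀ {a} → a ∈ fvP (ν x P) → Allowed F (η a)
  allowed-ν⁻ {F} P {η} h a∈ with ∈removeName⁻ (fvP P) a∈
  ... | a∈P , ne = subst (Allowed F) ([↦]-other η ne) (h a∈P)

  covers-copy : ∀ {n T v j E} → Covers n T (v ∷ʳ j) E →
                ∀ {t} → t ∈ T → ∀ v' → All (_< n) v' → length (v ++ j ∷ v') ≡ proj₁ t → inst (v ++ j ∷ v') (proj₂ t) ∈ E
  covers-copy {v = v} {j} c {t} t∈ v' a l = subst (λ u → inst u (proj₂ t) ∈ _) as (c t∈ v' a (trans (cong length as) l))
    where as = ++-assoc v (j ∷ []) v'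

  mutual
    -- Every repetition gets `n` copies, except that one whose body fails the restriction to `F`
    -- gets none; such a repetition contributes no templates either.
    canon-instL : ∀ n {F η π v d} L {T} → WfEnv d η → length v ≡ d → TL F η π d L ≡ just T →
                  ∃ λ P → InstL L P × CanonOut n (Under π v) F T η v P
    canon-instL n [] w l refl = 𝟘 , inst-0 , [] , canon-𝟘 , (λ ()) , λ ()
    canon-instL n {F} {η} {π} {v} {d} (R ∷ Rs) w l e with ⊕-just⁻ (TR F η (π ∷ʳ 0) d R) (TL F η (π ∷ʳ 1) d Rs) e
    canon-instL n {F} {η} {π} {v} {d} (R ∷ []) w l e | X , Y , e₁ , refl , refl with canon-instR n {π = π ∷ʳ 0} R w l e₁
    ... | P , i , E , c , al , cov = P , inst-one i , E , canon-map under-⊆ c , al ,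
      λ t∈ → cov (subst (_ ∈_) (++-identityʳ X) t∈)
    canon-instL n {F} {η} {π} {v} {d} (R ∷ Rs@(_ ∷ _)) w l e | X , Y , e₁ , e₂ , refl
      with canon-instR n {π = π ∷ʳ 0} R w l e₁ | canon-instL n {π = π ∷ʳ 1} Rs w l e₂
    ... | P , i , E , c , al , cov | P' , i' , E' , c' , al' , cov' = P ∥ P' , inst-par i i' , E ++ E' ,
      canon-∥ (under-disjoint (λ ())) under-⊆ under-⊆ c c' , allowed-∥ (fvP P) al al' , covers-++ cov cov'

    canon-instR : ∀ n {F η π v d} R {T} → WfEnv d η → length v ≡ d → TR F η π d R ≡ just T →
                  ∃ λ P → InstR R P × CanonOut n (Under π v) F T η v P
    canon-instR n (once B) w l e with canon-instB n B w l e
    ... | P , i , r = P , inst-once i , r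
    canon-instR n {F} {η} {π} {v} {d} (omega B) w l e with TB F η π (suc d) B in eq
    canon-instR n {F} {η} {π} {v} {d} (omega B) w l refl | nothing = 𝟘 , inst-omega many-0 , [] , canon-𝟘 , (λ ()) , λ ()
    -- Without copies nothing is left to cover: a template of the repetition has depth above `d` and
    -- would require an index below 0.
    canon-instR zero {F} {η} {π} {v} {d} (omega B) w l refl | just T = 𝟘 , inst-omega many-0 , [] , canon-𝟘 , (λ ()) , cov
      where cov : Covers 0 T v []
            cov {t} t∈ [] a l' = ⊥-elim (<-irrefl (trans (sym l) (trans (sym (cong length (++-identityʳ v))) l')) (deep (TB-wf B (wfEnv-suc w) eq t∈)))
            cov t∈ (_ ∷ _) (() ∷ _) l'
    canon-instR (suc n) {F} {η} {π} {v} {d} (omega B) w l refl | just T with canon-instMany (suc n) 0 n {π = π} B w l eq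
    ... | P , i , E , c , al , cov = P , inst-omega (many+ i) , E , canon-map from⇒under c , al , cov'
      where cov' : Covers (suc n) T v E
            cov' {t} t∈ [] a l' = ⊥-elim (<-irrefl (trans (sym l) (trans (sym (cong length (++-identityʳ v))) l')) (deep (TB-wf B (wfEnv-suc w) eq t∈)))
            cov' t∈ (j ∷ v') (j< ∷ a) l' = cov t∈ j z≤n j< v' a l'

    -- The copies i, …, i + c.
    canon-instMany : ∀ n i c {F η π v d} B {T} → WfEnv d η → length v ≡ d → TB F η π (suc d) B ≡ just T →
      ∃ λ P → InstMany⁺ B P × ∃ λ E → Canon (UnderFrom i π v) (cenv η v) P E × (∀ {a} → a ∈ fvP P → Allowed F (η a)) ×
        (∀ {t} → t ∈ T → ∀ j → i ≤ j → j < suc i + c → ∀ v' → All (_< n) v' → length (v ++ j ∷ v') ≡ proj₁ t →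
          inst (v ++ j ∷ v') (proj₂ t) ∈ E)
    canon-instMany n i zero {v = v} B w l e with canon-instB n B (wfEnv-suc w) (length-∷ʳ′ v {i} l) e
    ... | P , ib , E , c , al , cov = P , many-one ib , E , canon-env (cenv-ext (i ∷ []) w l) (canon-map under⇒from c) , al ,
      λ { t∈ j i≤ j< → only t∈ (≤-antisym i≤ (s≤s⁻¹ (subst (j <_) (+-identityʳ (suc i)) j<))) }
      where only : ∀ {t j} → t ∈ _ → i ≡ j → ∀ v' → All (_< n) v' → length (v ++ j ∷ v') ≡ proj₁ t → inst (v ++ j ∷ v') (proj₂ t) ∈ E
            only t∈ refl = covers-copy cov t∈
    canon-instMany n i (suc c) {v = v} B {T} w l e
      with canon-instB n B (wfEnv-suc w) (length-∷ʳ′ v {i} l) e | canon-instMany n (suc i) c B w l e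
    ... | P , ib , E , cn , al , cov | P' , ib' , E' , cn' , al' , cov' = P ∥ P' , many-cons ib ib' , E ++ E' ,
      canon-∥ from-disjoint under⇒from from-suc (canon-env (cenv-ext (i ∷ []) w l) cn) cn' , allowed-∥ (fvP P) al al' , both
      where both : ∀ {t} → t ∈ T → ∀ j → i ≤ j → j < suc i + suc c → ∀ v' → All (_< n) v' → length (v ++ j ∷ v') ≡ proj₁ t →
                   inst (v ++ j ∷ v') (proj₂ t) ∈ E ++ E'
            both t∈ j i≤ j< v' a l' with i ≟ j
            ... | yes refl = ∈-++⁺ˡ (covers-copy cov t∈ v' a l')
            ... | no ne = ∈-++⁺ʳ E (cov' t∈ j (≤∧≢⇒< i≤ ne) (subst (j <_) (+-suc (suc i) c) j<) v' a l')

    canon-instB : ∀ n {F η π v d} B {T} → WfEnv d η → length v ≡ d → TB F η π d B ≡ just T →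
                  ∃ λ P → InstB B P × CanonOut n (Under π v) F T η v P
    canon-instB n {F} {η} {π} {v} {d} (msgB M) w l e with guard⁻ F (d , im (renM η M)) e
    ... | refl , al = ⟨ M ⟩ , inst-msg , _ , canon-msg ,
      (λ {a} a∈ → al (subst (η a ∈_) (sym (namesM-ren η M)) (∈-map⁺ η a∈))) ,
      λ { (here refl) v' a l' → here (cong im (inst-env M w l v')) }
    canon-instB n {F} {η} {π} {v} {d} (QB q Ms) w l e with guard⁻ F (d , iq (tid d π) q (map (renM η) Ms)) e
    ... | refl , al = Qc q Ms , inst-Q , _ , canon-Q {d = d} ,
      (λ {a} a∈ → al (subst (η a ∈_) (sym (namesL-ren η Ms)) (∈-map⁺ η a∈))) ,
      λ { (here refl) v' a l' → here (cong₂ (λ t N → iq t q N) (tid-key π v' l l') (inst-envL Ms w l v')) }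
    canon-instB n {F} {η} {π} {v} {d} (νB x L) w l e with canon-instL n {π = π ∷ʳ 2} L (wfEnv-ν x π w) l e
    ... | P , i , E , c , al , cov = ν x P , inst-ν i , E , canon-ν x π l c , allowed-ν⁻ P al , cov

  -- Template instances for ranges of indices

  _≟ᵏ_ : DecidableEquality Key
  _≟ᵏ_ = ProdP.≡-dec _≟_ (≡-dec _≟_)

  idsI : Item → List ℕ
  idsI e = tagsI e ++ namesI e

  renI-cong′ : ∀ {f g} e → (∀ {x} → x ∈ idsI e → f x ≡ g x) → renI f f e ≡ renI g g e
  renI-cong′ e h = renI-cong e (h ∘ ∈-++⁺ʳ (tagsI e)) (h ∘ ∈-++⁺ˡ)

  instτ : (Key → Key) → List ℕ → Item → Item
  instτ τ v = renI (⌜_⌝ ∘ τ ∘ key v) (⌜_⌝ ∘ τ ∘ key v)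

  lift : (Key → Key) → Name → Name
  lift δ n with decode n
  ... | []    = n
  ... | x ∷ u = ⌜ δ (x , u) ⌝

  lift-⌜⌝ : ∀ δ k → lift δ ⌜ k ⌝ ≡ ⌜ δ k ⌝
  lift-⌜⌝ δ (x , u) with decode (code (x ∷ u)) | decode-code (x ∷ u)
  ... | _ | refl = refl

  lift-instτ : ∀ δ τ v e → renI (lift δ) (lift δ) (instτ τ v e) ≡ instτ (δ ∘ τ) v e
  lift-instτ δ τ v e = trans (renI-∘ _ _ _ _ e) (renI-cong′ e (λ {x} _ → lift-⌜⌝ δ (τ (key v x))))

  abstract
    CanR : (ℕ → ℕ) → List Tm → List Item
    CanR r = concatMap (λ t → map (λ v → inst v (proj₂ t)) (vecs (proj₁ t) r))

    ∈CanR⁺ : ∀ {r T t} v → t ∈ T → length v ≡ proj₁ t → InR r v → inst v (proj₂ t) ∈ CanR r T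
    ∈CanR⁺ {r} {t = t} v t∈ l p = concatMap∈⁺ (λ t → map (λ v → inst v (proj₂ t)) (vecs (proj₁ t) r)) t∈
      (∈-map⁺ (λ v → inst v (proj₂ t)) (∈vecs⁺ v l p))

    ∈CanR⁻ : ∀ {r e} T → e ∈ CanR r T → ∃ λ t → ∃ λ v → t ∈ T × length v ≡ proj₁ t × InR r v × e ≡ inst v (proj₂ t)
    ∈CanR⁻ {r} T e∈ with concatMap∈⁻ (λ t → map (λ v → inst v (proj₂ t)) (vecs (proj₁ t) r)) T e∈
    ... | t , t∈ , p with ∈-map⁻ (λ v → inst v (proj₂ t)) p
    ...   | v , v∈ , eq with ∈vecs⁻ (proj₁ t) v∈
    ...     | l , q = t , v , t∈ , l , q , eq

  CanR-⊆ : ∀ {r r' T} → (∀ {t v} → t ∈ T → length v ≡ proj₁ t → InR r v → InR r' v) → CanR r T ⊆ CanR r' T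
  CanR-⊆ {T = T} h e∈ with ∈CanR⁻ T e∈
  ... | t , v , t∈ , l , p , refl = ∈CanR⁺ v t∈ l (h t∈ l p)

  CanR-≗ : ∀ {r r' T} → (∀ i → r i ≡ r' i) → CanR r T ⊆ CanR r' T
  CanR-≗ h = CanR-⊆ (λ {_} {v} _ _ → InR-mono v (λ i → ≤-reflexive (h i)))

  Can : ℕ → List Tm → List Item
  Can m = CanR (const m)

  Can-mono : ∀ {m n T} → m ≤ n → Can m T ⊆ Can n T
  Can-mono l = CanR-⊆ (λ {_} {v} _ _ → InR-mono v (λ _ → l))

  instτ-names : ∀ τ v e {a} → a ∈ namesI (instτ τ v e) → ∃ λ x → x ∈ idsI e × a ≡ ⌜ τ (key v x) ⌝
  instτ-names τ v e {a} a∈ with ∈-map⁻ _ (subst (a ∈_) (namesI-ren _ _ e) a∈)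
  ... | x , x∈ , eq = x , ∈-++⁺ʳ (tagsI e) x∈ , eq

  instτ-tags : ∀ τ v e {a} → a ∈ tagsI (instτ τ v e) → ∃ λ x → x ∈ tagsI e × a ≡ ⌜ τ (key v x) ⌝
  instτ-tags τ v e {a} a∈ = ∈-map⁻ _ (subst (a ∈_) (tagsI-ren _ _ e) a∈)

  CanR-names : ∀ {r T a} → a ∈ namesE (CanR r T) → ∃ λ y → ∃ λ w → a ≡ ⌜ y , w ⌝ × InR r w
  CanR-names {r} {T} a∈ with concatMap∈⁻ namesI (CanR r T) a∈
  ... | e , e∈ , a∈e with ∈CanR⁻ T e∈
  ...   | t , v , _ , _ , p , refl with instτ-names id v (proj₂ t) a∈e
  ...     | x , _ , eq = x , take (dep x) v , eq , InR-take (dep x) v p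

  -- A tag has the full depth of its template and therefore determines the whole index vector of its
  -- process constant.
  record WfIds (X : List ℕ) (t : Tm) : Set where
    field
      ids    : ∀ {x} → x ∈ idsI (proj₂ t) → x ∈ X × dep x ≤ proj₁ t
      tagDep : ∀ {x} → x ∈ tagsI (proj₂ t) → dep x ≡ proj₁ t

  open WfIds

  -- Commuting with `take` means respecting the sharing of outer names, so `g` sends template
  -- instances to template instances. `Q` is a domain on which `g` is injective; there it acts as a
  -- renaming that preserves derivability. More copies may be required to contain the new indices.
  Ok-lift : ∀ {T} (g : List ℕ → List ℕ) (Q : List ℕ → Set) → (∀ n w → take n (g w) ≡ g (take n w)) → (∀ w → length (g w) ≡ length w) →
    (∀ {w w'} → Q w → Q w' → g w ≡ g w' → w ≡ w') → ∀ {m} → (∀ {w} → InR (const m) w → Q w) →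
    ∀ τ v e → (∀ {x} → x ∈ idsI e → Q (proj₂ (τ (key v x)))) → Ok (Can m T) (instτ τ v e) →
    ∃ λ m' → Ok (Can m' T) (instτ (λ k → proj₁ (τ k) , g (proj₂ (τ k))) v e)
  Ok-lift {T} g Q g-take g-length g-inj {m} Q-Can τ v e Q-e ok = m' , subst (Ok (Can m' T)) (lift-instτ δ τ v e)
      (Ok-⊆ {e = renI (lift δ) (lift δ) (instτ τ v e)} sub (Ok-ren (lift δ) (lift δ) {Can m T} {instτ τ v e} inj ok))
    where
      δ : Key → Key
      δ (y , w) = y , g w
      lifted : ∀ w t → renI (lift δ) (lift δ) (inst w (proj₂ t)) ≡ inst (g w) (proj₂ t)
      lifted w t = trans (lift-instτ δ id w (proj₂ t)) (renI-cong′ (proj₂ t) (λ {x} _ → cong (λ u → ⌜ x , u ⌝) (sym (g-take (dep x) w))))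
      common = commonBound {P = λ m' f → renI (lift δ) (lift δ) f ∈ Can m' T} (λ l → Can-mono l) (Can m T) each
        where
          each : ∀ {f} → f ∈ Can m T → ∃ λ m' → renI (lift δ) (lift δ) f ∈ Can m' T
          each f∈ with ∈CanR⁻ T f∈
          ... | t , w , t∈ , l , _ , refl = bound (g w) , subst (_∈ Can (bound (g w)) T) (sym (lifted w t))
                (∈CanR⁺ (g w) t∈ (trans (g-length w) l) (All⇒InR (g w) (All-bound (g w))))
      m' = proj₁ common
      sub : map (renI (lift δ) (lift δ)) (Can m T) ⊆ Can m' T
      sub p with ∈-map⁻ (renI (lift δ) (lift δ)) p
      ... | f , f∈ , refl = proj₂ common f∈
      coded : ∀ {a} → a ∈ namesE (Can m T) ++ namesI (instτ τ v e) → ∃ λ y → ∃ λ w → a ≡ ⌜ y , w ⌝ × Q w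
      coded {a} p with ∈-++⁻ (namesE (Can m T)) p
      ... | inj₁ q with CanR-names {T = T} q
      ...   | y , w , eq , r = y , w , eq , Q-Can r
      coded {a} p | inj₂ q with instτ-names τ v e q
      ...   | x , x∈ , eq = _ , _ , eq , Q-e x∈
      inj : InjOn (lift δ) (namesE (Can m T) ++ namesI (instτ τ v e))
      inj a∈ b∈ eq with coded a∈ | coded b∈
      ... | y , w , refl , q | y' , w' , refl , q' with ⌜⌝-injective (trans (sym (lift-⌜⌝ δ (y , w))) (trans eq (lift-⌜⌝ δ (y' , w'))))
      ...   | eqk with ,-injective eqk
      ...     | e₁ , e₂ = cong₂ (λ y w → ⌜ y , w ⌝) e₁ (g-inj q q' e₂)

  -- Bounding the target

  SmallName : ℕ → Name → Set
  SmallName k a = ∃ λ y → ∃ λ w → a ≡ ⌜ y , w ⌝ × All (_< k) w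

  ∈⇒≤sum : ∀ {A : Set} (f : A → ℕ) {x xs} → x ∈ xs → f x ≤ sum (map f xs)
  ∈⇒≤sum f {xs = y ∷ xs} (here refl) = m≤m+n (f y) _
  ∈⇒≤sum f {xs = y ∷ xs} (there p)   = ≤-trans (∈⇒≤sum f p) (m≤n+m _ (f y))

  bumpKey : ℕ → ℕ → Key → Key
  bumpKey j c (y , w) = y , bump j c w

  -- Copy `suc c` at level `j` is copy `c` renamed by `bump`. Its own names are new to the smaller
  -- knowledge and, by `k ≤ suc c`, to `M`, so absorption removes it.
  absorb-step : ∀ {T} j c r k M → k ≤ suc c → (∀ {a} → a ∈ namesM M → SmallName k a) →
    msgs (CanR (updR j (suc (suc c)) r) T) ⊢ M → msgs (CanR (updR j (suc c) r) T) ⊢ M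
  absorb-step {T} j c r k M k≤ small d = ⊢-absorb (lift (bumpKey j c)) Γ M inj out (ax-mono sub d)
    where
      E = CanR (updR j (suc c) r) T
      Γ = msgs E
      names : ∀ {a} → a ∈ namesL Γ → ∃ λ y → ∃ λ w → a ≡ ⌜ y , w ⌝ × InR (updR j (suc c) r) w
      names a∈ = CanR-names {T = T} (names-msgs E a∈)
      inj : InjOn (lift (bumpKey j c)) (namesL Γ)
      inj a∈ b∈ eq with names a∈ | names b∈
      ... | y , w , refl , p | y' , w' , refl , p'
          with ,-injective (⌜⌝-injective (trans (sym (lift-⌜⌝ (bumpKey j c) (y , w))) (trans eq (lift-⌜⌝ (bumpKey j c) (y' , w')))))
      ...   | e₁ , e₂ = cong₂ (λ y w → ⌜ y , w ⌝) e₁ (bump-injective j c w w' p p' e₂)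
      out : ∀ {a} → a ∈ namesL Γ → lift (bumpKey j c) a ≢ a → lift (bumpKey j c) a ∉ namesL Γ × lift (bumpKey j c) a ∉ namesM M
      out a∈ ne with names a∈
      ... | y , w , refl , p = notΓ , notM
        where
          moved : bump j c w ≢ w
          moved e = ne (trans (lift-⌜⌝ (bumpKey j c) (y , w)) (cong (λ w → ⌜ y , w ⌝) e))
          notΓ : lift (bumpKey j c) ⌜ y , w ⌝ ∉ namesL Γ
          notΓ q with names q
          ... | y' , w' , e , p' = bump-moved-InR j c w moved (subst (InR _)
                  (sym (proj₂ (,-injective (⌜⌝-injective (trans (sym (lift-⌜⌝ (bumpKey j c) (y , w))) e))))) p')
          notM : lift (bumpKey j c) ⌜ y , w ⌝ ∉ namesM M
          notM q with small q
          ... | y' , w' , e , p' = <⇒≱ (All.lookup p' (subst (suc c ∈_)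
                  (proj₂ (,-injective (⌜⌝-injective (trans (sym (lift-⌜⌝ (bumpKey j c) (y , w))) e)))) (bump-moved-∈ j c w moved))) k≤
      lifted : ∀ w t → renI (lift (bumpKey j c)) (lift (bumpKey j c)) (inst w (proj₂ t)) ≡ inst (bump j c w) (proj₂ t)
      lifted w t = trans (lift-instτ (bumpKey j c) id w (proj₂ t))
        (renI-cong′ (proj₂ t) (λ {x} _ → cong (λ u → ⌜ x , u ⌝) (sym (bump-take j c (dep x) w))))
      sub : msgs (CanR (updR j (suc (suc c)) r) T) ⊆ Γ ++ map (renM (lift (bumpKey j c))) Γ
      sub {N} N∈ with ∈CanR⁻ T (∈msgs⁻ (CanR (updR j (suc (suc c)) r) T) N∈)
      ... | t , w , t∈ , l , p , eq with bump-cover j c w p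
      ...   | inj₁ p' = ∈-++⁺ˡ (∈msgs⁺ (subst (_∈ E) (sym eq) (∈CanR⁺ w t∈ l p')))
      ...   | inj₂ (w₀ , p' , l₀ , refl) = ∈-++⁺ʳ Γ (subst (N ∈_) (msgs-ren (lift (bumpKey j c)) (lift (bumpKey j c)) E)
                (∈msgs⁺ (subst (_∈ map (renI (lift (bumpKey j c)) (lift (bumpKey j c))) E) (trans (lifted w₀ t) (sym eq))
                  (∈-map⁺ (renI (lift (bumpKey j c)) (lift (bumpKey j c))) (∈CanR⁺ w₀ t∈ (trans l₀ l) p')))))

  absorb-level : ∀ {T} j r k M → (∀ {a} → a ∈ namesM M → SmallName k a) → ∀ n →
    msgs (CanR (updR j (n + suc k) r) T) ⊢ M → msgs (CanR (updR j (suc k) r) T) ⊢ M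
  absorb-level j r k M small zero    d = d
  absorb-level {T} j r k M small (suc n) d = absorb-level j r k M small n
    (subst (λ c → msgs (CanR (updR j c r) T) ⊢ M) (sym (+-suc n k)) (absorb-step {T} j (n + k) r k M (≤-trans (m≤n+m k n) (n≤1+n _)) small
      (subst (λ c → msgs (CanR (updR j (suc c) r) T) ⊢ M) (+-suc n k) d)))

  absorb-levels : ∀ {T} k M → (∀ {a} → a ∈ namesM M → SmallName k a) → ∀ n D →
    msgs (Can (n + suc k) T) ⊢ M → msgs (CanR (mixR (suc k) (n + suc k) D) T) ⊢ M
  absorb-levels k M small n zero    d = d
  absorb-levels {T} k M small n (suc D) d =
    ax-mono (msgs-⊆ (CanR-≗ (updR-mix-lo (suc k) (n + suc k) D)))
      (absorb-level {T} D (mixR (suc k) (n + suc k) D) k M small n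
        (ax-mono (msgs-⊆ (CanR-≗ (λ i → sym (updR-mix-hi (suc k) (n + suc k) D i)))) (absorb-levels {T} k M small n D d)))

  absorb-all : ∀ {T} k M → (∀ {a} → a ∈ namesM M → SmallName k a) → ∀ m → msgs (Can m T) ⊢ M → msgs (Can (suc k) T) ⊢ M
  absorb-all {T} k M small m d = ax-mono (msgs-⊆ (CanR-⊆ {T = T} λ {t} {v} t∈ l p →
      InR-mix⁻ (suc k) (m + suc k) D v (≤-trans (≤-reflexive l) (∈⇒≤sum proj₁ t∈)) p))
    (absorb-levels {T} k M small m D (ax-mono (msgs-⊆ (Can-mono {T = T} (m≤m+n m (suc k)))) d))
    -- At least the depth of every template, so no template reaches a level that still has the
    -- larger range.
    where D = sum (map proj₁ T)

  -- Messages are handled by absorption. The instance of a process constant is determined by its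
  -- tag, whose indices are already small.
  Ok-bounded : ∀ {T Y} → (∀ {t} → t ∈ T → WfIds Y t) → ∀ k e → (∀ {a} → a ∈ namesI e → SmallName k a) → (∀ {a} → a ∈ tagsI e → SmallName k a) →
    ∀ m → Ok (Can m T) e → Ok (Can (suc k) T) e
  Ok-bounded {T} wt k (im M) small smallT m d = absorb-all {T} k M small m d
  Ok-bounded {T} wt k (iq t q Ms) small smallT m e∈ with ∈CanR⁻ T e∈
  ... | tm , w , tm∈ , l , p , eq = subst (_∈ Can (suc k) T) (sym eq)
        (∈CanR⁺ w tm∈ l (All⇒InR w (All.map (λ p → <-≤-trans p (n≤1+n k)) (idx (instτ-tags id w (proj₂ tm) (subst (λ f → t ∈ tagsI f) eq (here refl)))))))
    where
      idx : (∃ λ x → x ∈ tagsI (proj₂ tm) × t ≡ ⌜ key w x ⌝) → All (_< k) w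
      idx (x , x∈ , e) with smallT (here refl)
      ... | y , w' , e' , a = subst (All (_< k)) (trans (sym (proj₂ (,-injective (⌜⌝-injective (trans (sym e) e')))))
              (take-length (dep x) w (trans l (sym (tagDep (wt tm∈) x∈))))) a

  length-cartesianProductWith : ∀ {A B C : Set} (f : A → B → C) xs ys → length (cartesianProductWith f xs ys) ≡ length xs * length ys
  length-cartesianProductWith f []       ys = refl
  length-cartesianProductWith f (x ∷ xs) ys = trans (length-++ (map (f x) ys))
    (cong₂ _+_ (length-map (f x) ys) (length-cartesianProductWith f xs ys))

  length-concatMap-≤ : ∀ {A B : Set} (f : A → List B) {D} xs → (∀ {x} → x ∈ xs → length (f x) ≤ D) → length (concatMap f xs) ≤ length xs * D
  length-concatMap-≤ f []       h = z≤n
  length-concatMap-≤ f (x ∷ xs) h = ≤-trans (≤-reflexive (length-++ (f x))) (+-mono-≤ (h (here refl)) (length-concatMap-≤ f xs (h ∘ there)))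

  -- Coverings

  module Keys (X : List ℕ) where

    Valid : (ℕ → ℕ) → Key → Set
    Valid r (x , u) = x ∈ X × length u ≡ dep x × InR r u

    keys : (ℕ → ℕ) → List Key
    keys r = concatMap (λ x → map (x ,_) (vecs (dep x) r)) X

    ∈keys⁺ : ∀ {r k} → Valid r k → k ∈ keys r
    ∈keys⁺ {r} {x , u} (x∈ , l , p) = concatMap∈⁺ (λ x → map (x ,_) (vecs (dep x) r)) x∈ (∈-map⁺ (x ,_) (∈vecs⁺ u l p))

    ∈keys⁻ : ∀ {r k} → k ∈ keys r → Valid r k
    ∈keys⁻ {r} {k} k∈ with concatMap∈⁻ (λ x → map (x ,_) (vecs (dep x) r)) X k∈
    ... | x , x∈ , p with ∈-map⁻ (x ,_) p
    ...   | u , u∈ , refl with ∈vecs⁻ (dep x) u∈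
    ...     | l , q = x∈ , l , q

  module Coverings (X : List ℕ) (T₁ : List Tm) (Y : List ℕ) (T₂ : List Tm) (F₂ : List Name) where

    open Keys X

    -- τ embeds the instance of T₁ given by r into the instance of T₂ given by m. The pairs (a , k) of O
    -- are the keys k of T₁ that stand for the name a.
    record IsCov (O : List (Name × Key)) (r : ℕ → ℕ) (τ : Key → Key) (m : ℕ) : Set where
      field
        wf  : ∀ {k} → Valid r k → proj₁ (τ k) ∈ Y × length (proj₂ (τ k)) ≡ dep (proj₁ (τ k))
        inj : ∀ {k k'} → Valid r k → Valid r k' → τ k ≡ τ k' → k ≡ k'
        rig : ∀ {k a} → Valid r k → a ∈ F₂ → ((a , k) ∈ O → τ k ≡ κ a) × (τ k ≡ κ a → (a , k) ∈ O)
        ok  : ∀ {t v} → t ∈ T₁ → length v ≡ proj₁ t → InR r v → Ok (Can m T₂) (instτ τ v (proj₂ t))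

  module Cover (X : List ℕ) (T₁ : List Tm) (Y : List ℕ) (T₂ : List Tm) (F₂ : List Name)
               (wt₁ : ∀ {t} → t ∈ T₁ → WfIds X t) (wt₂ : ∀ {t} → t ∈ T₂ → WfIds Y t) where

    open Keys X
    open Coverings X T₁ Y T₂ F₂
    open IsCov

    key-valid : ∀ {r t v x} → t ∈ T₁ → length v ≡ proj₁ t → InR r v → x ∈ idsI (proj₂ t) → Valid r (key v x)
    key-valid {v = v} {x} t∈ l p x∈ with ids (wt₁ t∈) x∈
    ... | x∈X , d≤ = x∈X , length-take-≤ (dep x) v (≤-trans d≤ (≤-reflexive (sym l))) , InR-take (dep x) v p

    insts : (ℕ → ℕ) → List (Tm × List ℕ)
    insts r = concatMap (λ t → map (t ,_) (vecs (proj₁ t) r)) T₁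

    ∈insts⁺ : ∀ {r t v} → t ∈ T₁ → length v ≡ proj₁ t → InR r v → (t , v) ∈ insts r
    ∈insts⁺ {r} {t} {v} t∈ l p = concatMap∈⁺ (λ t → map (t ,_) (vecs (proj₁ t) r)) t∈ (∈-map⁺ (t ,_) (∈vecs⁺ v l p))

    ∈insts⁻ : ∀ {r t v} → (t , v) ∈ insts r → t ∈ T₁ × length v ≡ proj₁ t × InR r v
    ∈insts⁻ {r} p with concatMap∈⁻ (λ t → map (t ,_) (vecs (proj₁ t) r)) T₁ p
    ... | t' , t∈ , q with ∈-map⁻ (t' ,_) q
    ...   | v' , v∈ , refl = t∈ , ∈vecs⁻ (proj₁ t') v∈

    commonOk : ∀ r τ → (∀ {t v} → t ∈ T₁ → length v ≡ proj₁ t → InR r v → ∃ λ m → Ok (Can m T₂) (instτ τ v (proj₂ t))) →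
               ∃ λ m → ∀ {t v} → t ∈ T₁ → length v ≡ proj₁ t → InR r v → Ok (Can m T₂) (instτ τ v (proj₂ t))
    commonOk r τ h with commonBound {P = λ m tv → Ok (Can m T₂) (instτ τ (proj₂ tv) (proj₂ (proj₁ tv)))}
                          (λ {m} {n} {tv} l → Ok-⊆ {e = instτ τ (proj₂ tv) (proj₂ (proj₁ tv))} (Can-mono {T = T₂} l)) (insts r)
                          (λ p → let (a , b , c) = ∈insts⁻ p in h a b c)
    ... | m , q = m , λ t∈ l p → q (∈insts⁺ t∈ l p)

    isCov-cong : ∀ {O r τ τ' m} → (∀ {k} → Valid r k → τ k ≡ τ' k) → IsCov O r τ m → IsCov O r τ' m
    isCov-cong {O} {r} {τ} {τ'} {m} h c = record
      { wf  = λ v → subst (λ k → proj₁ k ∈ Y × length (proj₂ k) ≡ dep (proj₁ k)) (h v) (wf c v)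
      ; inj = λ v v' e → inj c v v' (trans (h v) (trans e (sym (h v'))))
      ; rig = λ v a∈ → (λ o → trans (sym (h v)) (proj₁ (rig c v a∈) o)) , (λ e → proj₂ (rig c v a∈) (trans (h v) e))
      ; ok  = λ {t} {v} t∈ l p → subst (Ok (Can m T₂))
                (renI-cong′ (proj₂ t) (λ x∈ → cong ⌜_⌝ (h (key-valid t∈ l p x∈)))) (ok c t∈ l p) }

    isCov-weaken : ∀ {O r r' τ m} → (∀ {k} → Valid r' k → InR r (proj₂ k)) →
                   (∀ {t v} → t ∈ T₁ → length v ≡ proj₁ t → InR r' v → InR r v) → IsCov O r τ m → IsCov O r' τ m
    isCov-weaken h h' c = record
      { wf  = λ v → wf c (val v)
      ; inj = λ v v' → inj c (val v) (val v')
      ; rig = λ v → rig c (val v)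
      ; ok  = λ t∈ l p → ok c t∈ l (h' t∈ l p) }
      where val : ∀ {k} → Valid _ k → Valid _ k
            val v@(x∈ , l , p) = x∈ , l , h v

    -- Counts the keys over `Y` on the paths that a copy must avoid: one path for each identifier of
    -- `X`, and the empty path.
    K : ℕ
    K = length Y * suc (length X)

    -- Pumping: changing the range of one level of the source

    module Pump {O r τ m} (c : IsCov O r τ m) (j k : ℕ) (k≤ : k + suc K ≤ r j)
                (small : ∀ {a x u} → (a , (x , u)) ∈ O → All (_< k) u) (n' : ℕ) where

      -- The keys `key p z` include all names shared by the copies below `p`, and these are the
      -- paths to their images. The empty path makes every key without indices, in particular each
      -- `κ a`, count as lying on them.
      ws : List ℕ → List (List ℕ)
      ws p = [] ∷ map (λ z → proj₂ (τ (key p z))) X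

      Λ : List ℕ → List Key
      Λ p = cartesianProductWith (λ y w → y , take (dep y) w) Y (ws p)

      length-Λ : ∀ p → length (Λ p) ≡ K
      length-Λ p = trans (length-cartesianProductWith (λ y w → y , take (dep y) w) Y (ws p))
        (cong (λ n → length Y * suc n) (length-map (λ z → proj₂ (τ (key p z))) X))

      BadKey : List ℕ → ℕ → Key → Set
      BadKey p i k = (j < length (proj₂ k)) × (take j (proj₂ k) ≡ p) × (getAt j (proj₂ k) ≡ i) × (τ k ∈ Λ p)

      bad? : ∀ p i → Dec (Any (BadKey p i) (keys r))
      bad? p i = Any.any? (λ k → (j <? length (proj₂ k)) ×-dec ((≡-dec _≟_ (take j (proj₂ k)) p) ×-dec
                   ((getAt j (proj₂ k) ≟ i) ×-dec (τ k ∈ᵏ? Λ p)))) (keys r)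

      -- A bad copy has a key whose image lies in `Λ p`. Keys of different copies differ at index
      -- `j` and `τ` is injective, so at most `K` of the `suc K` copies are bad.
      notAllBad : ∀ p → ¬ (∀ (i : Fin (suc K)) → Any (BadKey p (k + toℕ i)) (keys r))
      notAllBad p h with FinP.pigeonhole (s≤s (≤-reflexive (length-Λ p))) (λ i → Any.index (proj₂ (proj₂ (proj₂ (proj₂ (proj₂ (find (h i))))))))
      ... | i , i' , i<i' , e = <-irrefl (+-cancelˡ-≡ k (toℕ i) (toℕ i') same) i<i'
        where
          w : ∀ i → ∃ λ κ → κ ∈ keys r × BadKey p (k + toℕ i) κ
          w i = find (h i)
          val : ∀ i → τ (proj₁ (w i)) ≡ lookup (Λ p) (Any.index (proj₂ (proj₂ (proj₂ (proj₂ (proj₂ (w i)))))))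
          val i = AnyP.lookup-index (proj₂ (proj₂ (proj₂ (proj₂ (proj₂ (w i))))))
          keyEq : proj₁ (w i) ≡ proj₁ (w i')
          keyEq = inj c (∈keys⁻ (proj₁ (proj₂ (w i)))) (∈keys⁻ (proj₁ (proj₂ (w i'))))
                    (trans (val i) (trans (cong (lookup (Λ p)) e) (sym (val i'))))
          at : ∀ i → getAt j (proj₂ (proj₁ (w i))) ≡ k + toℕ i
          at i = proj₁ (proj₂ (proj₂ (proj₂ (proj₂ (w i)))))
          same : k + toℕ i ≡ k + toℕ i'
          same = trans (sym (at i)) (trans (cong (getAt j ∘ proj₂) keyEq) (at i'))

      Good : List ℕ → ℕ → Set
      Good p i = i < r j × (∀ {x u} → Valid r (x , u) → j < length u → take j u ≡ p → getAt j u ≡ i → ¬ Prefix (ws p) (proj₂ (τ (x , u))))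

      abstract
        goodCopy : ∀ p → ∃ (Good p)
        goodCopy p with FinP.¬∀⟶∃¬ (suc K) (λ i → Any (BadKey p (k + toℕ i)) (keys r)) (λ i → bad? p (k + toℕ i)) (notAllBad p)
        ... | i , notBad = k + toℕ i , ≤-trans (+-monoʳ-< k (FinP.toℕ<n i)) k≤ , good
          where
            good : ∀ {x u} → Valid r (x , u) → j < length u → take j u ≡ p → getAt j u ≡ k + toℕ i → ¬ Prefix (ws p) (proj₂ (τ (x , u)))
            good {x} {u} v j< e e' (s , w∈) = notBad (lose (∈keys⁺ v) (j< , e , e' , inΛ))
              where
                -- By `wf` the image has the length that its identifier prescribes, so as a prefix
                -- of a path it equals the truncation collected in `Λ p`.
                eq : take (dep (proj₁ (τ (x , u)))) (proj₂ (τ (x , u)) ++ s) ≡ proj₂ (τ (x , u))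
                eq = trans (cong (λ n → take n (proj₂ (τ (x , u)) ++ s)) (sym (proj₂ (wf c v)))) (take-length-++ (proj₂ (τ (x , u))) s)
                inΛ : τ (x , u) ∈ Λ p
                inΛ = subst (λ w → (proj₁ (τ (x , u)) , w) ∈ Λ p) eq
                        (∈-cartesianProductWith⁺ (λ y w → y , take (dep y) w) (proj₁ (wf c v)) w∈)

      ip : List ℕ → ℕ
      ip p = proj₁ (goodCopy p)

      abstract
        entries : ∃ λ M → ∀ {κ} → κ ∈ keys r → All (_< M) (proj₂ (τ κ))
        entries = commonBound {P = λ M κ → All (_< M) (proj₂ (τ κ))} (λ l → All.map (λ p → <-≤-trans p l)) (keys r)
          (λ {κ} _ → bound (proj₂ (τ κ)) , All-bound (proj₂ (τ κ)))

      -- Above all indices in the images of `τ` and above those of the `m` target copies, so that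
      -- shifted indices are recognizable in either.
      M : ℕ
      M = proj₁ entries ⊔ m

      small-τ : ∀ {κ} → Valid r κ → All (_< M) (proj₂ (τ κ))
      small-τ v = All.map (λ p → <-≤-trans p (m≤m⊔n (proj₁ entries) m)) (proj₂ entries (∈keys⁺ v))

      -- Records the replaced index together with the vector `q` that identifies the new copy;
      -- distinct new copies thus get disjoint images.
      g : List ℕ → ℕ → ℕ
      g q i = M + code (i ∷ q)

      g-big : ∀ q i → M ≤ g q i
      g-big q i = m≤m+n M _

      g-inj : ∀ {q q' i i'} → g q i ≡ g q' i' → i ≡ i' × q ≡ q'
      g-inj {q} {q'} {i} {i'} e with code-injective (+-cancelˡ-≡ M (code (i ∷ q)) (code (i' ∷ q')) e)
      ... | refl = refl , refl

      old : List ℕ → List ℕ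
      old u = setAt j (ip (take j u)) u

      δ : List ℕ → List ℕ → List ℕ
      δ u = shift (g (take (suc j) u)) (ws (take j u))

      -- A new key takes the image of its counterpart in the good copy for its prefix, moved off the
      -- shared paths; all other keys keep their images.
      τ⁺ : Key → Key
      τ⁺ (x , u) with New? r j u
      ... | yes _ = proj₁ (τ (x , old u)) , δ u (proj₂ (τ (x , old u)))
      ... | no _  = τ (x , u)

      τ⁺-new : ∀ {x u} → New r j u → τ⁺ (x , u) ≡ (proj₁ (τ (x , old u)) , δ u (proj₂ (τ (x , old u))))
      τ⁺-new {x} {u} n with New? r j u
      ... | yes _ = refl
      ... | no ¬n = ⊥-elim (¬n n)

      τ⁺-old : ∀ {x u} → ¬ New r j u → τ⁺ (x , u) ≡ τ (x , u)
      τ⁺-old {x} {u} ¬n with New? r j u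
      ... | yes n = ⊥-elim (¬n n)
      ... | no _  = refl

      r⁺ : ℕ → ℕ
      r⁺ = updR j n' r

      InR-old⁺ : ∀ u → InR r⁺ u → InR r (old u)
      InR-old⁺ u p = InR-setAt j u (proj₁ (proj₂ (goodCopy (take j u)))) p

      valid-old : ∀ {x u} → Valid r⁺ (x , u) → Valid r (x , old u)
      valid-old {x} {u} (x∈ , l , p) = x∈ , trans (length-setAt j _ u) l , InR-old⁺ u p

      valid-same : ∀ {x u} → ¬ New r j u → Valid r⁺ (x , u) → Valid r (x , u)
      valid-same {x} {u} ¬n (x∈ , l , p) = x∈ , l , InR-old j u ¬n p

      notPrefix : ∀ {x u} → New r j u → Valid r⁺ (x , u) → ¬ Prefix (ws (take j u)) (proj₂ (τ (x , old u)))
      notPrefix {x} {u} (j< , _) v = proj₂ (proj₂ (goodCopy (take j u))) (valid-old v)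
        (subst (j <_) (sym (length-setAt j _ u)) j<) (take-setAt-before j _ u) (getAt-setAt j _ u j<)

      big-new : ∀ {x u} → New r j u → Valid r⁺ (x , u) → ∃ λ i → firstBig M (proj₂ (τ⁺ (x , u))) ≡ just (g (take (suc j) u) i)
      big-new {x} {u} n v with shift-big (g-big (take (suc j) u)) (ws (take j u)) (proj₂ (τ (x , old u))) (small-τ (valid-old v)) (notPrefix n v) ([] , here refl)
      ... | i , e = i , trans (cong (firstBig M ∘ proj₂) (τ⁺-new {x} n)) e

      big-old : ∀ {x u} → ¬ New r j u → Valid r⁺ (x , u) → firstBig M (proj₂ (τ⁺ (x , u))) ≡ nothing
      big-old {x} {u} ¬n v = trans (cong (firstBig M ∘ proj₂) (τ⁺-old {x} ¬n)) (firstBig-small _ (small-τ (valid-same ¬n v)))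

      nothing≢just : ∀ {n : ℕ} → nothing ≢ just n
      nothing≢just ()

      wf⁺ : ∀ {κ} → Valid r⁺ κ → proj₁ (τ⁺ κ) ∈ Y × length (proj₂ (τ⁺ κ)) ≡ dep (proj₁ (τ⁺ κ))
      wf⁺ {x , u} v with New? r j u
      ... | no ¬n = wf c (valid-same ¬n v)
      ... | yes n = proj₁ (wf c (valid-old v)) , trans (shift-length (g (take (suc j) u)) (ws (take j u)) (proj₂ (τ (x , old u)))) (proj₂ (wf c (valid-old v)))

      inj-new : ∀ {x u x' u'} → New r j u → New r j u' → Valid r⁺ (x , u) → Valid r⁺ (x' , u') → take (suc j) u ≡ take (suc j) u' →
                (proj₁ (τ (x , old u)) , δ u (proj₂ (τ (x , old u)))) ≡ (proj₁ (τ (x' , old u')) , δ u' (proj₂ (τ (x' , old u')))) →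
                (x , u) ≡ (x' , u')
      inj-new {x} {u} {x'} {u'} n n' v v' eq e = cong₂ _,_ (proj₁ both) (setAt-injective j (ip (take j u)) u u' eq
          (trans (proj₂ both) (cong (λ p → setAt j (ip p) u') (sym eqj))))
        where
          eqj : take j u ≡ take j u'
          eqj = trans (sym (take-take-≤ j (suc j) u (n≤1+n j))) (trans (cong (take j) eq) (take-take-≤ j (suc j) u' (n≤1+n j)))
          eqδ : δ u (proj₂ (τ (x' , old u'))) ≡ δ u' (proj₂ (τ (x' , old u')))
          eqδ = cong₂ (λ q p → shift (g q) (ws p) (proj₂ (τ (x' , old u')))) eq eqj
          second : proj₂ (τ (x , old u)) ≡ proj₂ (τ (x' , old u'))
          second = shift-injective (g-big (take (suc j) u)) (proj₁ ∘ g-inj) (ws (take j u)) _ _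
                     (small-τ (valid-old v)) (small-τ (valid-old v')) (trans (proj₂ (,-injective e)) (sym eqδ))
          both : x ≡ x' × old u ≡ old u'
          both = ,-injective (inj c (valid-old v) (valid-old v') (cong₂ _,_ (proj₁ (,-injective e)) second))

      -- An index of at least `M` distinguishes images of new keys from those of old ones. For two
      -- new keys the first such index reveals the copy, which leaves injectivity of `shift` and of
      -- `τ`.
      inj⁺ : ∀ {κ κ'} → Valid r⁺ κ → Valid r⁺ κ' → τ⁺ κ ≡ τ⁺ κ' → κ ≡ κ'
      inj⁺ {x , u} {x' , u'} v v' e = cases (New? r j u) (New? r j u')
        where
          cases : Dec (New r j u) → Dec (New r j u') → (x , u) ≡ (x' , u')
          cases (no ¬n) (no ¬n') = inj c (valid-same ¬n v) (valid-same ¬n' v') (trans (sym (τ⁺-old ¬n)) (trans e (τ⁺-old ¬n')))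
          cases (no ¬n) (yes n') = ⊥-elim (nothing≢just (trans (sym (big-old ¬n v)) (trans (cong (firstBig M ∘ proj₂) e) (proj₂ (big-new n' v')))))
          cases (yes n) (no ¬n') = ⊥-elim (nothing≢just (trans (sym (big-old ¬n' v')) (trans (cong (firstBig M ∘ proj₂) (sym e)) (proj₂ (big-new n v)))))
          cases (yes n) (yes n') = inj-new n n' v v'
            (proj₂ (g-inj (just-injective (trans (sym (proj₂ (big-new n v))) (trans (cong (firstBig M ∘ proj₂) e) (proj₂ (big-new n' v')))))))
            (trans (sym (τ⁺-new n)) (trans e (τ⁺-new n')))

      -- Opened keys have indices below `k`, so no new key is opened; and the image of a new key has
      -- a big index, so it is no `κ a`.
      rig⁺ : ∀ {κ' a} → Valid r⁺ κ' → a ∈ F₂ → ((a , κ') ∈ O → τ⁺ κ' ≡ κ a) × (τ⁺ κ' ≡ κ a → (a , κ') ∈ O)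
      rig⁺ {x , u} {a} v a∈ = cases (New? r j u)
        where
          cases : Dec (New r j u) → ((a , (x , u)) ∈ O → τ⁺ (x , u) ≡ κ a) × (τ⁺ (x , u) ≡ κ a → (a , (x , u)) ∈ O)
          cases (no ¬n) = (λ o → trans (τ⁺-old ¬n) (proj₁ (rig c (valid-same ¬n v) a∈) o)) ,
                          (λ e → proj₂ (rig c (valid-same ¬n v) a∈) (trans (sym (τ⁺-old ¬n)) e))
          cases (yes n) = (λ o → ⊥-elim (<⇒≱ (All.lookup (small o) (getAt-∈ j u (proj₁ n))) (≤-trans (≤-trans (m≤m+n k (suc K)) k≤) (proj₂ n)))) ,
                          (λ e → ⊥-elim (nothing≢just (trans (sym (cong (firstBig M ∘ proj₂) e)) (proj₂ (big-new n v)))))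

      -- All names of a new item are mapped like those of its counterpart in the good copy, followed
      -- by one common shift: names that depend on at most `j` indices have their image paths in
      -- `ws` and are fixed by it. So `Ok-lift` applies.
      ok⁺ : ∀ {t v} → t ∈ T₁ → length v ≡ proj₁ t → InR r⁺ v → ∃ λ m' → Ok (Can m' T₂) (instτ τ⁺ v (proj₂ t))
      ok⁺ {t} {v} t∈ l p = cases (New? r j v)
        where
          len : ∀ {x} → x ∈ idsI (proj₂ t) → length (take (dep x) v) ≡ dep x
          len x∈ = length-take-≤ _ v (≤-trans (proj₂ (ids (wt₁ t∈) x∈)) (≤-reflexive (sym l)))
          lold : length (old v) ≡ proj₁ t
          lold = trans (length-setAt j _ v) l

          shifted : New r j v → ∀ {x} → x ∈ idsI (proj₂ t) →
                    (proj₁ (τ (key (old v) x)) , δ v (proj₂ (τ (key (old v) x)))) ≡ τ⁺ (key v x)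
          shifted (j< , r≤) {x} x∈ with j <? dep x
          ... | yes j<x = trans (cong₂ (λ u q → proj₁ (τ (x , u)) , q) eqOld eqδ) (sym (τ⁺-new {x} new))
            where
              u = take (dep x) v
              new : New r j u
              new = subst (j <_) (sym (len x∈)) j<x , ≤-trans r≤ (≤-reflexive (sym (getAt-take j (dep x) v j<x)))
              eqj : take j v ≡ take j u
              eqj = sym (take-take-≤ j (dep x) v (<⇒≤ j<x))
              eqOld : take (dep x) (old v) ≡ old u
              eqOld = trans (take-setAt (dep x) j _ v) (cong (λ p → setAt j (ip p) u) eqj)
              eqδ : δ v (proj₂ (τ (key (old v) x))) ≡ δ u (proj₂ (τ (x , old u)))
              eqδ = trans (cong (λ w → δ v (proj₂ (τ (x , w)))) eqOld)
                      (cong₂ (λ q p → shift (g q) (ws p) (proj₂ (τ (x , old u)))) (sym (take-take-≤ (suc j) (dep x) v j<x)) eqj)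
          ... | no j≮x = trans (cong₂ _,_ (cong (λ w → proj₁ (τ (x , w))) eqOld) eqδ) (sym (τ⁺-old {x} notNew))
            where
              u = take (dep x) v
              x≤j : dep x ≤ j
              x≤j = ≮⇒≥ j≮x
              notNew : ¬ New r j u
              notNew (j<u , _) = j≮x (subst (j <_) (len x∈) j<u)
              eqOld : take (dep x) (old v) ≡ u
              eqOld = trans (take-setAt (dep x) j _ v) (setAt-short j _ u (≤-trans (≤-reflexive (len x∈)) x≤j))
              inWs : proj₂ (τ (x , u)) ∈ ws (take j v)
              inWs = there (subst (λ w → proj₂ (τ (x , w)) ∈ map (λ z → proj₂ (τ (key (take j v) z))) X) (take-take-≤ (dep x) j v x≤j)
                       (∈-map⁺ (λ z → proj₂ (τ (key (take j v) z))) (proj₁ (ids (wt₁ t∈) x∈))))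
              eqδ : δ v (proj₂ (τ (key (old v) x))) ≡ proj₂ (τ (x , u))
              eqδ = trans (cong (λ w → δ v (proj₂ (τ (x , w)))) eqOld) (shift-fix _ (ws (take j v)) _ (∈⇒prefix inWs))

          same : ¬ New r j v → ∀ {x} → x ∈ idsI (proj₂ t) → τ (key v x) ≡ τ⁺ (key v x)
          same ¬n {x} x∈ = sym (τ⁺-old {x} λ (j<u , r≤) →
            let j<x = subst (j <_) (len x∈) j<u in
            ¬n (<-≤-trans j<x (≤-trans (proj₂ (ids (wt₁ t∈) x∈)) (≤-reflexive (sym l))) ,
                ≤-trans r≤ (≤-reflexive (getAt-take j (dep x) v j<x))))

          cases : Dec (New r j v) → ∃ λ m' → Ok (Can m' T₂) (instτ τ⁺ v (proj₂ t))
          cases (no ¬n) = m , subst (Ok (Can m T₂)) (renI-cong′ (proj₂ t) (λ x∈ → cong ⌜_⌝ (same ¬n x∈))) (ok c t∈ l (InR-old j v ¬n p))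
          cases (yes n) = proj₁ lifted , subst (Ok (Can (proj₁ lifted) T₂)) (renI-cong′ (proj₂ t) (λ x∈ → cong ⌜_⌝ (shifted n x∈))) (proj₂ lifted)
            where
              lifted = Ok-lift (δ v) (All (_< M)) (shift-take _ (ws (take j v))) (shift-length _ (ws (take j v)))
                (λ {w} {w'} → shift-injective (g-big (take (suc j) v)) (proj₁ ∘ g-inj) (ws (take j v)) w w')
                (λ {w} q → All.map (λ p → <-≤-trans p (m≤n⊔m (proj₁ entries) m)) (InR⇒All w q))
                τ (old v) (proj₂ t) (λ x∈ → small-τ (key-valid t∈ lold (InR-old⁺ v p) x∈)) (ok c t∈ lold (InR-old⁺ v p))

      pumped : ∃ λ m' → IsCov O r⁺ τ⁺ m'
      pumped with commonOk r⁺ τ⁺ ok⁺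
      ... | m' , q = m' , record { wf = wf⁺ ; inj = inj⁺ ; rig = rig⁺ ; ok = q }

    -- The levels are changed in turn; when level `D` is reached, it still has the `n₀` copies that
    -- the pigeonhole argument requires.
    pumpLevels : ∀ {O k n₀} → k + suc K ≤ n₀ → (∀ {a x u} → (a , (x , u)) ∈ O → All (_< k) u) →
      ∀ n D {τ m} → IsCov O (const n₀) τ m → ∃ λ τ → ∃ λ m → IsCov O (mixR n n₀ D) τ m
    pumpLevels k≤ small n zero c = _ , _ , c
    pumpLevels {O} {k} {n₀} k≤ small n (suc D) c with pumpLevels k≤ small n D c
    ... | τ , m , c' = _ , _ , isCov-weaken (λ {κ} v → conv (proj₂ κ) (proj₂ (proj₂ v))) (λ {_} {v} _ _ → conv v)
            (proj₂ (Pump.pumped c' D k (≤-trans k≤ (≤-reflexive (sym (mixR-at n n₀ D)))) small n))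
      where conv : ∀ v → InR (mixR n n₀ (suc D)) v → InR (updR D n (mixR n n₀ D)) v
            conv v = InR-mono v (λ i → ≤-reflexive (sym (updR-mix-lo n n₀ D i)))

    pumpAll : ∀ {O k n₀ τ m} → k + suc K ≤ n₀ → (∀ {a x u} → (a , (x , u)) ∈ O → All (_< k) u) →
      IsCov O (const n₀) τ m → ∀ n → ∃ λ τ → ∃ λ m → IsCov O (const n) τ m
    pumpAll {n₀ = n₀} k≤ small c n with pumpLevels k≤ small n D c
      where D = sum (map dep X) + sum (map proj₁ T₁)
    ... | τ , m , c' = τ , m , isCov-weaken
            (λ {κ} (x∈ , l , p) → InR-mix⁺ n n₀ _ (proj₂ κ) (≤-trans (≤-reflexive l) (≤-trans (∈⇒≤sum dep x∈) (m≤m+n _ _))) p)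
            (λ {_} {v} t∈ l p → InR-mix⁺ n n₀ _ v (≤-trans (≤-reflexive l) (≤-trans (∈⇒≤sum proj₁ t∈) (m≤n+m _ (sum (map dep X))))) p) c'

    -- Deciding coverings

    -- Each image has as many indices as its identifier prescribes, so the images of all keys
    -- together have at most this many.
    k₂ : (ℕ → ℕ) → ℕ
    k₂ r = length (keys r) * sum (map dep Y)

    -- One injective renaming of all indices makes the images small without identifying any. Then
    -- `Ok-bounded` limits the number of target copies.
    bounded : ∀ {O r τ m} → IsCov O r τ m →
              ∃ λ τ' → IsCov O r τ' (suc (k₂ r)) × (∀ {κ} → Valid r κ → All (_< k₂ r) (proj₂ (τ' κ)))
    bounded {O} {r} {τ} {m} c = τ' , record { wf = wf' ; inj = inj' ; rig = rig' ; ok = ok' } , small'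
      where
        S = concatMap (proj₂ ∘ τ) (keys r)
        S≤ : length S ≤ k₂ r
        S≤ = length-concatMap-≤ (proj₂ ∘ τ) (keys r) (λ κ∈ → let (y∈ , l) = wf c (∈keys⁻ κ∈) in ≤-trans (≤-reflexive l) (∈⇒≤sum dep y∈))
        π = reindex (k₂ r) S
        τ' : Key → Key
        τ' κ = proj₁ (τ κ) , map π (proj₂ (τ κ))
        π-inj : ∀ {w w'} → map π w ≡ map π w' → w ≡ w'
        π-inj = map-injective (reindex-injective S S≤)
        small' : ∀ {κ} → Valid r κ → All (_< k₂ r) (proj₂ (τ' κ))
        small' {κ} v = All.tabulate λ i∈ → let (s , s∈ , e) = ∈-map⁻ π i∈ in
          subst (_< k₂ r) (sym e) (reindex-∈ S≤ (concatMap∈⁺ (proj₂ ∘ τ) (∈keys⁺ v) s∈))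
        wf' : ∀ {κ} → Valid r κ → proj₁ (τ' κ) ∈ Y × length (proj₂ (τ' κ)) ≡ dep (proj₁ (τ' κ))
        wf' {k} v = proj₁ (wf c v) , trans (length-map π (proj₂ (τ k))) (proj₂ (wf c v))
        inj' : ∀ {κ κ'} → Valid r κ → Valid r κ' → τ' κ ≡ τ' κ' → κ ≡ κ'
        inj' v v' e = inj c v v' (cong₂ _,_ (proj₁ (,-injective e)) (π-inj (proj₂ (,-injective e))))
        rig' : ∀ {κ' a} → Valid r κ' → a ∈ F₂ → ((a , κ') ∈ O → τ' κ' ≡ κ a) × (τ' κ' ≡ κ a → (a , κ') ∈ O)
        rig' v a∈ = (λ o → cong (λ { (y , w) → y , map π w }) (proj₁ (rig c v a∈) o)) ,
                    (λ e → proj₂ (rig c v a∈) (cong₂ _,_ (proj₁ (,-injective e)) (π-inj (proj₂ (,-injective e)))))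
        ok' : ∀ {t v} → t ∈ T₁ → length v ≡ proj₁ t → InR r v → Ok (Can (suc (k₂ r)) T₂) (instτ τ' v (proj₂ t))
        ok' {t} {v} t∈ l p = Ok-bounded wt₂ (k₂ r) (instτ τ' v (proj₂ t))
            (λ a∈ → let (x , x∈ , e) = instτ-names τ' v (proj₂ t) a∈ in _ , _ , e , small' (key-valid t∈ l p x∈))
            (λ a∈ → let (x , x∈ , e) = instτ-tags τ' v (proj₂ t) a∈ in _ , _ , e , small' (key-valid t∈ l p (∈-++⁺ˡ x∈)))
            (proj₁ lifted) (proj₂ lifted)
          where
            lifted = Ok-lift (map π) (λ _ → ⊤) (take-map {f = π}) (length-map π) (λ _ _ → π-inj) {m} (λ _ → tt) τ v (proj₂ t) (λ _ → tt) (ok c t∈ l p)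

    isCov? : ∀ O r τ m → Dec (IsCov O r τ m)
    isCov? O r τ m = map′
        (λ (a , b , d , e) → record
          { wf = λ v → All.lookup a (∈keys⁺ v)
          ; inj = λ v v' → All.lookup b (∈-cartesianProduct⁺ (∈keys⁺ v) (∈keys⁺ v'))
          ; rig = λ v a∈ → All.lookup d (∈-cartesianProduct⁺ (∈keys⁺ v) a∈)
          ; ok = λ t∈ l p → All.lookup e (∈insts⁺ t∈ l p) })
        (λ c → All.tabulate (λ κ∈ → wf c (∈keys⁻ κ∈)) ,
               All.tabulate (λ {(κ , κ')} p → let (q , q') = ∈-cartesianProduct⁻ (keys r) (keys r) p in inj c (∈keys⁻ q) (∈keys⁻ q')) ,
               All.tabulate (λ {(κ , a)} p → let (q , q') = ∈-cartesianProduct⁻ (keys r) F₂ p in rig c (∈keys⁻ q) q') ,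
               All.tabulate (λ {(t , v)} p → let (t∈ , l , q) = ∈insts⁻ p in ok c t∈ l q))
        (All.all? (λ κ → (proj₁ (τ κ) ∈? Y) ×-dec (length (proj₂ (τ κ)) ≟ dep (proj₁ (τ κ)))) (keys r)
         ×-dec (All.all? (λ (κ , κ') → (τ κ ≟ᵏ τ κ') →-dec (κ ≟ᵏ κ')) (cartesianProduct (keys r) (keys r))
         ×-dec (All.all? (λ (k , a) → (((a , k) ∈ᵒ? O) →-dec (τ k ≟ᵏ κ a)) ×-dec ((τ k ≟ᵏ κ a) →-dec ((a , k) ∈ᵒ? O))) (cartesianProduct (keys r) F₂)
         ×-dec All.all? (λ (t , v) → Ok? (Can m T₂) (instτ τ v (proj₂ t))) (insts r))))

    apply : List (Key × Key) → Key → Key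
    apply []             k = 0 , []
    apply ((k' , w) ∷ R) k with k ≟ᵏ k'
    ... | yes _ = w
    ... | no  _ = apply R k

    apply-∈ : ∀ {τ : Key → Key} R {k} → (∀ {k' w} → (k' , w) ∈ R → τ k' ≡ w) → (∃ λ w → (k , w) ∈ R) → apply R k ≡ τ k
    apply-∈ ((k' , w) ∷ R) {k} h (w' , p) with k ≟ᵏ k'
    ... | yes refl = sym (h (here refl))
    ... | no n with p
    ...   | here refl = ⊥-elim (n refl)
    ...   | there q   = apply-∈ R (h ∘ there) (w' , q)

    targets : (ℕ → ℕ) → List Key
    targets r = concatMap (λ y → map (y ,_) (vecs (dep y) (const (k₂ r)))) Y

    -- A covering is evaluated only at the finitely many valid keys. It can be replaced by its
    -- graph, and by `bounded` the graph may be taken as a subset of a finite product.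
    cov? : ∀ O r → Dec (∃ λ τ → ∃ λ m → IsCov O r τ m)
    cov? O r = map′ (λ p → let (R , _ , c) = find p in apply R , suc (k₂ r) , c) complete
        (Any.any? (λ R → isCov? O r (apply R) (suc (k₂ r))) (sublists (cartesianProduct (keys r) (targets r))))
      where
        complete : (∃ λ τ → ∃ λ m → IsCov O r τ m) → Any (λ R → IsCov O r (apply R) (suc (k₂ r))) (sublists (cartesianProduct (keys r) (targets r)))
        complete (τ₀ , m₀ , c₀) with bounded c₀
        ... | τ , c , small = lose (filter∈sublists graph? (cartesianProduct (keys r) (targets r)))
                (isCov-cong (λ {κ} v → sym (apply-∈ (filter graph? (cartesianProduct (keys r) (targets r)))
                  (λ p → proj₂ (∈-filter⁻ graph? {xs = cartesianProduct (keys r) (targets r)} p))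
                  (τ κ , ∈-filter⁺ graph? (∈-cartesianProduct⁺ (∈keys⁺ v) (target v)) refl))) c)
          where
            graph? : ∀ (kw : Key × Key) → Dec (τ (proj₁ kw) ≡ proj₂ kw)
            graph? (k , w) = τ k ≟ᵏ w
            target : ∀ {κ} → Valid r κ → τ κ ∈ targets r
            target {κ} v = concatMap∈⁺ (λ y → map (y ,_) (vecs (dep y) (const (k₂ r)))) (proj₁ (wf c v))
              (∈-map⁺ (proj₁ (τ κ) ,_) (∈vecs⁺ (proj₂ (τ κ)) (proj₂ (wf c v)) (All⇒InR _ (small v))))

  -- Two flattenings of a process differ by a renaming

  Fl-length : ∀ {ρ ρ' P cs ys E E'} → Fl ρ P cs E → Fl ρ' P ys E' → length cs ≡ length ys × length (tagsE E) ≡ length (tagsE E')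
  Fl-length f𝟘 f𝟘 = refl , refl
  Fl-length (fν d) (fν d') = let (p , q) = Fl-length d d' in cong suc p , q
  Fl-length (f∥ {ys = cs} {E = E} {E' = F} d₁ d₂) (f∥ {ys = ys} {E = E'} {E' = F'} d₁' d₂')
    with Fl-length d₁ d₁' | Fl-length d₂ d₂'
  ... | p , q | p' , q' = trans (length-++ cs) (trans (cong₂ _+_ p p') (sym (length-++ ys))) ,
    trans (cong length (tagsE-++ E F)) (trans (length-++ (tagsE E)) (trans (cong₂ _+_ q q')
      (trans (sym (length-++ (tagsE E'))) (sym (cong length (tagsE-++ E' F'))))))
  Fl-length fm fm = refl , refl
  Fl-length (fq _) (fq _) = refl , refl

  map-++⁻ : ∀ (f : Name → Name) xs {ys zs ws} → length xs ≡ length zs → map f (xs ++ ys) ≡ zs ++ ws → map f xs ≡ zs × map f ys ≡ ws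
  map-++⁻ f []       {zs = []}     l e = refl , e
  map-++⁻ f (x ∷ xs) {zs = z ∷ zs} l e with map-++⁻ f xs (suc-injective l) (∷-injectiveʳ e)
  ... | p , q = cong₂ _∷_ (∷-injectiveˡ e) p , q

  -- Any two flattenings traverse the process in the same order, so matching their lists of binders
  -- and of tags entry by entry determines the renaming.
  Fl-relate : ∀ ψ σ {ρ ρ' P cs ys E E'} → Fl ρ P cs E → Fl ρ' P ys E' → (∀ {a} → a ∈ fvP P → ψ (ρ a) ≡ ρ' a) →
              map ψ cs ≡ ys → map σ (tagsE E) ≡ tagsE E' → E' ≡ map (renI ψ σ) E
  Fl-relate ψ σ f𝟘 f𝟘 h e t = refl
  Fl-relate ψ σ {ρ} {ρ'} {ν x P} (fν {y = c} d) (fν {y = y} d') h e t = Fl-relate ψ σ d d' h' (∷-injectiveʳ e) t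
    where h' : ∀ {a} → a ∈ fvP P → ψ ((ρ [ x ↦ c ]) a) ≡ (ρ' [ x ↦ y ]) a
          h' {a} a∈ with a ≟ x
          ... | yes _ = ∷-injectiveˡ e
          ... | no n  = h (∈removeName⁺ a∈ n)
  Fl-relate ψ σ {P = P ∥ Q} (f∥ {ys = cs} {E = E} {E' = F} d₁ d₂) (f∥ {E = E'} {E' = F'} d₁' d₂') h e t
    with map-++⁻ ψ cs (proj₁ (Fl-length d₁ d₁')) e
       | map-++⁻ σ (tagsE E) (proj₂ (Fl-length d₁ d₁')) (trans (cong (map σ) (sym (tagsE-++ E F))) (trans t (tagsE-++ E' F')))
  ... | e₁ , e₂ | t₁ , t₂ = trans (cong₂ _++_ (Fl-relate ψ σ d₁ d₁' (h ∘ ∈-++⁺ˡ) e₁ t₁) (Fl-relate ψ σ d₂ d₂' (h ∘ ∈-++⁺ʳ (fvP P)) e₂ t₂))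
                              (sym (map-++ (renI ψ σ) E F))
  Fl-relate ψ σ {ρ} {P = ⟨ M ⟩} fm fm h e t = cong (λ N → im N ∷ []) (sym (trans (renM-∘ ψ ρ M) (renM-cong M h)))
  Fl-relate ψ σ {ρ} {P = Qc q Ms} (fq s) (fq s') h e t =
    cong₂ (λ s N → iq s q N ∷ []) (sym (∷-injectiveˡ t)) (sym (trans (renL-∘ ψ ρ Ms) (renL-cong Ms h)))

  map-envs : ∀ ρ cs ys → Unique cs → length cs ≡ length ys → map (envs ρ cs ys) cs ≡ ys
  map-envs ρ [] [] u l = refl
  map-envs ρ (c ∷ cs) (y ∷ ys) u l with Unique-∷⁻ u
  ... | c∉ , v = cong₂ _∷_ (trans (envs-∉ _ cs ys c∉) ([↦]-same ρ c y)) (map-envs _ cs ys v (suc-injective l))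

  take-[] : ∀ n → take n ([] {A = ℕ}) ≡ []
  take-[] zero    = refl
  take-[] (suc n) = refl

  cenv-fr : ∀ a → cenv fr [] a ≡ ⌜ κ a ⌝
  cenv-fr a = cong (λ u → ⌜ fr a , u ⌝) (take-[] (dep (fr a)))

  unκ : Name → Name
  unκ c = payload (hd (decode c))

  unκ-κ : ∀ a → unκ ⌜ κ a ⌝ ≡ a
  unκ-κ a = trans (cong (payload ∘ hd) (decode-code (fr a ∷ []))) (payload-fr a)

  κ-not-under : ∀ {π v c a} → Under π v 1 c → c ≢ ⌜ κ a ⌝
  κ-not-under {a = a} (d , π' , v' , refl) e = absurd (trans (sym (kind-code d 1 _)) (trans (cong kind (,-injectiveˡ (⌜⌝-injective e))) (kind-code 0 0 (a ∷ []))))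
    where absurd : 1 ≢ 0
          absurd ()

  CanonFlat : Proc → List Item → Set
  CanonFlat P E = Canon (Under [] []) (cenv fr []) P E

  record Renaming (P : Proc) (Ec E : List Item) : Set where
    field
      θ σ   : Name → Name
      eq    : E ≡ map (renI θ σ) Ec
      θ-inj : InjOn θ (namesE Ec)
      σ-inj : InjOn σ (tagsE Ec)
      θ-κ   : ∀ {a} → a ∈ fvP P → θ ⌜ κ a ⌝ ≡ a
      κ∈    : ∀ {a} → a ∈ fvP P → ⌜ κ a ⌝ ∈ namesE Ec

  canonRenaming : ∀ {P Ec E} → CanonFlat P Ec → FlatOf P E → Renaming P Ec E
  canonRenaming {P} {Ec} {E} (canon {cs} f u nm ut tg) (ys , d , uys , h , utE) = record
      { θ = θ ; σ = σ
      ; eq = Fl-relate θ σ f d (λ {a} a∈ → trans (cong θ (cenv-fr a)) (θ-κ a)) (map-envs unκ cs ys u lcs) (map-envs id (tagsE Ec) (tagsE E) ut lts)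
      ; θ-inj = θ-inj
      ; σ-inj = envs-inj id (tagsE Ec) (tagsE E) lts utE
      ; θ-κ = λ {a} _ → θ-κ a
      ; κ∈ = λ {a} a∈ → subst (_∈ namesE Ec) (cenv-fr a) (Fl-fv f a∈) }
    where
      lcs = proj₁ (Fl-length f d)
      lts = proj₂ (Fl-length f d)
      -- Outside the canonical binders the default `unκ` returns the free name for which a key
      -- stands.
      θ = envs unκ cs ys
      σ = envs id (tagsE Ec) (tagsE E)
      κ∉ : ∀ a → ⌜ κ a ⌝ ∉ cs
      κ∉ a p = κ-not-under (nm p) refl
      θ-κ : ∀ a → θ ⌜ κ a ⌝ ≡ a
      θ-κ a = trans (envs-∉ unκ cs ys (κ∉ a)) (unκ-κ a)
      origin : ∀ {c} → c ∈ namesE Ec → c ∈ cs ⊎ (∃ λ a → a ∈ fvP P × c ≡ ⌜ κ a ⌝)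
      origin c∈ = Sum.map id (λ (a , a∈ , e) → a , a∈ , trans e (cenv-fr a)) (Fl-names f c∈)
      θ-inj : InjOn θ (namesE Ec)
      θ-inj a∈ b∈ e with origin a∈ | origin b∈
      ... | inj₁ p | inj₁ q = envs-inj unκ cs ys lcs uys p q e
      ... | inj₁ p | inj₂ (b , b∈P , refl) = ⊥-elim (h (envs-∈ unκ cs ys lcs p) (subst (_∈ fvP P) (sym (trans e (θ-κ b))) b∈P))
      ... | inj₂ (a , a∈P , refl) | inj₁ q = ⊥-elim (h (envs-∈ unκ cs ys lcs q) (subst (_∈ fvP P) (trans (sym (θ-κ a)) e) a∈P))
      ... | inj₂ (a , a∈P , refl) | inj₂ (b , b∈P , refl) = cong (λ a → ⌜ κ a ⌝) (trans (sym (θ-κ a)) (trans e (θ-κ b)))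

  realize : ∀ {P Ec} φ σ → CanonFlat P Ec → Injective _≡_ _≡_ φ → Injective _≡_ _≡_ σ → (∀ {a} → a ∈ fvP P → φ ⌜ κ a ⌝ ≡ a) →
            FlatOf P (map (renI φ σ) Ec)
  realize {P} {Ec} φ σ (canon {cs} f u nm ut tg) φ-inj σ-inj rig =
      map φ cs , Fl-cong (λ {a} a∈ → trans (cong φ (cenv-fr a)) (rig a∈)) (Fl-ren φ σ f) ,
      Unique-map-InjOn φ (λ _ _ → φ-inj) u ,
      (λ p a∈ → let (c , c∈ , e) = ∈-map⁻ φ p in κ-not-under (nm c∈) (φ-inj (trans (sym e) (sym (rig a∈))))) ,
      subst Unique (sym (tagsE-ren φ σ Ec)) (Unique-map-InjOn σ (λ _ _ → σ-inj) ut)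

  -- A left inverse of ψ on xs, extended injectively by fresh keys with identifier y.
  record Inverse (ψ : Name → Name) (xs : List Name) (y : ℕ) (Q : Key → Set) : Set where
    field
      χ     : Name → Name
      χ-inv : ∀ {c} → c ∈ xs → χ (ψ c) ≡ c
      χ-inj : Injective _≡_ _≡_ χ
      χ-key : ∀ b → ∃ λ k → χ b ≡ ⌜ k ⌝ × (Q k ⊎ (∃ λ i → k ≡ (y , i ∷ [])))

  -- The keys `(y , b ∷ [])` carry one index, so a single identifier provides values for all names
  -- without a preimage in `xs`; since `Q` excludes `y`, they do not meet `xs`.
  inverse : ∀ ψ xs y (Q : Key → Set) → InjOn ψ xs → (∀ {c} → c ∈ xs → ∃ λ k → c ≡ ⌜ k ⌝ × Q k) → (∀ {k} → Q k → proj₁ k ≢ y) → Inverse ψ xs y Q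
  inverse ψ xs y Q ψ-inj keyed Q≢y = record { χ = χ ; χ-inv = χ-inv ; χ-inj = χ-inj ; χ-key = χ-key }
    where
      found? : ∀ b → Dec (Any (λ c → ψ c ≡ b) xs)
      found? b = Any.any? (λ c → ψ c ≟ b) xs
      pick : ∀ b → Dec (Any (λ c → ψ c ≡ b) xs) → Name
      pick b (yes p) = proj₁ (find p)
      pick b (no _)  = ⌜ y , b ∷ [] ⌝
      χ : Name → Name
      χ b = pick b (found? b)
      Found : Name → Set
      Found b = ∃ λ c → c ∈ xs × ψ c ≡ b × χ b ≡ c
      cases : ∀ b → Found b ⊎ (χ b ≡ ⌜ y , b ∷ [] ⌝ × ¬ Any (λ c → ψ c ≡ b) xs)
      cases b with found? b in eq
      ... | yes p = let (c , c∈ , e) = find p in inj₁ (c , c∈ , e , refl)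
      ... | no n  = inj₂ (refl , n)
      χ-inv : ∀ {c} → c ∈ xs → χ (ψ c) ≡ c
      χ-inv {c} c∈ with cases (ψ c)
      ... | inj₁ (c' , c'∈ , e , e') = trans e' (ψ-inj c'∈ c∈ e)
      ... | inj₂ (_ , n) = ⊥-elim (n (lose c∈ refl))
      fresh≢ : ∀ {c b} → c ∈ xs → c ≢ ⌜ y , b ∷ [] ⌝
      fresh≢ c∈ e with keyed c∈
      ... | k , e' , q = Q≢y q (,-injectiveˡ (⌜⌝-injective (trans (sym e') e)))
      χ-inj : Injective _≡_ _≡_ χ
      χ-inj {b} {b'} e with cases b | cases b'
      ... | inj₁ (c , c∈ , p , q) | inj₁ (c' , c'∈ , p' , q') = trans (sym p) (trans (cong ψ (trans (sym q) (trans e q'))) p')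
      ... | inj₁ (c , c∈ , p , q) | inj₂ (q' , _) = ⊥-elim (fresh≢ c∈ (trans (sym q) (trans e q')))
      ... | inj₂ (q , _) | inj₁ (c' , c'∈ , p' , q') = ⊥-elim (fresh≢ c'∈ (trans (sym q') (trans (sym e) q)))
      ... | inj₂ (q , _) | inj₂ (q' , _) = ∷-injectiveˡ (,-injectiveʳ (⌜⌝-injective (trans (sym q) (trans e q'))))
      χ-key : ∀ b → ∃ λ k → χ b ≡ ⌜ k ⌝ × (Q k ⊎ (∃ λ i → k ≡ (y , i ∷ [])))
      χ-key b with cases b
      ... | inj₂ (q , _) = _ , q , inj₂ (b , refl)
      ... | inj₁ (c , c∈ , _ , q) with keyed c∈
      ...   | k , e , qk = k , trans q e , inj₁ qk

  -- The identifiers of fresh names and fresh tags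
  y₀ y₁ : ℕ
  y₀ = code (1 ∷ 3 ∷ [])
  y₁ = code (1 ∷ 4 ∷ [])

  unkey : Name → Key
  unkey n with decode n
  ... | []    = 0 , []
  ... | x ∷ u = x , u

  unkey-⌜⌝ : ∀ k → unkey ⌜ k ⌝ ≡ k
  unkey-⌜⌝ (x , u) with decode (code (x ∷ u)) | decode-code (x ∷ u)
  ... | _ | refl = refl

  module Openings (X : List ℕ) (F₁ : List Name) (A : List Name) where

    open Keys X

    -- A finite partial injection telling which keys of names, as opposed to tags, carry a name from
    -- `A`. The free names of the source always carry themselves.
    record Opening (n : ℕ) (O : List (Name × Key)) : Set where
      field
        dom   : ∀ {a k} → (a , k) ∈ O → a ∈ A × Valid (const n) k × kind (proj₁ k) ≢ 2
        func  : ∀ {a k k'} → (a , k) ∈ O → (a , k') ∈ O → k ≡ k'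
        inj   : ∀ {a a' k} → (a , k) ∈ O → (a' , k) ∈ O → a ≡ a'
        rigid : ∀ {a} → a ∈ F₁ → (a , κ a) ∈ O

    opening-mono : ∀ {m n O} → m ≤ n → Opening m O → Opening n O
    opening-mono l op = record
      { dom = λ { {k = x , u} p → let (a∈ , (x∈ , e , v) , q) = Opening.dom op p in a∈ , (x∈ , e , InR-mono u (λ _ → l) v) , q }
      ; func = Opening.func op ; inj = Opening.inj op ; rigid = Opening.rigid op }

  Kinds : Tm → Set
  Kinds t = (∀ {x} → x ∈ namesI (proj₂ t) → kind x < 2) × (∀ {x} → x ∈ tagsI (proj₂ t) → kind x ≡ 2)

  nontag? : ∀ (k : Key) → Dec (kind (proj₁ k) ≢ 2)
  nontag? k = ¬? (kind (proj₁ k) ≟ 2)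

  lookO : List (Name × Key) → ℕ → Name → Name
  lookO []            N c = N + c
  lookO ((a , k) ∷ O) N c with c ≟ ⌜ k ⌝
  ... | yes _ = a
  ... | no  _ = lookO O N c

  lookO-cases : ∀ O N c → (∃ λ k → (lookO O N c , k) ∈ O × c ≡ ⌜ k ⌝) ⊎ (lookO O N c ≡ N + c × (∀ {a k} → (a , k) ∈ O → c ≢ ⌜ k ⌝))
  lookO-cases [] N c = inj₂ (refl , λ ())
  lookO-cases ((a , k) ∷ O) N c with c ≟ ⌜ k ⌝
  ... | yes e = inj₁ (k , here refl , e)
  ... | no n with lookO-cases O N c
  ...   | inj₁ (k' , p , e) = inj₁ (k' , there p , e)
  ...   | inj₂ (e , q) = inj₂ (e , λ { (here refl) → n ; (there p) → q p })

  -- From embeddings of configurations to coverings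

  module Forward (X : List ℕ) (T₁ : List Tm) (Y : List ℕ) (T₂ : List Tm) (F₂ : List Name) (O : List (Name × Key)) (n m : ℕ)
    (φ χ χt : Name → Name) (φ-inj : Injective _≡_ _≡_ φ) (χ-inj : Injective _≡_ _≡_ χ) (χt-inj : Injective _≡_ _≡_ χt)
    (χ-key : ∀ b → ∃ λ k → χ b ≡ ⌜ k ⌝ × proj₁ k ∈ Y × length (proj₂ k) ≡ dep (proj₁ k) × (kind (proj₁ k) < 2 ⊎ kind (proj₁ k) ≡ 3))
    (χt-key : ∀ b → ∃ λ k → χt b ≡ ⌜ k ⌝ × proj₁ k ∈ Y × length (proj₂ k) ≡ dep (proj₁ k) × (kind (proj₁ k) ≡ 2 ⊎ kind (proj₁ k) ≡ 4))
    (χ-κ : ∀ {a} → a ∈ F₂ → χ a ≡ ⌜ κ a ⌝)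
    (φ-O : ∀ {a k} → (a , k) ∈ O → φ ⌜ k ⌝ ≡ a × kind (proj₁ k) ≢ 2)
    (O-φ : ∀ {a k} → a ∈ F₂ → φ ⌜ k ⌝ ≡ a → (a , k) ∈ O)
    (kinds : ∀ {t} → t ∈ T₁ → Kinds t)
    (emb : ∀ {t v} → t ∈ T₁ → length v ≡ proj₁ t → InR (const n) v → Ok (Can m T₂) (renI (χ ∘ φ) (χt ∘ φ) (inst v (proj₂ t)))) where

    open Keys X
    open Coverings X T₁ Y T₂ F₂

    -- Names and tags are renamed by separate maps, but a covering acts on both sorts of keys at
    -- once. The disjoint kinds of the values keep the combination injective.
    image : Key → Name
    image k with kind (proj₁ k) ≟ 2
    ... | yes _ = χt (φ ⌜ k ⌝)
    ... | no  _ = χ (φ ⌜ k ⌝)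

    image-tag : ∀ {k} → kind (proj₁ k) ≡ 2 → image k ≡ χt (φ ⌜ k ⌝)
    image-tag {k} e with kind (proj₁ k) ≟ 2
    ... | yes _ = refl
    ... | no ne = ⊥-elim (ne e)

    image-name : ∀ {k} → kind (proj₁ k) ≢ 2 → image k ≡ χ (φ ⌜ k ⌝)
    image-name {k} ne with kind (proj₁ k) ≟ 2
    ... | yes e = ⊥-elim (ne e)
    ... | no _  = refl

    τ : Key → Key
    τ k = unkey (image k)

    WfKey : Key → Set
    WfKey k = proj₁ k ∈ Y × length (proj₂ k) ≡ dep (proj₁ k)

    coded : ∀ k → ∃ λ k' → image k ≡ ⌜ k' ⌝ × WfKey k'
    coded k with kind (proj₁ k) ≟ 2
    ... | yes _ = let (k' , e , y∈ , l , _) = χt-key (φ ⌜ k ⌝) in k' , e , y∈ , l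
    ... | no _  = let (k' , e , y∈ , l , _) = χ-key (φ ⌜ k ⌝) in k' , e , y∈ , l

    τ-image : ∀ k → ⌜ τ k ⌝ ≡ image k
    τ-image k with coded k
    ... | k' , e , _ = trans (cong (⌜_⌝ ∘ unkey) e) (trans (cong ⌜_⌝ (unkey-⌜⌝ k')) (sym e))

    clash : ∀ {k k' : Key} → (kind (proj₁ k) < 2 ⊎ kind (proj₁ k) ≡ 3) → (kind (proj₁ k') ≡ 2 ⊎ kind (proj₁ k') ≡ 4) → k ≢ k'
    clash (inj₁ p) (inj₁ q) refl = <-irrefl q p
    clash (inj₁ p) (inj₂ q) refl = <⇒≱ p (≤-trans (s≤s (s≤s z≤n)) (≤-reflexive (sym q)))
    clash (inj₂ p) (inj₁ q) refl with trans (sym p) q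
    ... | ()
    clash (inj₂ p) (inj₂ q) refl with trans (sym p) q
    ... | ()

    χ≢χt : ∀ b b' → χ b ≢ χt b'
    χ≢χt b b' e with χ-key b | χt-key b'
    ... | k , e₁ , _ , _ , q | k' , e₂ , _ , _ , q' = clash q q' (⌜⌝-injective (trans (sym e₁) (trans e e₂)))

    image-inj : ∀ {k k'} → image k ≡ image k' → k ≡ k'
    image-inj {k} {k'} e with kind (proj₁ k) ≟ 2 | kind (proj₁ k') ≟ 2
    ... | yes _ | yes _ = ⌜⌝-injective (φ-inj (χt-inj e))
    ... | no _  | no _  = ⌜⌝-injective (φ-inj (χ-inj e))
    ... | yes _ | no _  = ⊥-elim (χ≢χt _ _ (sym e))
    ... | no _  | yes _ = ⊥-elim (χ≢χt _ _ e)

    fromRigid : ∀ {k a} → a ∈ F₂ → τ k ≡ κ a → (a , k) ∈ O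
    fromRigid {k} {a} a∈ e = go (kind (proj₁ k) ≟ 2)
      where
        img : image k ≡ ⌜ κ a ⌝
        img = trans (sym (τ-image k)) (cong ⌜_⌝ e)
        go : Dec (kind (proj₁ k) ≡ 2) → (a , k) ∈ O
        go (yes p) = ⊥-elim (χ≢χt a (φ ⌜ k ⌝) (trans (χ-κ a∈) (trans (sym img) (image-tag p))))
        go (no p)  = O-φ a∈ (χ-inj (trans (sym (image-name p)) (trans img (sym (χ-κ a∈)))))

    covering : IsCov O (const n) τ m
    covering = record
      { wf  = λ {k} _ → let (k' , e , w) = coded k in subst WfKey (sym (trans (cong unkey e) (unkey-⌜⌝ k'))) w
      ; inj = λ {k} {k'} _ _ e → image-inj (trans (sym (τ-image k)) (trans (cong ⌜_⌝ e) (τ-image k')))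
      ; rig = λ {k} {a} _ a∈ → (λ o → ⌜⌝-injective (trans (τ-image k) (trans (image-name (proj₂ (φ-O o)))
                (trans (cong χ (proj₁ (φ-O o))) (χ-κ a∈))))) , fromRigid a∈
      ; ok  = λ {t} {v} t∈ l p → subst (Ok (Can m T₂)) (trans (renI-∘ _ _ _ _ (proj₂ t)) (renI-cong (proj₂ t)
                (λ {x} x∈ → sym (trans (τ-image (key v x)) (image-name {key v x} (λ e → <-irrefl e (proj₁ (kinds t∈) x∈)))))
                (λ {x} x∈ → sym (trans (τ-image (key v x)) (image-tag {key v x} (proj₂ (kinds t∈) x∈))))))
                (emb t∈ l p) }

  -- From coverings to embeddings of configurations

  module Backward (X : List ℕ) (T₁ : List Tm) (Y : List ℕ) (T₂ : List Tm) (F₂ : List Name)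
    (wt₁ : ∀ {t} → t ∈ T₁ → WfIds X t) (wt₂ : ∀ {t} → t ∈ T₂ → WfIds Y t)
    (O : List (Name × Key)) (n m : ℕ) (τ : Key → Key) (cov : Coverings.IsCov X T₁ Y T₂ F₂ O (const n) τ m)
    (φ φt : Name → Name) (φ-inj : Injective _≡_ _≡_ φ) (φt-inj : Injective _≡_ _≡_ φt)
    (φ-O : ∀ {a k} → (a , k) ∈ O → φ ⌜ k ⌝ ≡ a)
    (O-φ : ∀ {a k} → a ∈ F₂ → Keys.Valid X (const n) k → kind (proj₁ k) ≢ 2 → φ ⌜ k ⌝ ≡ a → (a , k) ∈ O)
    (kinds : ∀ {t} → t ∈ T₁ → Kinds t) where

    open Keys X
    open Coverings X T₁ Y T₂ F₂
    open Cover X T₁ Y T₂ F₂ wt₁ wt₂ using (key-valid)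
    open IsCov cov

    nks : List Key
    nks = filter nontag? (keys (const n))

    nks⁻ : ∀ {k} → k ∈ nks → Valid (const n) k × kind (proj₁ k) ≢ 2
    nks⁻ p = let (k∈ , q) = ∈-filter⁻ nontag? {xs = keys (const n)} p in ∈keys⁻ k∈ , q

    nks⁺ : ∀ {k} → Valid (const n) k → kind (proj₁ k) ≢ 2 → k ∈ nks
    nks⁺ v q = ∈-filter⁺ nontag? (∈keys⁺ v) q

    search : (Name → Name) → List Key → (Name → Name) → Name → Name
    search f []       d c = d c
    search f (k ∷ ks) d c with ⌜ τ k ⌝ ≟ c
    ... | yes _ = f ⌜ k ⌝
    ... | no  _ = search f ks d c

    search-∈ : ∀ f ks d {k} → (∀ {k'} → k' ∈ ks → Valid (const n) k') → k ∈ ks → search f ks d ⌜ τ k ⌝ ≡ f ⌜ k ⌝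
    search-∈ f (k' ∷ ks) d {k} val k∈ with ⌜ τ k' ⌝ ≟ ⌜ τ k ⌝
    ... | yes e = cong (f ∘ ⌜_⌝) (inj (val (here refl)) (val k∈) (⌜⌝-injective e))
    ... | no ne with k∈
    ...   | here refl = ⊥-elim (ne refl)
    ...   | there p   = search-∈ f ks d (val ∘ there) p

    search-cases : ∀ f ks d c → (∃ λ k → k ∈ ks × c ≡ ⌜ τ k ⌝) ⊎ search f ks d c ≡ d c
    search-cases f []       d c = inj₂ refl
    search-cases f (k ∷ ks) d c with ⌜ τ k ⌝ ≟ c
    ... | yes e = inj₁ (k , here refl , sym e)
    ... | no _  = Sum.map (λ (k' , p , e) → k' , there p , e) id (search-cases f ks d c)

    -- The name of a target key is dictated by `φ` on the image of `τ` and by the free name itself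
    -- on the keys `κ a`. The two directions of `rig` make these demands consistent and jointly
    -- injective.
    ψ₀ : Name → Name
    ψ₀ = search φ nks unκ

    ψ₀-τ : ∀ {k} → Valid (const n) k → kind (proj₁ k) ≢ 2 → ψ₀ ⌜ τ k ⌝ ≡ φ ⌜ k ⌝
    ψ₀-τ v q = search-∈ φ nks unκ (proj₁ ∘ nks⁻) (nks⁺ v q)

    ψ₀-κ : ∀ {a} → a ∈ F₂ → ψ₀ ⌜ κ a ⌝ ≡ a
    ψ₀-κ {a} a∈ with search-cases φ nks unκ ⌜ κ a ⌝
    ... | inj₂ e = trans e (unκ-κ a)
    ... | inj₁ (k , k∈ , e) = let (v , q) = nks⁻ k∈ in
      trans (cong ψ₀ e) (trans (ψ₀-τ v q) (φ-O (proj₂ (rig v a∈) (⌜⌝-injective (sym e)))))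

    dom : List Name
    dom = map (⌜_⌝ ∘ τ) nks ++ map (⌜_⌝ ∘ κ) F₂

    dom-cases : ∀ {c} → c ∈ dom → (∃ λ k → Valid (const n) k × kind (proj₁ k) ≢ 2 × c ≡ ⌜ τ k ⌝) ⊎ (∃ λ a → a ∈ F₂ × c ≡ ⌜ κ a ⌝)
    dom-cases p = Sum.map (λ q → let (k , k∈ , e) = ∈-map⁻ (⌜_⌝ ∘ τ) q ; (v , nt) = nks⁻ k∈ in k , v , nt , e) (∈-map⁻ (⌜_⌝ ∘ κ))
                    (∈-++⁻ (map (⌜_⌝ ∘ τ) nks) p)

    ψ₀-inj : InjOn ψ₀ dom
    ψ₀-inj c∈ c'∈ e with dom-cases c∈ | dom-cases c'∈
    ... | inj₁ (k , v , q , refl) | inj₁ (k' , v' , q' , refl) =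
          cong (⌜_⌝ ∘ τ) (⌜⌝-injective (φ-inj (trans (sym (ψ₀-τ v q)) (trans e (ψ₀-τ v' q')))))
    ... | inj₁ (k , v , q , refl) | inj₂ (a , a∈ , refl) =
          cong ⌜_⌝ (proj₁ (rig v a∈) (O-φ a∈ v q (trans (sym (ψ₀-τ v q)) (trans e (ψ₀-κ a∈)))))
    ... | inj₂ (a , a∈ , refl) | inj₁ (k , v , q , refl) =
          cong ⌜_⌝ (sym (proj₁ (rig v a∈) (O-φ a∈ v q (trans (sym (ψ₀-τ v q)) (trans (sym e) (ψ₀-κ a∈))))))
    ... | inj₂ (a , a∈ , refl) | inj₂ (b , b∈ , refl) = cong (⌜_⌝ ∘ κ) (trans (sym (ψ₀-κ a∈)) (trans e (ψ₀-κ b∈)))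

    ψ ψt : Name → Name
    ψ  = extend ψ₀ dom
    ψt = extend (search φt (keys (const n)) id) (map (⌜_⌝ ∘ τ) (keys (const n)))

    ψ-injective : Injective _≡_ _≡_ ψ
    ψ-injective = extend-injective ψ₀ dom ψ₀-inj

    ψt₀-τ : ∀ {k} → Valid (const n) k → search φt (keys (const n)) id ⌜ τ k ⌝ ≡ φt ⌜ k ⌝
    ψt₀-τ v = search-∈ φt (keys (const n)) id ∈keys⁻ (∈keys⁺ v)

    ψt-injective : Injective _≡_ _≡_ ψt
    ψt-injective = extend-injective _ _ λ p q e → go (∈-map⁻ (⌜_⌝ ∘ τ) p) (∈-map⁻ (⌜_⌝ ∘ τ) q) e
      where
        go : ∀ {c c'} → (∃ λ k → k ∈ keys (const n) × c ≡ ⌜ τ k ⌝) → (∃ λ k → k ∈ keys (const n) × c' ≡ ⌜ τ k ⌝) →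
             search φt (keys (const n)) id c ≡ search φt (keys (const n)) id c' → c ≡ c'
        go (k , k∈ , refl) (k' , k'∈ , refl) e = cong (⌜_⌝ ∘ τ) (⌜⌝-injective (φt-inj (trans (sym (ψt₀-τ (∈keys⁻ k∈))) (trans e (ψt₀-τ (∈keys⁻ k'∈))))))

    ψ-κ : ∀ {a} → a ∈ F₂ → ψ ⌜ κ a ⌝ ≡ a
    ψ-κ a∈ = trans (extend-∈ ψ₀ dom (∈-++⁺ʳ (map (⌜_⌝ ∘ τ) nks) (∈-map⁺ (⌜_⌝ ∘ κ) a∈))) (ψ₀-κ a∈)

    ψ-τ : ∀ {k} → Valid (const n) k → kind (proj₁ k) ≢ 2 → ψ ⌜ τ k ⌝ ≡ φ ⌜ k ⌝
    ψ-τ v q = trans (extend-∈ ψ₀ dom (∈-++⁺ˡ (∈-map⁺ (⌜_⌝ ∘ τ) (nks⁺ v q)))) (ψ₀-τ v q)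

    ψt-τ : ∀ {k} → Valid (const n) k → ψt ⌜ τ k ⌝ ≡ φt ⌜ k ⌝
    ψt-τ v = trans (extend-∈ _ _ (∈-map⁺ (⌜_⌝ ∘ τ) (∈keys⁺ v))) (ψt₀-τ v)

    embedding : ∀ {E₂} → Can m T₂ ⊆ E₂ → ∀ {t v} → t ∈ T₁ → length v ≡ proj₁ t → InR (const n) v →
                Ok (map (renI ψ ψt) E₂) (renI φ φt (inst v (proj₂ t)))
    embedding {E₂} sub {t} {v} t∈ l p = subst (Ok (map (renI ψ ψt) E₂))
        (trans (renI-∘ _ _ _ _ (proj₂ t)) (trans (renI-cong (proj₂ t)
          (λ {x} x∈ → ψ-τ (key-valid t∈ l p (∈-++⁺ʳ (tagsI (proj₂ t)) x∈)) (λ e → <-irrefl e (proj₁ (kinds t∈) x∈)))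
          (λ {x} x∈ → ψt-τ (key-valid t∈ l p (∈-++⁺ˡ x∈)))) (sym (renI-∘ _ _ _ _ (proj₂ t)))))
        (Ok-ren ψ ψt {E₂} {instτ τ v (proj₂ t)} (λ _ _ → ψ-injective) (Ok-⊆ {e = instτ τ v (proj₂ t)} sub (ok t∈ l p)))

  -- The decision procedure

  dec-∀∈ : ∀ {A : Set} {P : A → Set} (xs : List A) → (∀ {x} → x ∈ xs → Dec (P x)) → Dec (∀ {x} → x ∈ xs → P x)
  dec-∀∈ [] P? = yes λ ()
  dec-∀∈ {P = P} (x ∷ xs) P? = map′ join (λ h → h (here refl) , λ p → h (there p)) (P? (here refl) ×-dec dec-∀∈ {P = P} xs (P? ∘ there))
    where join : P x × (∀ {y} → y ∈ xs → P y) → ∀ {y} → y ∈ x ∷ xs → P y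
          join (p , q) (here refl) = p
          join (p , q) (there r)   = q r

  dec-Any∈ : ∀ {A : Set} {P : A → Set} (xs : List A) → (∀ {x} → x ∈ xs → Dec (P x)) → Dec (Any P xs)
  dec-Any∈ [] P? = no λ ()
  dec-Any∈ (x ∷ xs) P? = map′ (Sum.[ here , there ]) (λ { (here p) → inj₁ p ; (there p) → inj₂ p })
    (P? (here refl) ⊎-dec dec-Any∈ xs (P? ∘ there))

  allIds : List Tm → List ℕ
  allIds = concatMap (idsI ∘ proj₂)

  entry : List Name → Maybe (List Tm) → List (List Name × List Tm)
  entry F (just T) = (F , T) ∷ []
  entry F nothing  = []

  fam : Limit → List (List Name × List Tm)
  fam L = concatMap (λ F → entry F (TL F fr [] 0 L)) (sublists (namesLim L))

  fam⁻ : ∀ L {F T} → (F , T) ∈ fam L → TL F fr [] 0 L ≡ just T × (∀ {a} → a ∈ F → a ∈ namesLim L)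
  fam⁻ L p with concatMap∈⁻ (λ F → entry F (TL F fr [] 0 L)) (sublists (namesLim L)) p
  ... | F' , F'∈ , q with TL F' fr [] 0 L in eq
  ...   | just T' with q
  ...     | here refl = eq , ∈sublists⇒⊆ (namesLim L) F'∈

  fam⁺ : ∀ L {F T} → F ∈ sublists (namesLim L) → TL F fr [] 0 L ≡ just T → (F , T) ∈ fam L
  fam⁺ L {F} {T} F∈ eq = concatMap∈⁺ (λ F → entry F (TL F fr [] 0 L)) F∈ (subst (λ m → (F , T) ∈ entry F m) (sym eq) (here refl))

  fam-kinds : ∀ L {F T} → (F , T) ∈ fam L → ∀ {t} → t ∈ T → Kinds t
  fam-kinds L p t∈ = let w = TL-wf L wfEnv-fr (proj₁ (fam⁻ L p)) t∈ in proj₂ ∘ WfTm.wfName w , proj₂ ∘ WfTm.wfTag w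

  fam-ids : ∀ L {F T} X → (F , T) ∈ fam L → (∀ {x} → x ∈ allIds T → x ∈ X) → ∀ {t} → t ∈ T → WfIds X t
  fam-ids L X p sub {t} t∈ = record
      { ids = λ x∈ → sub (concatMap∈⁺ (idsI ∘ proj₂) t∈ x∈) , Sum.[ (λ q → ≤-reflexive (proj₁ (WfTm.wfTag w q))) , proj₁ ∘ WfTm.wfName w ] (∈-++⁻ (tagsI (proj₂ t)) x∈)
      ; tagDep = proj₁ ∘ WfTm.wfTag w }
    where w = TL-wf L wfEnv-fr (proj₁ (fam⁻ L p)) t∈

  -- `F` holds exactly the free names of `P`: as the larger process, `P` fixes precisely the names
  -- on which a covering into its templates is rigid.
  record Canonical (L : Limit) (P : Proc) : Set where
    field
      F    : List Name
      T    : List Tm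
      mem  : (F , T) ∈ fam L
      F⇒fv : ∀ {a} → a ∈ F → a ∈ fvP P
      fv⇒F : ∀ {a} → a ∈ fvP P → a ∈ F
      Ec   : List Item
      can  : CanonFlat P Ec
      n    : ℕ
      sub  : Ec ⊆ Can n T

  canonical : ∀ {L P} → InstL L P → Canonical L P
  canonical {L} {P} i = go (instL-canon {F} {fr} {[]} {[]} wfEnv-fr refl i (λ {a} a∈ _ → subst (_∈ F) (sym (payload-fr a)) (fv⇒F a∈)))
    where
      F = filter (_∈? fvP P) (namesLim L)
      fv⇒F : ∀ {a} → a ∈ fvP P → a ∈ F
      fv⇒F a∈ = ∈-filter⁺ (_∈? fvP P) (fv-InstL i a∈) a∈
      go : CanonIn (Under [] []) (TL F fr [] 0 L) fr [] P → Canonical L P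
      go (T , eq , Ec , c , inc) = record
          { F = F ; T = T ; mem = fam⁺ L (filter∈sublists (_∈? fvP P) (namesLim L)) eq
          ; F⇒fv = λ a∈ → proj₂ (∈-filter⁻ (_∈? fvP P) {xs = namesLim L} a∈) ; fv⇒F = fv⇒F ; Ec = Ec ; can = c
          ; n = proj₁ common ; sub = proj₂ common }
        where
          common : ∃ λ n → ∀ {e} → e ∈ Ec → e ∈ Can n T
          common = commonBound {P = λ n e → e ∈ Can n T} (λ l → Can-mono l) Ec
            (λ e∈ → let (t , t∈ , v , l , eq) = inc e∈ in bound v , subst (_∈ Can (bound v) T) (sym eq) (∈CanR⁺ v t∈ l (All⇒InR v (All-bound v))))

  -- A name of `F` may be absent from `P`. A covering treats it as fixed all the same, and `P` still
  -- flattens accordingly.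
  record Instance (L : Limit) (F : List Name) (T : List Tm) (n : ℕ) : Set where
    field
      P    : Proc
      ins  : InstL L P
      Ec   : List Item
      can  : CanonFlat P Ec
      fv⇒F : ∀ {a} → a ∈ fvP P → a ∈ F
      sub  : Can n T ⊆ Ec

  instanceOf : ∀ L {F T} n → (F , T) ∈ fam L → Instance L F T n
  instanceOf L {F} {T} n p = go (canon-instL n {F} {fr} {[]} {[]} L wfEnv-fr refl (proj₁ (fam⁻ L p)))
    where
      go : (∃ λ P → InstL L P × CanonOut n (Under [] []) F T fr [] P) → Instance L F T n
      go (P , i , Ec , c , al , cov) = record
        { P = P ; ins = i ; Ec = Ec ; can = c
        ; fv⇒F = λ {a} a∈ → subst (_∈ F) (payload-fr a) (al a∈ (kind-code 0 0 (a ∷ [])))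
        ; sub = λ e∈ → let (t , v , t∈ , l , p , eq) = ∈CanR⁻ T e∈ in subst (_∈ Ec) (sym eq) (cov t∈ v (InR⇒All v p) l) }

  ∈names-Can : ∀ {Ec n T} → Ec ⊆ Can n T → ∀ {c} → c ∈ namesE Ec →
               ∃ λ t → t ∈ T × ∃ λ v → length v ≡ proj₁ t × ∃ λ x → x ∈ namesI (proj₂ t) × c ≡ ⌜ key v x ⌝
  ∈names-Can {Ec} {n} {T} sub {c} c∈ with concatMap∈⁻ namesI Ec c∈
  ... | e , e∈ , c∈e with ∈CanR⁻ T (sub e∈)
  ...   | t , v , t∈ , l , _ , refl with ∈-map⁻ _ (subst (c ∈_) (namesI-ren _ _ (proj₂ t)) c∈e)
  ...     | x , x∈ , eq = t , t∈ , v , l , x , x∈ , eq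

  ∈tags-Can : ∀ {Ec n T} → Ec ⊆ Can n T → ∀ {c} → c ∈ tagsE Ec →
              ∃ λ t → t ∈ T × ∃ λ v → length v ≡ proj₁ t × ∃ λ x → x ∈ tagsI (proj₂ t) × c ≡ ⌜ key v x ⌝
  ∈tags-Can {Ec} {n} {T} sub {c} c∈ with concatMap∈⁻ tagsI Ec c∈
  ... | e , e∈ , c∈e with ∈CanR⁻ T (sub e∈)
  ...   | t , v , t∈ , l , _ , refl with ∈-map⁻ _ (subst (c ∈_) (tagsI-ren _ _ (proj₂ t)) c∈e)
  ...     | x , x∈ , eq = t , t∈ , v , l , x , x∈ , eq

  -- An opening gives a name at most one key, so its index vector is a function of the name.
  -- Collecting these vectors over `A` bounds the number of opened indices even if `O` lists an
  -- entry repeatedly.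
  firstIdx : List (Name × Key) → Name → List ℕ
  firstIdx []                   a = []
  firstIdx ((a' , (x , u)) ∷ O) a with a ≟ a'
  ... | yes _ = u
  ... | no  _ = firstIdx O a

  firstIdx-∈ : ∀ O {a k} → (a , k) ∈ O → ∃ λ x → (a , (x , firstIdx O a)) ∈ O
  firstIdx-∈ ((a' , (x , u)) ∷ O) {a} p with a ≟ a'
  ... | yes refl = x , here refl
  ... | no ne with p
  ...   | here refl = ⊥-elim (ne refl)
  ...   | there q   = let (y , r) = firstIdx-∈ O q in y , there r

  firstIdx-length : ∀ O {D} → (∀ {a k} → (a , k) ∈ O → length (proj₂ k) ≤ D) → ∀ a → length (firstIdx O a) ≤ D
  firstIdx-length [] h a = z≤n
  firstIdx-length ((a' , (x , u)) ∷ O) h a with a ≟ a'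
  ... | yes _ = h (here refl)
  ... | no _  = firstIdx-length O (h ∘ there) a

  module Decide (L₁ L₂ : Limit) where

    -- One list for all families of `L₂`, so that the size of the tests does not depend on the
    -- family that covers. `y₀` and `y₁` receive names and tags that do not occur in the target
    -- instance.
    Y : List ℕ
    Y = y₀ ∷ y₁ ∷ concatMap (allIds ∘ proj₂) (fam L₂)

    Y-ids : ∀ {F T} → (F , T) ∈ fam L₂ → ∀ {x} → x ∈ allIds T → x ∈ Y
    Y-ids p x∈ = there (there (concatMap∈⁺ (allIds ∘ proj₂) p x∈))

    wt₂ : ∀ {F T} → (F , T) ∈ fam L₂ → ∀ {t} → t ∈ T → WfIds Y t
    wt₂ p = fam-ids L₂ Y p (Y-ids p)

    module Source (F₁ : List Name) (T₁ : List Tm) where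

      X : List ℕ
      X = map fr F₁ ++ allIds T₁

      -- The free names of the source are always opened, and only names of `L₂` can be fixed in the
      -- target; other names are not recorded.
      A : List Name
      A = F₁ ++ namesLim L₂

      open Keys X
      open Openings X F₁ A

      Covered : ℕ → List (Name × Key) → Set
      Covered n O = Any (λ FT → ∃ λ τ → ∃ λ m → Coverings.IsCov X T₁ Y (proj₂ FT) (proj₁ FT) O (const n) τ m) (fam L₂)

      -- Each name of `A` opens at most one key, which has at most `sum (map dep X)` indices, so
      -- opened keys use at most `k` indices in all. Beyond these, `n₀` offers the `suc K` copies of
      -- the pigeonhole argument.
      k n₀ : ℕ
      k  = length A * sum (map dep X)
      n₀ = k + suc (length Y * suc (length X))

      univ : ℕ → List (Name × Key)
      univ n = cartesianProduct A (filter nontag? (keys (const n)))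

      ∈univ⁺ : ∀ {n a κ} → a ∈ A → Valid (const n) κ → kind (proj₁ κ) ≢ 2 → (a , κ) ∈ univ n
      ∈univ⁺ a∈ v q = ∈-cartesianProduct⁺ a∈ (∈-filter⁺ nontag? (∈keys⁺ v) q)

      ∈univ⁻ : ∀ n {a κ} → (a , κ) ∈ univ n → a ∈ A × Valid (const n) κ × kind (proj₁ κ) ≢ 2
      ∈univ⁻ n p = let (a∈ , q) = ∈-cartesianProduct⁻ A (filter nontag? (keys (const n))) p
                       (κ∈ , r) = ∈-filter⁻ nontag? {xs = keys (const n)} q in a∈ , ∈keys⁻ κ∈ , r

      fr-valid : ∀ {n a} → a ∈ F₁ → Valid (const n) (κ a)
      fr-valid {a = a} a∈ = ∈-++⁺ˡ (∈-map⁺ fr a∈) , sym (dep-code 0 0 (a ∷ [])) , tt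

      fr-nontag : ∀ a → kind (fr a) ≢ 2
      fr-nontag a e = absurd (trans (sym (kind-code 0 0 (a ∷ []))) e)
        where absurd : 0 ≢ 2
              absurd ()

      module _ (mem₁ : (F₁ , T₁) ∈ fam L₁) where

        wt₁ : ∀ {t} → t ∈ T₁ → WfIds X t
        wt₁ = fam-ids L₁ X mem₁ (∈-++⁺ʳ (map fr F₁))

        -- Inclusion implies that every opening is covered

        module FlatToCov {n O} (op : Opening n O) where
          open Opening op

          -- Names that are not opened are moved beyond the names of `O` and of `L₂`, so that none
          -- of them meets a free name of the larger process by accident.
          N : ℕ
          N = bound (map proj₁ O ++ namesLim L₂)

          φ : Name → Name
          φ = lookO O N

          φ-O : ∀ {a κ} → (a , κ) ∈ O → φ ⌜ κ ⌝ ≡ a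
          φ-O {a} {κ} p with lookO-cases O N ⌜ κ ⌝
          ... | inj₁ (κ' , q , e) = inj (subst (λ k → (φ ⌜ κ ⌝ , k) ∈ O) (sym (⌜⌝-injective e)) q) p
          ... | inj₂ (_ , none)   = ⊥-elim (none p refl)

          small-O : ∀ {a κ c} → (a , κ) ∈ O → a ≢ N + c
          small-O {a} {c = c} p refl = bound≤⇒∉ (m≤m+n N c) (∈-++⁺ˡ (∈-map⁺ proj₁ p))

          φ-inj : Injective _≡_ _≡_ φ
          φ-inj {b} {b'} e with lookO-cases O N b | lookO-cases O N b'
          ... | inj₁ (κ' , q , refl) | inj₁ (κ'' , q' , refl) = cong ⌜_⌝ (func q (subst (λ a → (a , κ'') ∈ O) (sym e) q'))
          ... | inj₁ (κ' , q , _)  | inj₂ (e' , _) = ⊥-elim (small-O q (trans e e'))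
          ... | inj₂ (e' , _) | inj₁ (κ' , q , _) = ⊥-elim (small-O q (trans (sym e) e'))
          ... | inj₂ (e₁ , _) | inj₂ (e₂ , _) = +-cancelˡ-≡ N b b' (trans (sym e₁) (trans e e₂))

          O-φ : ∀ {a κ} → a ∈ namesLim L₂ → φ ⌜ κ ⌝ ≡ a → (a , κ) ∈ O
          O-φ {a} {κ} a∈ e with lookO-cases O N ⌜ κ ⌝
          ... | inj₁ (κ' , q , e') = subst₂ (λ a κ → (a , κ) ∈ O) e (sym (⌜⌝-injective e')) q
          ... | inj₂ (e' , _) = ⊥-elim (bound≤⇒∉ (≤-trans (m≤m+n N ⌜ κ ⌝) (≤-reflexive (trans (sym e') e))) (∈-++⁺ʳ (map proj₁ O) a∈))

          module _ {P₂ : Proc} {E₂ : List Item} (S : Instance L₁ F₁ T₁ n) (C : Canonical L₂ P₂)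
                   (R : Renaming P₂ (Canonical.Ec C) E₂) (s : map (renI φ φ) (Instance.Ec S) ≼ E₂) where
            open Canonical C renaming (n to m)
            open Renaming R

            NameKey TagKey : Key → Set
            NameKey k = proj₁ k ∈ Y × length (proj₂ k) ≡ dep (proj₁ k) × kind (proj₁ k) < 2
            TagKey k = proj₁ k ∈ Y × length (proj₂ k) ≡ dep (proj₁ k) × kind (proj₁ k) ≡ 2

            wfKey : ∀ {t v x} → t ∈ T → length v ≡ proj₁ t → x ∈ idsI (proj₂ t) → x ∈ Y × length (take (dep x) v) ≡ dep x
            wfKey {v = v} t∈ l x∈ = let (y∈ , d≤) = WfIds.ids (wt₂ mem t∈) x∈ in
              y∈ , length-take-≤ _ v (≤-trans d≤ (≤-reflexive (sym l)))

            nameKey : ∀ {c} → c ∈ namesE Ec → ∃ λ k → c ≡ ⌜ k ⌝ × NameKey k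
            nameKey c∈ = let (t , t∈ , v , l , x , x∈ , e) = ∈names-Can sub c∈
                             (y∈ , l') = wfKey t∈ l (∈-++⁺ʳ (tagsI (proj₂ t)) x∈)
                         in key v x , e , y∈ , l' , proj₁ (fam-kinds L₂ mem t∈) x∈

            tagKey : ∀ {c} → c ∈ tagsE Ec → ∃ λ k → c ≡ ⌜ k ⌝ × TagKey k
            tagKey c∈ = let (t , t∈ , v , l , x , x∈ , e) = ∈tags-Can sub c∈
                            (y∈ , l') = wfKey t∈ l (∈-++⁺ˡ x∈)
                        in key v x , e , y∈ , l' , proj₂ (fam-kinds L₂ mem t∈) x∈

            name≢y₀ : ∀ k → NameKey k → proj₁ k ≢ y₀
            name≢y₀ k (_ , _ , q) refl = <⇒≱ q (≤-trans (s≤s (s≤s z≤n)) (≤-reflexive (sym (kind-code 1 3 []))))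

            tag≢y₁ : ∀ k → TagKey k → proj₁ k ≢ y₁
            tag≢y₁ k (_ , _ , q) refl = absurd (trans (sym q) (kind-code 1 4 []))
              where absurd : 2 ≢ 4
                    absurd ()

            module _ (NI : Inverse θ (namesE Ec) y₀ NameKey) (TI : Inverse σ (tagsE Ec) y₁ TagKey) where
              open Inverse NI
              open Inverse TI renaming (χ to χt; χ-inv to χt-inv; χ-inj to χt-inj; χ-key to χt-key)

              χ-key′ : ∀ b → ∃ λ k → χ b ≡ ⌜ k ⌝ × proj₁ k ∈ Y × length (proj₂ k) ≡ dep (proj₁ k) × (kind (proj₁ k) < 2 ⊎ kind (proj₁ k) ≡ 3)
              χ-key′ b with χ-key b
              ... | k , e , inj₁ (y∈ , l , q) = k , e , y∈ , l , inj₁ q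
              ... | k , e , inj₂ (i , refl)   = k , e , here refl , sym (dep-code 1 3 []) , inj₂ (kind-code 1 3 [])

              χt-key′ : ∀ b → ∃ λ k → χt b ≡ ⌜ k ⌝ × proj₁ k ∈ Y × length (proj₂ k) ≡ dep (proj₁ k) × (kind (proj₁ k) ≡ 2 ⊎ kind (proj₁ k) ≡ 4)
              χt-key′ b with χt-key b
              ... | k , e , inj₁ (y∈ , l , q) = k , e , y∈ , l , inj₁ q
              ... | k , e , inj₂ (i , refl)   = k , e , there (here refl) , sym (dep-code 1 4 []) , inj₂ (kind-code 1 4 [])

              undo : map (renI χ χt) E₂ ≡ Ec
              undo = trans (cong (map (renI χ χt)) eq) (trans (renE-∘ χ θ χt σ Ec) (trans (renE-cong Ec χ-inv χt-inv) (renE-id Ec)))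

              emb : ∀ {t v} → t ∈ T₁ → length v ≡ proj₁ t → InR (const n) v → Ok (Can m T) (renI (χ ∘ φ) (χt ∘ φ) (inst v (proj₂ t)))
              emb {t} {v} t∈ l p = subst (Ok (Can m T)) (renI-∘ χ φ χt φ (inst v (proj₂ t)))
                (Ok-⊆ {e = renI χ χt (renI φ φ (inst v (proj₂ t)))} sub (subst (λ E → Ok E (renI χ χt (renI φ φ (inst v (proj₂ t))))) undo
                  (Ok-ren χ χt {E₂} {renI φ φ (inst v (proj₂ t))} (λ _ _ → χ-inj)
                    (s (∈-map⁺ (renI φ φ) (Instance.sub S (∈CanR⁺ v t∈ l p)))))))

              covered : Covered n O
              covered = lose mem (_ , m , Forward.covering X T₁ Y T F O n m φ χ χt φ-inj χ-inj χt-inj χ-key′ χt-key′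
                (λ {a} a∈ → trans (cong χ (sym (θ-κ (F⇒fv a∈)))) (χ-inv (κ∈ (F⇒fv a∈))))
                (λ p → φ-O p , proj₂ (proj₂ (dom p))) (λ a∈ → O-φ (proj₂ (fam⁻ L₂ mem) a∈)) (fam-kinds L₁ mem₁) emb)

            coveredInv : Covered n O
            coveredInv = covered (inverse θ (namesE Ec) y₀ NameKey θ-inj nameKey (λ {k} → name≢y₀ k)) (inverse σ (tagsE Ec) y₁ TagKey σ-inj tagKey (λ {k} → tag≢y₁ k))

          flat⇒cov : FlatIncl L₁ L₂ → Covered n O
          flat⇒cov incl = go (incl (Instance.ins S) (realize φ φ (Instance.can S) φ-inj φ-inj (λ a∈ → φ-O (rigid (Instance.fv⇒F S a∈)))))
            where
              S = instanceOf L₁ n mem₁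
              go : (∃ λ P' → ∃ λ E' → InstL L₂ P' × FlatOf P' E' × map (renI φ φ) (Instance.Ec S) ≼ E') → Covered n O
              go (P₂ , E₂ , i₂ , fl₂ , s) = coveredInv S (canonical i₂) (canonRenaming (Canonical.can (canonical i₂)) fl₂) s

        -- The indices of opened keys can be renamed injectively to numbers below k.
        module Reduce {n O} (op : Opening n O) where
          open Opening op

          S : List ℕ
          S = concatMap (firstIdx O) A

          S≤ : length S ≤ k
          S≤ = length-concatMap-≤ (firstIdx O) A (λ {a} _ → firstIdx-length O
            (λ p → let (_ , (x∈ , l , _) , _) = dom p in ≤-trans (≤-reflexive l) (∈⇒≤sum dep x∈)) a)

          π : ℕ → ℕ
          π = reindex k S

          move : Key → Key
          move (x , u) = x , map π u

          move-inj : ∀ {κ κ'} → move κ ≡ move κ' → κ ≡ κ'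
          move-inj e = cong₂ _,_ (,-injectiveˡ e) (map-injective (reindex-injective S S≤) (,-injectiveʳ e))

          moved : List (Name × Key)
          moved = map (λ (a , κ) → a , move κ) O

          O' : List (Name × Key)
          O' = filter (_∈ᵒ? moved) (univ k)

          idx⊆S : ∀ {a κ} → (a , κ) ∈ O → ∀ {i} → i ∈ proj₂ κ → i ∈ S
          idx⊆S {a} p i∈ = let (x , q) = firstIdx-∈ O p in
            concatMap∈⁺ (firstIdx O) (proj₁ (dom p)) (subst (_ ∈_) (cong proj₂ (func p q)) i∈)

          ∈O'⁺ : ∀ {a κ} → (a , κ) ∈ O → (a , move κ) ∈ O'
          ∈O'⁺ {a} {x , u} p = let (a∈ , (x∈ , l , _) , nt) = dom p in
            ∈-filter⁺ (_∈ᵒ? moved) (∈univ⁺ a∈ (x∈ , trans (length-map π u) l , All⇒InR (map π u) (All.tabulate λ i∈ →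
              let (s , s∈ , e) = ∈-map⁻ π i∈ in subst (_< k) (sym e) (reindex-∈ {S = S} S≤ (idx⊆S p s∈)))) nt)
              (∈-map⁺ (λ (a , κ) → a , move κ) p)

          ∈O'⁻ : ∀ {a κ'} → (a , κ') ∈ O' → ∃ λ κ → (a , κ) ∈ O × κ' ≡ move κ
          ∈O'⁻ p with ∈-map⁻ (λ (a , κ) → a , move κ) (proj₂ (∈-filter⁻ (_∈ᵒ? moved) {xs = univ k} p))
          ... | (a , κ) , q , refl = κ , q , refl

          dom' : ∀ {a κ'} → (a , κ') ∈ O' → a ∈ A × Valid (const k) κ' × kind (proj₁ κ') ≢ 2
          dom' p = ∈univ⁻ k (proj₁ (∈-filter⁻ (_∈ᵒ? moved) {xs = univ k} p))

          opening' : Opening k O'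
          opening' = record { dom = dom' ; func = func' ; inj = inj' ; rigid = λ a∈ → ∈O'⁺ (rigid a∈) }
            where
              func' : ∀ {a κ κ'} → (a , κ) ∈ O' → (a , κ') ∈ O' → κ ≡ κ'
              func' p q with ∈O'⁻ p | ∈O'⁻ q
              ... | _ , p' , refl | _ , q' , refl = cong move (func p' q')
              inj' : ∀ {a a' κ} → (a , κ) ∈ O' → (a' , κ) ∈ O' → a ≡ a'
              inj' p q with ∈O'⁻ p | ∈O'⁻ q
              ... | κ₁ , p' , refl | κ₂ , q' , e = inj p' (subst (λ κ → (_ , κ) ∈ O) (sym (move-inj e)) q')

          InR-move : ∀ v → InR (const n) v → InR (const (k + n)) (map π v)
          InR-move v p = All⇒InR (map π v) (All.tabulate λ i∈ → let (s , s∈ , e) = ∈-map⁻ π i∈ in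
            subst (_< k + n) (sym e) (≤-<-trans (reindex-≤ {S = S} s S≤) (+-monoʳ-< k (All.lookup (InR⇒All v p) s∈))))

          -- `move` is injective on keys and commutes with the truncation of index vectors, so
          -- composing a covering with it gives a covering for the opening before renaming.
          pullBack : ∀ {F₂ T₂ τ m} → (F₂ , T₂) ∈ fam L₂ → Coverings.IsCov X T₁ Y T₂ F₂ O' (const (k + n)) τ m →
                     Coverings.IsCov X T₁ Y T₂ F₂ O (const n) (τ ∘ move) m
          pullBack {F₂} {T₂} {τ} {m} mem c = record
              { wf = λ v → IsCov.wf c (val v)
              ; inj = λ v v' e → move-inj (IsCov.inj c (val v) (val v') e)
              ; rig = λ {κ'} {a} v a∈ → (λ o → proj₁ (IsCov.rig c (val v) a∈) (∈O'⁺ o)) ,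
                  (λ e → back (∈O'⁻ (proj₂ (IsCov.rig c (val v) a∈) e)))
              ; ok = λ {t} {v} t∈ l p → subst (Ok (Can m T₂))
                  (renI-cong′ (proj₂ t) (λ {x} _ → cong (λ u → ⌜ τ (x , u) ⌝) (take-map {f = π} (dep x) v)))
                  (IsCov.ok c t∈ (trans (length-map π v) l) (InR-move v p)) }
            where
              open Coverings X T₁ Y T₂ F₂
              val : ∀ {κ'} → Valid (const n) κ' → Valid (const (k + n)) (move κ')
              val {x , u} (x∈ , l , p) = x∈ , trans (length-map π u) l , InR-move u p
              back : ∀ {a κ'} → (∃ λ κ → (a , κ) ∈ O × move κ' ≡ move κ) → (a , κ') ∈ O
              back (κ , q , e) = subst (λ κ → (_ , κ) ∈ O) (sym (move-inj e)) q

          reduce : Covered n₀ O' → Covered n O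
          reduce cov = go (find cov)
            where
              go : (∃ λ FT → FT ∈ fam L₂ × (∃ λ τ → ∃ λ m → Coverings.IsCov X T₁ Y (proj₂ FT) (proj₁ FT) O' (const n₀) τ m)) → Covered n O
              go ((F₂ , T₂) , mem , τ , m , c) =
                -- `move` sends an index `s` to at most `k + s`, so `k + n` copies contain the moved
                -- keys of `n` copies.
                let (τ' , m' , c') = Cover.pumpAll X T₁ Y T₂ F₂ wt₁ (wt₂ mem) {O'} {k} {n₀} ≤-refl
                                       (λ {a} {x} {u} p → InR⇒All u (proj₂ (proj₂ (proj₁ (proj₂ (dom' p)))))) c (k + n)
                in lose mem (τ' ∘ move , m' , pullBack mem c')

      Test : Set
      Test = ∀ {O} → O ∈ sublists (univ k) → Opening k O → Covered n₀ O

      Functional Injection Rigid : List (Name × Key) → Set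
      Functional O = ∀ {pq} → pq ∈ cartesianProduct O O → proj₁ (proj₁ pq) ≡ proj₁ (proj₂ pq) → proj₂ (proj₁ pq) ≡ proj₂ (proj₂ pq)
      Injection O  = ∀ {pq} → pq ∈ cartesianProduct O O → proj₂ (proj₁ pq) ≡ proj₂ (proj₂ pq) → proj₁ (proj₁ pq) ≡ proj₁ (proj₂ pq)
      Rigid O      = ∀ {a} → a ∈ F₁ → (a , κ a) ∈ O

      opening? : ∀ {O} → O ∈ sublists (univ k) → Dec (Opening k O)
      opening? {O} O∈ = map′ to from
        (dec-∀∈ {P = λ pq → proj₁ (proj₁ pq) ≡ proj₁ (proj₂ pq) → proj₂ (proj₁ pq) ≡ proj₂ (proj₂ pq)} (cartesianProduct O O)
            (λ {pq} _ → (proj₁ (proj₁ pq) ≟ proj₁ (proj₂ pq)) →-dec (proj₂ (proj₁ pq) ≟ᵏ proj₂ (proj₂ pq)))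
         ×-dec (dec-∀∈ {P = λ pq → proj₂ (proj₁ pq) ≡ proj₂ (proj₂ pq) → proj₁ (proj₁ pq) ≡ proj₁ (proj₂ pq)} (cartesianProduct O O)
            (λ {pq} _ → (proj₂ (proj₁ pq) ≟ᵏ proj₂ (proj₂ pq)) →-dec (proj₁ (proj₁ pq) ≟ proj₁ (proj₂ pq)))
         ×-dec dec-∀∈ {P = λ a → (a , κ a) ∈ O} F₁ (λ {a} _ → (a , κ a) ∈ᵒ? O)))
        where
          to : Functional O × Injection O × Rigid O → Opening k O
          to (f , i , r) = record
            { dom = λ p → ∈univ⁻ k (∈sublists⇒⊆ (univ k) O∈ p)
            ; func = λ p q → f (∈-cartesianProduct⁺ p q) refl
            ; inj = λ p q → i (∈-cartesianProduct⁺ p q) refl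
            ; rigid = r }
          from : Opening k O → Functional O × Injection O × Rigid O
          from op = func′ , inj′ , Opening.rigid op
            where
              func′ : Functional O
              func′ p refl = let (q , q') = ∈-cartesianProduct⁻ O O p in Opening.func op q q'
              inj′ : Injection O
              inj′ p refl = let (q , q') = ∈-cartesianProduct⁻ O O p in Opening.inj op q q'

      test? : (F₁ , T₁) ∈ fam L₁ → Dec Test
      test? mem₁ = dec-∀∈ (sublists (univ k)) (λ {O} O∈ → opening? O∈ →-dec
        dec-Any∈ (fam L₂) (λ {FT} mem₂ → Cover.cov? X T₁ Y (proj₂ FT) (proj₁ FT) (wt₁ mem₁) (wt₂ mem₂) O (const n₀)))

    open Source using (Test)

    -- Passing all tests implies inclusion

    module CovToFlat (tests : ∀ {FT} → FT ∈ fam L₁ → Test (proj₁ FT) (proj₂ FT)) {P : Proc} {E : List Item}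
                     (C : Canonical L₁ P) (R : Renaming P (Canonical.Ec C) E) where
      open Canonical C
      open Renaming R
      open Source F T hiding (Test)
      open Keys X
      open Openings X F A

      φ φt : Name → Name
      φ  = extend θ (namesE Ec)
      φt = extend σ (tagsE Ec)

      φ-inj : Injective _≡_ _≡_ φ
      φ-inj = extend-injective θ (namesE Ec) θ-inj

      -- The opening read off from the given flattening: all keys of names to which it assigns a
      -- name of `A`.
      O : List (Name × Key)
      O = filter (λ (a , κ) → φ ⌜ κ ⌝ ≟ a) (univ n)

      O⁻ : ∀ {a κ} → (a , κ) ∈ O → (a ∈ A × Valid (const n) κ × kind (proj₁ κ) ≢ 2) × φ ⌜ κ ⌝ ≡ a
      O⁻ p = let (q , e) = ∈-filter⁻ (λ (a , κ) → φ ⌜ κ ⌝ ≟ a) {xs = univ n} p in ∈univ⁻ n q , e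

      O⁺ : ∀ {a κ} → a ∈ A → Valid (const n) κ → kind (proj₁ κ) ≢ 2 → φ ⌜ κ ⌝ ≡ a → (a , κ) ∈ O
      O⁺ a∈ v q e = ∈-filter⁺ (λ (a , κ) → φ ⌜ κ ⌝ ≟ a) (∈univ⁺ a∈ v q) e

      opening : Opening n O
      opening = record
        { dom = proj₁ ∘ O⁻
        ; func = λ p q → ⌜⌝-injective (φ-inj (trans (proj₂ (O⁻ p)) (sym (proj₂ (O⁻ q)))))
        ; inj = λ p q → trans (sym (proj₂ (O⁻ p))) (proj₂ (O⁻ q))
        ; rigid = λ {a} a∈ → O⁺ (∈-++⁺ˡ a∈) (fr-valid {n} a∈) (fr-nontag a)
            (trans (extend-∈ θ (namesE Ec) (κ∈ (F⇒fv a∈))) (θ-κ (F⇒fv a∈))) }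

      isCovered : Covered n O
      isCovered = Reduce.reduce mem opening (tests mem (filter∈sublists _ (univ k)) (Reduce.opening' mem opening))

      conclude : ∀ {F₂ T₂ τ m} → (F₂ , T₂) ∈ fam L₂ → Coverings.IsCov X T Y T₂ F₂ O (const n) τ m →
                 ∃ λ P' → ∃ λ E' → InstL L₂ P' × FlatOf P' E' × E ≼ E'
      conclude {F₂} {T₂} {τ} {m} mem₂ c = Instance.P S , _ , Instance.ins S ,
          realize ψ ψt (Instance.can S) ψ-injective ψt-injective (λ a∈ → ψ-κ (Instance.fv⇒F S a∈)) , emb
        where
          S = instanceOf L₂ m mem₂
          open Backward X T Y T₂ F₂ (wt₁ mem) (wt₂ mem₂) O n m τ c φ φt φ-inj (extend-injective σ (tagsE Ec) σ-inj)
            (λ p → proj₂ (O⁻ p)) (λ a∈ v q e → O⁺ (∈-++⁺ʳ F (proj₂ (fam⁻ L₂ mem₂) a∈)) v q e) (fam-kinds L₁ mem)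
          emb₀ : ∀ {e₀} → e₀ ∈ Ec → Ok (map (renI ψ ψt) (Instance.Ec S)) (renI θ σ e₀)
          emb₀ {e₀} e₀∈ with ∈CanR⁻ T (sub e₀∈)
          ... | t , v , t∈ , l , p , refl = subst (Ok (map (renI ψ ψt) (Instance.Ec S)))
                (renI-cong (inst v (proj₂ t)) (λ a∈ → extend-∈ θ (namesE Ec) (concatMap∈⁺ namesI e₀∈ a∈))
                  (λ a∈ → extend-∈ σ (tagsE Ec) (concatMap∈⁺ tagsI e₀∈ a∈)))
                (embedding (Instance.sub S) t∈ l p)
          emb : E ≼ map (renI ψ ψt) (Instance.Ec S)
          emb {e} e∈ = let (e₀ , e₀∈ , q) = ∈-map⁻ (renI θ σ) (subst (e ∈_) eq e∈) in subst (Ok _) (sym q) (emb₀ e₀∈)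

      result : ∃ λ P' → ∃ λ E' → InstL L₂ P' × FlatOf P' E' × E ≼ E'
      result = go (find isCovered)
        where
          go : (∃ λ FT → FT ∈ fam L₂ × (∃ λ τ → ∃ λ m → Coverings.IsCov X T Y (proj₂ FT) (proj₁ FT) O (const n) τ m)) →
               ∃ λ P' → ∃ λ E' → InstL L₂ P' × FlatOf P' E' × E ≼ E'
          go (_ , mem₂ , _ , _ , c) = conclude mem₂ c

    Tests : Set
    Tests = ∀ {FT} → FT ∈ fam L₁ → Test (proj₁ FT) (proj₂ FT)

    inclusion? : Dec (DenotIncl L₁ L₂)
    inclusion? = map′ to from (dec-∀∈ {P = λ FT → Test (proj₁ FT) (proj₂ FT)} (fam L₁) (λ {FT} mem₁ → Source.test? (proj₁ FT) (proj₂ FT) mem₁))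
      where
        to : Tests → DenotIncl L₁ L₂
        to tests = FlatIncl⇒DenotIncl (λ i fl → CovToFlat.result tests (canonical i) (canonRenaming (Canonical.can (canonical i)) fl))
        from : DenotIncl L₁ L₂ → Tests
        from incl {FT} mem₁ {O} _ op = Source.FlatToCov.flat⇒cov (proj₁ FT) (proj₂ FT) mem₁
          (Openings.opening-mono (Source.X (proj₁ FT) (proj₂ FT)) (proj₁ FT) (Source.A (proj₁ FT) (proj₂ FT)) (m≤m+n _ _) op) (DenotIncl⇒FlatIncl incl)

theorem22 : (I : IntruderModel) (L₁ L₂ : LimitOf I) → Dec (DenotationIncluded I L₁ L₂)
theorem22 I L₁ L₂ = Decide.inclusion? I L₁ L₂
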